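{- There is an absolute constant $C>0$ such that the following holds. Let $m\geq 3$, $n\geq 1$, $\epsilon\geq 0$, and let $f:S_m^n\to S_m$ be $\epsilon$-IR, i.e. $$\sum_{i\in[n],\,j\in[m]}\Pr_{x^{ -i}\in S_m^{n-1},\,x_i,y_i\in S_m}\Big[\big(x_i^{ -1}(j)=y_i^{ -1}(j)\big)\wedge\big(f(x^{ -i},x_i)^{ -1}(j)\neq f(x^{ -i},y_i)^{ -1}(j)\big)\Big]\leq\epsilon,$$ where $x^{ -i},x_i,y_i$ are independent and uniform. Then there is a function $h:S_m^n\to S_m$ which is either constant or of the form $h(x)=x_i\circ y$ (i.e. $h(x)(r)=x_i(y(r))$) for some voter $i\in[n]$ and some $y\in S_m$, such that $$\mathbb{E}_{x\in S_m^n}\big\|P(f(x))-P(h(x))\big\|_F^2\leq C\,m^8\,\epsilon,$$ with $x$ uniform on $S_m^n$.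
   Context: $S_m$ is the symmetric group on $[m]$; a ranking $x\in S_m$ uses the convention $x(\text{rank})=\text{name}$, so $x^{ -1}(j)$ is the rank of alternative $j$. A profile is $x=(x_1,\dots,x_n)\in S_m^n$, and $(x^{ -i},y_i)$ is the profile with $x_i$ replaced by $y_i$. $\circ$ is ordinary composition. For $z\in S_m$, $P(z)$ is the $m\times m$ permutation matrix $P(z)_{ab}=\mathbf 1_{z(a)=b}$, and $\|\cdot\|_F$ is the Frobenius norm. (The quantity $\|P(a)-P(b)\|_F^2$ equals $\|\rho^1(a)-\rho^1(b)\|_F^2$, where $\rho^1$ is the standard $(m-1)$-dimensional orthogonal representation of $S_m$, which is the encoding the paper uses.) -}

module Defs where

open import Data.Nat using (ℕ; zero; suc; _*_; _^_; ∣_-_∣)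
open import Data.Fin using (Fin; zero; suc; _≟_)
open import Data.Vec using (Vec; []; _∷_; lookup; _[_]≔_)
open import Data.List using (List; []; _∷_; map; concatMap; length; allFin; mapMaybe; filterᵇ)
open import Data.Bool.ListAction using (all; any)
open import Data.Nat.ListAction using (sum)
open import Data.Bool using (Bool; true; false; T; if_then_else_; _∧_; not)
open import Data.Maybe using (Maybe; just; nothing)
import Data.Maybe as Maybe
import Data.Maybe.Properties as MaybeP
open import Data.Product using (Σ; _,_; proj₁; _×_)
open import Data.Sum using (_⊎_)
open import Data.Unit using (tt)
open import Data.Integer using (+_)
open import Data.Rational using (ℚ; 0ℚ; _/_; _+_)
open import Relation.Nullary.Decidable using (⌊_⌋)
open import Relation.Binary.PropositionalEquality using (_≡_; subst; sym)

-- A ranking in S_m: vector indexed by rank, entry = name (x(rank) = name),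
-- required to be a bijection (every name occurs), checked by a Bool test
-- so that the proof component is proof-irrelevant (T true = ⊤).
isPermB : ∀ {m} → Vec (Fin m) m → Bool
isPermB {m} v = all (λ j → any (λ r → ⌊ lookup v r ≟ j ⌋) (allFin m)) (allFin m)

Perm : ℕ → Set
Perm m = Σ (Vec (Fin m) m) (λ v → T (isPermB v))

app : ∀ {m} → Perm m → Fin m → Fin m
app x r = lookup (proj₁ x) r

Profile : ℕ → ℕ → Set
Profile m n = Vec (Perm m) n

allVecs : ∀ {A : Set} → List A → (k : ℕ) → List (Vec A k)
allVecs as zero = [] ∷ []
allVecs as (suc k) = concatMap (λ a → map (a ∷_) (allVecs as k)) as

toPerm : ∀ {m} → Vec (Fin m) m → Maybe (Perm m)
toPerm v with isPermB v in eq
... | true = just (v , subst T (sym eq) tt)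
... | false = nothing

allPerms : (m : ℕ) → List (Perm m)
allPerms m = mapMaybe toPerm (allVecs (allFin m) m)

allProfiles : (m n : ℕ) → List (Profile m n)
allProfiles m n = allVecs (allPerms m) n

-- inverse: rank of name j (always 'just' for a permutation)
rankV : ∀ {m k} → Vec (Fin m) k → Fin m → Maybe (Fin k)
rankV [] j = nothing
rankV (a ∷ v) j = if ⌊ a ≟ j ⌋ then just zero else Maybe.map suc (rankV v j)

inv : ∀ {m} → Perm m → Fin m → Maybe (Fin m)
inv x j = rankV (proj₁ x) j

eqMF : ∀ {m} → Maybe (Fin m) → Maybe (Fin m) → Bool
eqMF a b = ⌊ MaybeP.≡-dec _≟_ a b ⌋

count : ∀ {A : Set} → (A → Bool) → List A → ℕ
count p xs = length (filterᵇ p xs)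

-- c / t as a rational (t = 0 never occurs for our nonempty sample spaces)
frac : ℕ → ℕ → ℚ
frac c zero = 0ℚ
frac c (suc t) = (+ c) / suc t

sumℚ : List ℚ → ℚ
sumℚ [] = 0ℚ
sumℚ (q ∷ qs) = q + sumℚ qs

-- Uniform probability of event E(x, y) with x uniform on S_m^n (this is
-- (x^{-i}, x_i)) and y uniform on S_m, all independent.
PrPair : (m n : ℕ) → (Profile m n → Perm m → Bool) → ℚ
PrPair m n E =
  frac (count (λ p → E (proj₁ p) (Data.Product.proj₂ p))
              (concatMap (λ x → map (λ y → (x , y)) (allPerms m)) (allProfiles m n)))
       (length (allProfiles m n) * length (allPerms m))

IRsum : (m n : ℕ) → (Profile m n → Perm m) → ℚ
IRsum m n f =
  sumℚ (concatMap (λ i → map (λ j →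
    PrPair m n (λ x y →
      eqMF (inv (lookup x i) j) (inv y j)
      ∧ not (eqMF (inv (f x) j) (inv (f (x [ i ]≔ y)) j))))
    (allFin m)) (allFin n))

PM : ∀ {m} → Perm m → Fin m → Fin m → ℕ
PM z a b = if ⌊ app z a ≟ b ⌋ then 1 else 0

frob2 : ∀ {m} → Perm m → Perm m → ℕ
frob2 {m} z w = sum (concatMap (λ a → map (λ b → ∣ PM z a b - PM w a b ∣ ^ 2) (allFin m)) (allFin m))

ExpDist : (m n : ℕ) → (Profile m n → Perm m) → (Profile m n → Perm m) → ℚ
ExpDist m n f h =
  frac (sum (map (λ x → frob2 (f x) (h x)) (allProfiles m n))) (length (allProfiles m n))

ConstOrDictator : (m n : ℕ) → (Profile m n → Perm m) → Set
ConstOrDictator m n h =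
  Σ (Perm m) (λ y → ∀ x r → app (h x) r ≡ app y r)
  ⊎ Σ (Fin n) (λ i → Σ (Perm m) (λ y → ∀ x r → app (h x) r ≡ app (lookup x i) (app y r)))

{-# OPTIONS --safe #-}

-- Resampling the voters one at a time, the rank F_j(x) = f(x)⁻¹(j) equals, up to probability O(mε),
-- a function g_j of the column c_j = (x_i⁻¹(j))_i. Exchange j with k at a set of voters and j with l
-- at a disjoint set: the other ranks of f(x) stay put, so the values of g_j at the four resulting
-- profiles form a square, {g(u,v), g(u′,v′)} = {g(u′,v), g(u,v′)} as multisets. For a random
-- partition of the voters this forces the indicators of g to have almost all their variance on
-- Efron–Stein level one. Moreover the two halves of the voters cannot both be influential, so the
-- products wᵢ wₖ (i ≠ k) of the level-one weights are small: either one voter carries the level-one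
-- weight, or the total weight is small. In the latter case g is almost constant: a set of small
-- measure p has level-one weight at most about p/2, by a fourth moment bound for sums of
-- independent functions, whereas here it is p(1 − p) up to O(mε). So each F_j is close to a
-- function η_j of the rank of j for a single voter, and exchanging two alternatives at one voter
-- shows that either all η_j are constant or they share both the voter and the function.
module Submission where

open import Defs
open import Data.Nat using (ℕ; zero; suc; _≤_; _^_; z≤n; s≤s)
import Data.Nat as ℕ
import Data.Nat.Properties as ℕP
import Data.Nat.ListAction as ℕL
import Data.Nat.ListAction.Properties as ℕL
open import Data.Product using (Σ; _×_; _,_; proj₁; proj₂; ∃)
open import Data.Sum using (_⊎_; inj₁; inj₂)
open import Data.Empty using (⊥; ⊥-elim)
open import Data.Unit using (⊤; tt)
open import Data.Bool using (Bool; true; false; T; if_then_else_; not; _∧_)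
import Data.Bool.Properties as BoolP
open import Data.Maybe using (Maybe; just; nothing; maybe)
open import Data.Integer using (+_)
import Data.Integer as ℤ
open import Data.Fin using (Fin; zero; suc)
import Data.Fin as Fin
import Data.Fin.Properties as FinP
open import Data.Fin.Permutation.Components using (transpose; transpose-inverse)
open import Data.Vec using (Vec; []; _∷_; lookup; zipWith; _[_]≔_; tabulate)
import Data.Vec as Vec
import Data.Vec.Properties as VecP
open import Data.List using (List; []; _∷_; _++_; map; concatMap; length; allFin; mapMaybe)
import Data.List as List
import Data.List.Properties as ListP
import Data.List.Relation.Unary.All.Properties as AllP
import Data.List.Relation.Unary.Any.Properties as AnyP
open import Data.Rational using (ℚ; 0ℚ; 1ℚ; ½; _/_; _+_; _*_; _-_; -_)
import Data.Rational as ℚ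
open import Data.Rational.Properties using (+-*-commutativeRing; ≤-refl; ≤-trans; ≤-reflexive; <-≤-trans; ≤-<-trans; <⇒≤; ≰⇒>; ≮⇒≥; <-irrefl)
import Data.Rational.Properties as ℚP
import Data.Rational.Unnormalised as ℚᵘ
open import Function using (_∘_; id)
open import Relation.Nullary using (Dec; yes; no; ¬_; contradiction)
open import Relation.Nullary.Decidable using (⌊_⌋; ¬?; _×-dec_; _⊎-dec_; toWitness; fromWitness)
open import Relation.Binary.PropositionalEquality
open import Tactic.RingSolver using (solve-∀)
open import Tactic.RingSolver.Core.AlmostCommutativeRing using (AlmostCommutativeRing; fromCommutativeRing)

-- Everything stays in ℚ, so hypercontractivity and roots are avoided: norms remain squared, and the
-- level-one bound for small sets comes from a polynomial inequality and a fourth moment. A single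
-- column of a uniform profile is uniform on a product space whose atoms have measure 1/m; the
-- analysis takes place there. Two partners `k` ≠ `l` of `j` are required so that an exchange of `j`
-- with `l` leaves the column of `k` alone, which takes three alternatives. A fixed partition sees
-- only the interaction across it; averaging over a random one tells level one from higher levels.
-- Powers of m: conditioning on a rank costs m, so failure of the column description has probability
-- at most mε. Replacing a column by one voter costs m, because the case distinction is drawn at
-- total weight 1/(64m). The union over alternatives costs m, and the squared norm m². Rounding
-- needs an error below 1/(2m²). If that is not granted, the trivial bound m² times a quantity of
-- order m⁵ε gives m⁷ε, within m⁸ε.

ringℚ : AlmostCommutativeRing _ _
ringℚ = fromCommutativeRing +-*-commutativeRing isZero
  where
  isZero : (x : ℚ) → Maybe (0ℚ ≡ x)
  isZero x with 0ℚ ℚP.≟ x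
  ... | yes p = just p
  ... | no _ = nothing

-- Ordered arithmetic, natural numbers and indicators in ℚ

+-congˡ : ∀ a {b c} → b ≡ c → a + b ≡ a + c
+-congˡ a = cong (λ z → a + z)

nat : ℕ → ℚ
nat n = + n / 1

lit : ∀ q {_ : T (0ℚ ℚ.≤ᵇ q)} → 0ℚ ℚ.≤ q
lit q {h} = ℚP.≤ᵇ⇒≤ h

0≤+ : ∀ {p q} → 0ℚ ℚ.≤ p → 0ℚ ℚ.≤ q → 0ℚ ℚ.≤ p + q
0≤+ hp hq = ≤-trans (≤-reflexive (sym (ℚP.+-identityʳ 0ℚ))) (ℚP.+-mono-≤ hp hq)

*-monoˡ : ∀ {p q} r → 0ℚ ℚ.≤ r → p ℚ.≤ q → r * p ℚ.≤ r * q
*-monoˡ r hr h = ℚP.*-monoˡ-≤-nonNeg r {{ℚ.nonNegative hr}} h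

0≤* : ∀ {p q} → 0ℚ ℚ.≤ p → 0ℚ ℚ.≤ q → 0ℚ ℚ.≤ p * q
0≤* {p} hp hq = ≤-trans (≤-reflexive (sym (ℚP.*-zeroʳ p))) (*-monoˡ p hp hq)

0≤sub : ∀ {p q} → p ℚ.≤ q → 0ℚ ℚ.≤ q - p
0≤sub {p} {q} h = ≤-trans (≤-reflexive (sym (ℚP.+-inverseʳ p))) (ℚP.+-monoˡ-≤ (- p) h)

-- The certificate form of the polynomial inequalities below: the difference is written as a
-- combination of visibly nonnegative terms, and the ring solver checks the identity.
by-nonneg : ∀ {p q e} → 0ℚ ℚ.≤ e → e ≡ q - p → p ℚ.≤ q
by-nonneg {p} {q} h refl = ≤-trans (≤-reflexive (sym (ℚP.+-identityˡ p)))
  (≤-trans (ℚP.+-monoˡ-≤ p h) (≤-reflexive (cancel q p)))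
  where
  cancel : ∀ q p → q - p + p ≡ q
  cancel = solve-∀ ringℚ

0≤sq : ∀ p → 0ℚ ℚ.≤ p * p
0≤sq p with ℚP.≤-total 0ℚ p
... | inj₁ h = 0≤* h h
... | inj₂ h = ≤-trans (0≤* (0≤sub h) (0≤sub h)) (≤-reflexive (eq p))
  where
  eq : ∀ p → (0ℚ - p) * (0ℚ - p) ≡ p * p
  eq = solve-∀ ringℚ

nat-+ : ∀ a b → nat (a ℕ.+ b) ≡ nat a + nat b
nat-+ a b = ℚP.toℚᵘ-injective (ℚᵘP.≃-trans (ℚP.toℚᵘ-fromℚᵘ (ℚᵘ.mkℚᵘ (+ (a ℕ.+ b)) 0))
  (ℚᵘP.≃-trans step (ℚᵘP.≃-sym (ℚᵘP.≃-trans (ℚP.toℚᵘ-homo-+ (nat a) (nat b))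
    (ℚᵘP.+-cong (ℚP.toℚᵘ-fromℚᵘ (ℚᵘ.mkℚᵘ (+ a) 0)) (ℚP.toℚᵘ-fromℚᵘ (ℚᵘ.mkℚᵘ (+ b) 0)))))))
  where
  import Data.Rational.Unnormalised.Properties as ℚᵘP
  import Data.Integer.Properties as ℤP
  step : ℚᵘ.mkℚᵘ (+ (a ℕ.+ b)) 0 ℚᵘ.≃ ℚᵘ.mkℚᵘ (+ a) 0 ℚᵘ.+ ℚᵘ.mkℚᵘ (+ b) 0
  step = ℚᵘ.*≡* (cong (ℤ._* + 1) (sym (cong₂ ℤ._+_ (ℤP.*-identityʳ (+ a)) (ℤP.*-identityʳ (+ b)))))

frac-*-nat : ∀ c t → frac c (suc t) * nat (suc t) ≡ nat c
frac-*-nat c t = ℚP.toℚᵘ-injective (ℚᵘP.≃-trans (ℚP.toℚᵘ-homo-* (frac c (suc t)) (nat (suc t)))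
  (ℚᵘP.≃-trans (ℚᵘP.*-cong (ℚP.toℚᵘ-fromℚᵘ (ℚᵘ.mkℚᵘ (+ c) t)) (ℚP.toℚᵘ-fromℚᵘ (ℚᵘ.mkℚᵘ (+ suc t) 0)))
    (ℚᵘP.≃-trans step (ℚᵘP.≃-sym (ℚP.toℚᵘ-fromℚᵘ (ℚᵘ.mkℚᵘ (+ c) 0))))))
  where
  import Data.Rational.Unnormalised.Properties as ℚᵘP
  import Data.Integer.Properties as ℤP
  step : ℚᵘ.mkℚᵘ (+ c) t ℚᵘ.* ℚᵘ.mkℚᵘ (+ suc t) 0 ℚᵘ.≃ ℚᵘ.mkℚᵘ (+ c) 0
  step = ℚᵘ.*≡* (trans (ℤP.*-identityʳ (+ c ℤ.* + suc t))
    (cong (λ z → + c ℤ.* + suc z) (sym (ℕP.*-identityʳ t))))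

nat-suc : ∀ n → nat (suc n) ≡ 1ℚ + nat n
nat-suc n = nat-+ 1 n

nat-* : ∀ a b → nat (a ℕ.* b) ≡ nat a * nat b
nat-* zero b = sym (ℚP.*-zeroˡ (nat b))
nat-* (suc a) b = trans (nat-+ b (a ℕ.* b)) (trans (+-congˡ (nat b) (nat-* a b))
  (trans (eq (nat a) (nat b)) (cong (_* nat b) (sym (nat-suc a)))))
  where
  eq : ∀ a b → b + a * b ≡ (1ℚ + a) * b
  eq = solve-∀ ringℚ

0≤nat : ∀ n → 0ℚ ℚ.≤ nat n
0≤nat zero = ≤-refl
0≤nat (suc n) = subst (0ℚ ℚ.≤_) (sym (nat-suc n)) (0≤+ (lit 1ℚ) (0≤nat n))

nat-mono : ∀ {a b} → a ≤ b → nat a ℚ.≤ nat b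
nat-mono {a} {b} h = by-nonneg (0≤nat (b ℕ.∸ a))
  (trans (eq (nat a) (nat (b ℕ.∸ a)))
    (cong (_- nat a) (trans (sym (nat-+ a (b ℕ.∸ a))) (cong nat (ℕP.m+[n∸m]≡n h)))))
  where
  eq : ∀ a b → b ≡ a + b - a
  eq = solve-∀ ringℚ

-- inverse 0 = 0
inverse : ℕ → ℚ
inverse n = frac 1 n

inverse-* : ∀ n → inverse (suc n) * nat (suc n) ≡ 1ℚ
inverse-* n = frac-*-nat 1 n

0≤inverse : ∀ n → 0ℚ ℚ.≤ inverse n
0≤inverse zero = ≤-refl
0≤inverse (suc n) = ℚP.nonNegative⁻¹ (inverse (suc n)) {{ℚP.normalize-nonNeg 1 (suc n)}}

frac-unique : ∀ c t e → nat c ≡ nat (suc t) * e → frac c (suc t) ≡ e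
frac-unique c t e h = trans (sym (lem (frac c (suc t))))
  (trans (cong (_* inverse (suc t)) (trans (frac-*-nat c t) (trans h (ℚP.*-comm (nat (suc t)) e)))) (lem e))
  where
  re : ∀ x n i → x * n * i ≡ x * (i * n)
  re = solve-∀ ringℚ
  lem : ∀ x → x * nat (suc t) * inverse (suc t) ≡ x
  lem x = trans (re x (nat (suc t)) (inverse (suc t)))
    (trans (cong (x *_) (inverse-* t)) (ℚP.*-identityʳ x))

ind : ∀ {ℓ} {P : Set ℓ} → Dec P → ℚ
ind (yes _) = 1ℚ
ind (no _) = 0ℚ

0≤ind : ∀ {ℓ} {P : Set ℓ} (d : Dec P) → 0ℚ ℚ.≤ ind d
0≤ind (yes _) = lit 1ℚ
0≤ind (no _) = ≤-refl

ind≤1 : ∀ {ℓ} {P : Set ℓ} (d : Dec P) → ind d ℚ.≤ 1ℚ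
ind≤1 (yes _) = ≤-refl
ind≤1 (no _) = lit 1ℚ

ind-yes : ∀ {ℓ} {P : Set ℓ} (d : Dec P) → P → ind d ≡ 1ℚ
ind-yes (yes _) _ = refl
ind-yes (no ¬p) p = contradiction p ¬p

ind-no : ∀ {ℓ} {P : Set ℓ} (d : Dec P) → ¬ P → ind d ≡ 0ℚ
ind-no (yes p) ¬p = contradiction p ¬p
ind-no (no _) _ = refl

ind-⇒ : ∀ {ℓ ℓ′} {P : Set ℓ} {Q : Set ℓ′} (d : Dec P) (e : Dec Q) → (P → Q) → ind d ℚ.≤ ind e
ind-⇒ (yes p) e f = ≤-reflexive (sym (ind-yes e (f p)))
ind-⇒ (no _) e f = 0≤ind e

ind-⇔ : ∀ {ℓ ℓ′} {P : Set ℓ} {Q : Set ℓ′} (d : Dec P) (e : Dec Q) → (P → Q) → (Q → P) → ind d ≡ ind e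
ind-⇔ d e f g = ℚP.≤-antisym (ind-⇒ d e f) (ind-⇒ e d g)

ind-¬ : ∀ {ℓ} {P : Set ℓ} (d : Dec P) → ind (¬? d) ≡ 1ℚ - ind d
ind-¬ (yes _) = refl
ind-¬ (no _) = refl

ind-idem : ∀ {ℓ} {P : Set ℓ} (d : Dec P) → ind d * ind d ≡ ind d
ind-idem (yes _) = refl
ind-idem (no _) = refl

-- Finite sums

∑ : ∀ {X : Set} → List X → (X → ℚ) → ℚ
∑ [] F = 0ℚ
∑ (x ∷ L) F = F x + ∑ L F

-- `cng` replaces function extensionality. Sums and expectations are both instances, so one exchange
-- lemma serves every mixture of them.
record Linear {Y : Set} (Φ : (Y → ℚ) → ℚ) : Set where
  field
    cng : ∀ {F G} → (∀ y → F y ≡ G y) → Φ F ≡ Φ G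
    add : ∀ F G → Φ (λ y → F y + G y) ≡ Φ F + Φ G
    scale : ∀ c F → Φ (λ y → c * F y) ≡ c * Φ F

  zer : Φ (λ _ → 0ℚ) ≡ 0ℚ
  zer = trans (cng (λ _ → sym (ℚP.*-zeroˡ 0ℚ))) (trans (scale 0ℚ (λ _ → 0ℚ)) (ℚP.*-zeroˡ (Φ (λ _ → 0ℚ))))

  scaleʳ : ∀ c F → Φ (λ y → F y * c) ≡ Φ F * c
  scaleʳ c F = trans (cng (λ y → ℚP.*-comm (F y) c)) (trans (scale c F) (ℚP.*-comm c (Φ F)))

  sub : ∀ F G → Φ (λ y → F y - G y) ≡ Φ F - Φ G
  sub F G = trans (cng (λ y → +-congˡ (F y) (neg (G y))))
    (trans (add F _) (+-congˡ (Φ F) (trans (scale (- 1ℚ) G) (sym (neg (Φ G))))))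
    where
    neg : ∀ x → - x ≡ - 1ℚ * x
    neg = solve-∀ ringℚ

open Linear

∑-linear : ∀ {X : Set} (L : List X) → Linear (∑ L)
∑-linear [] .cng h = refl
∑-linear (x ∷ L) .cng h = cong₂ _+_ (h x) (∑-linear L .cng h)
∑-linear [] .add F G = refl
∑-linear (x ∷ L) .add F G = trans (+-congˡ (F x + G x) (∑-linear L .add F G)) (re (F x) (G x) (∑ L F) (∑ L G))
  where
  re : ∀ a b c d → a + b + (c + d) ≡ a + c + (b + d)
  re = solve-∀ ringℚ
∑-linear [] .scale c F = sym (ℚP.*-zeroʳ c)
∑-linear (x ∷ L) .scale c F = trans (+-congˡ (c * F x) (∑-linear L .scale c F)) (sym (ℚP.*-distribˡ-+ c (F x) (∑ L F)))

∑-mono : ∀ {X : Set} (L : List X) {F G} → (∀ x → F x ℚ.≤ G x) → ∑ L F ℚ.≤ ∑ L G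
∑-mono [] h = ≤-refl
∑-mono (x ∷ L) h = ℚP.+-mono-≤ (h x) (∑-mono L h)

∑-nonneg : ∀ {X : Set} (L : List X) {F} → (∀ x → 0ℚ ℚ.≤ F x) → 0ℚ ℚ.≤ ∑ L F
∑-nonneg L h = ≤-trans (≤-reflexive (sym (zer (∑-linear L)))) (∑-mono L h)

∑-const : ∀ {X : Set} (L : List X) c → ∑ L (λ _ → c) ≡ nat (length L) * c
∑-const [] c = sym (ℚP.*-zeroˡ c)
∑-const (x ∷ L) c = trans (cong (_+_ c) (∑-const L c))
  (trans (eq c (nat (length L))) (cong (_* c) (sym (nat-suc (length L)))))
  where
  eq : ∀ c n → c + n * c ≡ (1ℚ + n) * c
  eq = solve-∀ ringℚ

∑-++ : ∀ {X : Set} (K L : List X) F → ∑ (K ++ L) F ≡ ∑ K F + ∑ L F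
∑-++ [] L F = sym (ℚP.+-identityˡ (∑ L F))
∑-++ (x ∷ K) L F = trans (+-congˡ (F x) (∑-++ K L F)) (sym (ℚP.+-assoc (F x) (∑ K F) (∑ L F)))

∑-map : ∀ {X Y : Set} (φ : X → Y) L F → ∑ (map φ L) F ≡ ∑ L (F ∘ φ)
∑-map φ [] F = refl
∑-map φ (x ∷ L) F = +-congˡ (F (φ x)) (∑-map φ L F)

∑-concatMap : ∀ {X Y : Set} (φ : X → List Y) L F → ∑ (concatMap φ L) F ≡ ∑ L (λ x → ∑ (φ x) F)
∑-concatMap φ [] F = refl
∑-concatMap φ (x ∷ L) F = trans (∑-++ (φ x) (concatMap φ L) F) (+-congˡ (∑ (φ x) F) (∑-concatMap φ L F))

∑-comm : ∀ {X Y : Set} (L : List X) {Φ : (Y → ℚ) → ℚ} → Linear Φ → (F : X → Y → ℚ) →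
         ∑ L (λ x → Φ (F x)) ≡ Φ (λ y → ∑ L (λ x → F x y))
∑-comm [] lin F = sym (zer lin)
∑-comm (x ∷ L) {Φ} lin F = trans (+-congˡ (Φ (F x)) (∑-comm L lin F)) (sym (add lin (F x) _))

∑-allFin-suc : ∀ {n} (F : Fin (suc n) → ℚ) → ∑ (allFin (suc n)) F ≡ F zero + ∑ (allFin n) (F ∘ suc)
∑-allFin-suc {n} F = +-congˡ (F zero)
  (trans (cong (λ L → ∑ L F) (sym (ListP.map-tabulate id suc))) (∑-map suc (allFin n) F))

-- Finite probability spaces, presented by their expectation operator

record Space (X : Set) : Set₁ where
  field
    𝔼 : (X → ℚ) → ℚ
    linear : Linear 𝔼
    mono : ∀ {F G} → (∀ x → F x ℚ.≤ G x) → 𝔼 F ℚ.≤ 𝔼 G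
    one : 𝔼 (λ _ → 1ℚ) ≡ 1ℚ
    comm : ∀ {Y : Set} {Φ : (Y → ℚ) → ℚ} → Linear Φ → (F : X → Y → ℚ) →
           𝔼 (λ x → Φ (F x)) ≡ Φ (λ y → 𝔼 (λ x → F x y))
    -- The probabilistic method with the point actually computed; it later fixes a resampling seed
    -- and the profiles used in rounding.
    attain : ∀ F q → 𝔼 F ℚ.≤ q → ∃ λ x → F x ℚ.≤ q

  const : ∀ c → 𝔼 (λ _ → c) ≡ c
  const c = trans (cng linear (λ _ → sym (ℚP.*-identityʳ c)))
    (trans (scale linear c (λ _ → 1ℚ)) (trans (cong (c *_) one) (ℚP.*-identityʳ c)))

  nonneg : ∀ {F} → (∀ x → 0ℚ ℚ.≤ F x) → 0ℚ ℚ.≤ 𝔼 F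
  nonneg h = ≤-trans (≤-reflexive (sym (const 0ℚ))) (mono h)

  variance : ∀ F → 𝔼 (λ x → F x * F x) ≡ 𝔼 F * 𝔼 F + 𝔼 (λ x → (F x - 𝔼 F) * (F x - 𝔼 F))
  variance F = sym (trans (+-congˡ (e * e) expand) (re e (𝔼 (λ x → F x * F x))))
    where
    e = 𝔼 F
    pt : ∀ x e → (x - e) * (x - e) ≡ x * x + ((- (e + e)) * x + e * e)
    pt = solve-∀ ringℚ
    re : ∀ e s → e * e + (s + ((- (e + e)) * e + e * e)) ≡ s
    re = solve-∀ ringℚ
    expand : 𝔼 (λ x → (F x - e) * (F x - e)) ≡ 𝔼 (λ x → F x * F x) + ((- (e + e)) * e + e * e)
    expand = trans (cng linear (λ x → pt (F x) e)) (trans (add linear _ _)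
      (+-congˡ (𝔼 (λ x → F x * F x)) (trans (add linear _ _) (cong₂ _+_ (scale linear (- (e + e)) F) (const (e * e))))))

  jensen : ∀ F → 𝔼 F * 𝔼 F ℚ.≤ 𝔼 (λ x → F x * F x)
  jensen F = by-nonneg (nonneg (λ x → 0≤sq (F x - 𝔼 F)))
    (trans (re (𝔼 F * 𝔼 F) _) (cong (_- 𝔼 F * 𝔼 F) (sym (variance F))))
    where
    re : ∀ a b → b ≡ a + b - a
    re = solve-∀ ringℚ

open Space

uniform : ∀ {X : Set} (x : X) (L : List X) → Space X
uniform {X} x₀ L₀ = record
  { 𝔼 = λ F → r * ∑ L F
  ; linear = record
    { cng = λ h → cong (r *_) (cng (∑-linear L) h)
    ; add = λ F G → trans (cong (r *_) (add (∑-linear L) F G)) (ℚP.*-distribˡ-+ r _ _)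
    ; scale = λ c F → trans (cong (r *_) (scale (∑-linear L) c F)) (re r c (∑ L F)) }
  ; mono = λ h → *-monoˡ r (0≤inverse n) (∑-mono L h)
  ; one = trans (cong (r *_) (trans (∑-const L 1ℚ) (ℚP.*-identityʳ _))) (inverse-* (length L₀))
  ; comm = λ lin F → trans (cong (r *_) (∑-comm L lin F)) (sym (scale lin r _))
  ; attain = λ F q h → find F q x₀ L₀ (bound F q h) }
  where
  L = x₀ ∷ L₀
  n = length L
  r = inverse n
  re : ∀ a b c → a * (b * c) ≡ b * (a * c)
  re = solve-∀ ringℚ
  re′ : ∀ a b c → a * (b * c) ≡ b * a * c
  re′ = solve-∀ ringℚ
  bound : ∀ F q → r * ∑ L F ℚ.≤ q → ∑ L F ℚ.≤ nat n * q
  bound F q h = ≤-trans (≤-reflexive (sym (trans (re′ (nat n) r (∑ L F))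
    (trans (cong (_* ∑ L F) (inverse-* (length L₀))) (ℚP.*-identityˡ _))))) (*-monoˡ (nat n) (0≤nat n) h)
  find : ∀ F q x L → ∑ (x ∷ L) F ℚ.≤ nat (suc (length L)) * q → ∃ λ y → F y ℚ.≤ q
  find F q x L h with F x ℚP.≤? q
  ... | yes p = x , p
  find F q x [] h | no ¬p = x , ≤-trans (≤-reflexive (sym (ℚP.+-identityʳ (F x))))
    (≤-trans h (≤-reflexive (ℚP.*-identityˡ q)))
  find F q x (y ∷ L) h | no ¬p = find F q y L (by-nonneg (0≤+ (0≤sub h) (0≤sub (<⇒≤ (≰⇒> ¬p))))
      (trans (cong (λ z → z * q - (F x + ∑ (y ∷ L) F) + (F x - q)) (nat-suc (suc (length L))))
        (eq (nat (suc (length L))) q (F x) (∑ (y ∷ L) F))))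
    where
    eq : ∀ n q f s → (1ℚ + n) * q - (f + s) + (f - q) ≡ n * q - s
    eq = solve-∀ ringℚ

unit : ∀ {X : Set} → X → Space X
unit x = record
  { 𝔼 = λ F → F x
  ; linear = record { cng = λ h → h x ; add = λ _ _ → refl ; scale = λ _ _ → refl }
  ; mono = λ h → h x
  ; one = refl
  ; comm = λ lin F → refl
  ; attain = λ F q h → x , h }

pairing : ∀ {X Y Z : Set} → (X → Y → Z) → Space X → Space Y → Space Z
pairing φ A B = record
  { 𝔼 = λ F → 𝔼 A λ x → 𝔼 B λ y → F (φ x y)
  ; linear = record
    { cng = λ h → cng (linear A) λ x → cng (linear B) λ y → h (φ x y)
    ; add = λ F G → trans (cng (linear A) λ x → add (linear B) _ _) (add (linear A) _ _)
    ; scale = λ c F → trans (cng (linear A) λ x → scale (linear B) c _) (scale (linear A) c _) }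
  ; mono = λ h → mono A λ x → mono B λ y → h (φ x y)
  ; one = trans (cng (linear A) λ x → one B) (one A)
  ; comm = λ lin F → trans (cng (linear A) λ x → comm B lin _) (comm A lin _)
  ; attain = λ F q h → let (x , hx) = attain A _ q h ; (y , hy) = attain B _ q hx in φ x y , hy }

infixr 7 _⊗_
_⊗_ : ∀ {X Y : Set} → Space X → Space Y → Space (X × Y)
_⊗_ = pairing _,_

infixl 8 _^^_
_^^_ : ∀ {X : Set} → Space X → (n : ℕ) → Space (Vec X n)
A ^^ zero = unit []
A ^^ suc n = pairing _∷_ A (A ^^ n)

coin : Space Bool
coin = uniform true (false ∷ [])

coin-𝔼 : ∀ F → 𝔼 coin F ≡ ½ * (F true + F false)
coin-𝔼 F = cong (λ z → ½ * (F true + z)) (ℚP.+-identityʳ (F false))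

-- Second moments of conditional expectations

Sel : ∀ (X : Set) {n} → Vec Bool n → Set
Sel X [] = ⊤
Sel X (true ∷ T) = X × Sel X T
Sel X (false ∷ T) = Sel X T

selected : ∀ {X : Set} → Space X → ∀ {n} (T : Vec Bool n) → Space (Sel X T)
selected A [] = unit tt
selected A (true ∷ T) = A ⊗ selected A T
selected A (false ∷ T) = selected A T

join : ∀ {X : Set} {n} (T : Vec Bool n) → Sel X T → Sel X (Vec.map not T) → Vec X n
join [] _ _ = []
join (true ∷ T) (x , u) v = x ∷ join T u v
join (false ∷ T) u (x , v) = x ∷ join T u v

total : ∀ {n} → (Fin n → ℚ) → ℚ
total {n} a = ∑ (allFin n) a

partial : ∀ {n} → Vec Bool n → (Fin n → ℚ) → ℚ
partial [] a = 0ℚ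
partial (true ∷ T) a = a zero + partial T (a ∘ suc)
partial (false ∷ T) a = partial T (a ∘ suc)

¼ ¾ : ℚ
¼ = ½ * ½
¾ = ½ + ¼

module _ {X : Set} (A : Space X) where

  avg : ∀ {n} → (Vec X (suc n) → ℚ) → Vec X n → ℚ
  avg F v = 𝔼 A λ x → F (x ∷ v)

  𝔼-avg : ∀ {n} (F : Vec X (suc n) → ℚ) → 𝔼 (A ^^ n) (avg F) ≡ 𝔼 (A ^^ suc n) F
  𝔼-avg {n} F = sym (comm A (linear (A ^^ n)) λ x v → F (x ∷ v))

  𝔼-join : ∀ {n} (T : Vec Bool n) F →
    𝔼 (A ^^ n) F ≡ 𝔼 (selected A T) λ u → 𝔼 (selected A (Vec.map not T)) λ v → F (join T u v)
  𝔼-join [] F = refl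
  𝔼-join (true ∷ T) F = cng (linear A) λ x → 𝔼-join T λ v → F (x ∷ v)
  𝔼-join (false ∷ T) F = trans (cng (linear A) λ x → 𝔼-join T λ v → F (x ∷ v))
    (comm A (linear (selected A T)) _)

  -- 𝕄 T F = 𝔼[ 𝔼[F | coordinates in T]² ]
  𝕄 : ∀ {n} → Vec Bool n → (Vec X n → ℚ) → ℚ
  𝕄 [] F = F [] * F []
  𝕄 (true ∷ T) F = 𝔼 A λ x → 𝕄 T λ v → F (x ∷ v)
  𝕄 (false ∷ T) F = 𝕄 T (avg F)

  M-cong : ∀ {n} (T : Vec Bool n) {F G} → (∀ v → F v ≡ G v) → 𝕄 T F ≡ 𝕄 T G
  M-cong [] h = cong₂ _*_ (h []) (h [])
  M-cong (true ∷ T) h = cng (linear A) λ x → M-cong T λ v → h (x ∷ v)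
  M-cong (false ∷ T) h = M-cong T λ v → cng (linear A) λ x → h (x ∷ v)

  -- Unfolds the recursion into its meaning: the square is taken after averaging out the unselected
  -- coordinates and before averaging over the selected ones.
  M-join : ∀ {n} (T : Vec Bool n) F → 𝕄 T F ≡ 𝔼 (selected A T) λ u →
    (𝔼 (selected A (Vec.map not T)) λ v → F (join T u v)) * (𝔼 (selected A (Vec.map not T)) λ v → F (join T u v))
  M-join [] F = refl
  M-join (true ∷ T) F = cng (linear A) λ x → M-join T λ v → F (x ∷ v)
  M-join (false ∷ T) F = trans (M-join T (avg F)) (cng (linear (selected A T)) λ u → cong₂ _*_ (eq u) (eq u))
    where
    eq : ∀ u → _
    eq u = sym (comm A (linear (selected A (Vec.map not T))) λ x v → F (x ∷ join T u v))

  M-join′ : ∀ {n} (T : Vec Bool n) F → 𝕄 (Vec.map not T) F ≡ 𝔼 (selected A (Vec.map not T)) λ v →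
    (𝔼 (selected A T) λ u → F (join T u v)) * (𝔼 (selected A T) λ u → F (join T u v))
  M-join′ [] F = refl
  M-join′ (false ∷ T) F = cng (linear A) λ x → M-join′ T λ v → F (x ∷ v)
  M-join′ (true ∷ T) F = trans (M-join′ T (avg F)) (cng (linear (selected A (Vec.map not T))) λ v → cong₂ _*_ (eq v) (eq v))
    where
    eq : ∀ v → _
    eq v = sym (comm A (linear (selected A T)) λ x u → F (x ∷ join T u v))

  -- Law of total variance for a random function `F y`: conditional expectation commutes with `𝔼 B`,
  -- so only the pointwise variance identity is used. With `B = A` it splits off one coordinate.
  M-variance : ∀ {Y : Set} (B : Space Y) {n} (T : Vec Bool n) (F : Y → Vec X n → ℚ) →
    𝔼 B (λ y → 𝕄 T (F y)) ≡
    𝕄 T (λ v → 𝔼 B λ y → F y v) + 𝔼 B (λ y → 𝕄 T λ v → F y v - 𝔼 B λ z → F z v)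
  M-variance B [] F = variance B λ y → F y []
  M-variance B (true ∷ T) F = trans (comm B (linear A) _)
    (trans (cng (linear A) λ x → M-variance B T λ y v → F y (x ∷ v))
      (trans (add (linear A) (λ x → 𝕄 T λ v → 𝔼 B λ y → F y (x ∷ v)) _)
        (+-congˡ (𝕄 (true ∷ T) λ v → 𝔼 B λ y → F y v) (comm A (linear B) λ x y → 𝕄 T λ v → F y (x ∷ v) - 𝔼 B λ z → F z (x ∷ v)))))
  M-variance B (false ∷ T) F = trans (M-variance B T λ y → avg (F y))
    (cong₂ _+_ (M-cong T λ v → comm B (linear A) λ y x → F y (x ∷ v))
      (cng (linear B) λ y → M-cong T λ v → trans
        (cong (λ z → avg (F y) v - z) (comm B (linear A) λ z x → F z (x ∷ v)))
        (sym (sub (linear A) _ _))))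

  energy : ∀ {n} → (Vec X n → ℚ) → ℚ
  energy {n} F = 𝔼 (A ^^ n) λ v → F v * F v

  deviation : ∀ {n} → (Vec X (suc n) → ℚ) → X → Vec X n → ℚ
  deviation F x v = F (x ∷ v) - avg F v

  -- Pythagoras: the deviation has mean zero in the head coordinate, hence is orthogonal to the
  -- average over it.
  energy-avg : ∀ {n} (F : Vec X (suc n) → ℚ) →
    energy F ≡ energy (avg F) + 𝔼 A λ x → energy (deviation F x)
  energy-avg {n} F = trans (comm A (linear (A ^^ n)) _)
    (trans (cng (linear (A ^^ n)) λ v → variance A λ x → F (x ∷ v))
      (trans (add (linear (A ^^ n)) _ _) (+-congˡ (energy (avg F)) (comm (A ^^ n) (linear A) _))))

  energy-nonneg : ∀ {n} (F : Vec X n → ℚ) → 0ℚ ℚ.≤ energy F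
  energy-nonneg {n} F = nonneg (A ^^ n) λ v → 0≤sq (F v)

  energy-avg-≤ : ∀ {n} (F : Vec X (suc n) → ℚ) → energy (avg F) ℚ.≤ energy F
  energy-avg-≤ F = by-nonneg (nonneg A λ x → energy-nonneg (deviation F x))
    (trans (re (energy (avg F)) _) (cong (_- energy (avg F)) (sym (energy-avg F))))
    where
    re : ∀ a b → b ≡ a + b - a
    re = solve-∀ ringℚ

  M≤energy : ∀ {n} (T : Vec Bool n) F → 𝕄 T F ℚ.≤ energy F
  M≤energy [] F = ≤-refl
  M≤energy (true ∷ T) F = mono A λ x → M≤energy T λ v → F (x ∷ v)
  M≤energy (false ∷ T) F = ≤-trans (M≤energy T (avg F)) (energy-avg-≤ F)

  -- weight F i = Var 𝔼[F | coordinate i]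
  weight : ∀ {n} → (Vec X n → ℚ) → Fin n → ℚ
  weight {suc n} F zero = 𝔼 A (λ x → m x * m x) - 𝔼 A m * 𝔼 A m
    where
    m : X → ℚ
    m x = 𝔼 (A ^^ n) λ v → F (x ∷ v)
  weight F (suc i) = weight (avg F) i

  weight-zero : ∀ {n} (F : Vec X (suc n) → ℚ) →
    weight F zero ≡ 𝔼 A λ x → 𝔼 (A ^^ n) (deviation F x) * 𝔼 (A ^^ n) (deviation F x)
  weight-zero {n} F = trans (cong (_- 𝔼 A m * 𝔼 A m) (variance A m))
    (trans (re (𝔼 A m * 𝔼 A m) _) (cng (linear A) λ x → cong₂ _*_ (eq x) (eq x)))
    where
    m : X → ℚ
    m x = 𝔼 (A ^^ n) λ v → F (x ∷ v)
    re : ∀ a b → a + b - a ≡ b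
    re = solve-∀ ringℚ
    eq : ∀ x → m x - 𝔼 A m ≡ 𝔼 (A ^^ n) (deviation F x)
    eq x = trans (cong (λ z → m x - z) (sym (𝔼-avg F))) (sym (sub (linear (A ^^ n)) _ _))

  weight-nonneg : ∀ {n} (F : Vec X n → ℚ) i → 0ℚ ℚ.≤ weight F i
  weight-nonneg F zero = subst (0ℚ ℚ.≤_) (sym (weight-zero F)) (nonneg A λ x → 0≤sq (𝔼 (A ^^ _) (deviation F x)))
  weight-nonneg F (suc i) = weight-nonneg (avg F) i

  -- Bessel's inequality: the centred functions of single coordinates in `T` are orthogonal to one
  -- another and to every function of the other coordinates. When the head is peeled off, its
  -- deviation pays for the weight by `jensen` if the head is in `T`, and for an `𝕄` term otherwise.
  partial-weight : ∀ {n} (T : Vec Bool n) F → partial T (weight F) + 𝕄 (Vec.map not T) F ℚ.≤ energy F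
  partial-weight [] F = ≤-reflexive (ℚP.+-identityˡ _)
  partial-weight {suc n} (true ∷ T) F =
    by-nonneg (0≤+ (0≤sub (partial-weight T (avg F)))
        (0≤sub (mono A λ x → jensen (A ^^ n) (deviation F x))))
      (trans (re p m (energy (avg F)) d w)
        (cong₂ (λ a b → a - (b + p + m)) (sym (energy-avg F)) (sym (weight-zero F))))
    where
    p = partial T (weight (avg F))
    m = 𝕄 (Vec.map not T) (avg F)
    d = 𝔼 A λ x → energy (deviation F x)
    w = 𝔼 A λ x → 𝔼 (A ^^ n) (deviation F x) * 𝔼 (A ^^ n) (deviation F x)
    re : ∀ p m e d w → e - (p + m) + (d - w) ≡ e + d - (w + p + m)
    re = solve-∀ ringℚ
  partial-weight (false ∷ T) F =
    by-nonneg (0≤+ (0≤sub (partial-weight T (avg F)))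
        (0≤sub (mono A λ x → M≤energy (Vec.map not T) (deviation F x))))
      (trans (re p m (energy (avg F)) d d′)
        (cong₂ (λ a b → a - (p + b)) (sym (energy-avg F)) (sym (M-variance A (Vec.map not T) λ x v → F (x ∷ v)))))
    where
    p = partial T (weight (avg F))
    m = 𝕄 (Vec.map not T) (avg F)
    d = 𝔼 A λ x → energy (deviation F x)
    d′ = 𝔼 A λ x → 𝕄 (Vec.map not T) (deviation F x)
    re : ∀ p m e d d′ → e - (p + m) + (d - d′) ≡ e + d - (p + (m + d′))
    re = solve-∀ ringℚ

  -- The head lies in the random `T` with probability ½. The averaged part is counted in both cases,
  -- the deviation only when the head is selected.
  M-average-suc : ∀ {n} (F : Vec X (suc n) → ℚ) → 𝔼 (coin ^^ suc n) (λ T → 𝕄 T F) ≡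
    𝔼 (coin ^^ n) (λ T → 𝕄 T (avg F)) + ½ * 𝔼 A λ x → 𝔼 (coin ^^ n) λ T → 𝕄 T (deviation F x)
  M-average-suc {n} F = trans (coin-𝔼 (λ t → 𝔼 (coin ^^ n) λ T → 𝕄 (t ∷ T) F)) (trans (cong (λ z → ½ * (z + e)) split) (re e d))
    where
    e = 𝔼 (coin ^^ n) λ T → 𝕄 T (avg F)
    d = 𝔼 A λ x → 𝔼 (coin ^^ n) λ T → 𝕄 T (deviation F x)
    re : ∀ e d → ½ * (e + d + e) ≡ e + ½ * d
    re = solve-∀ ringℚ
    split : 𝔼 (coin ^^ n) (λ T → 𝔼 A λ x → 𝕄 T λ v → F (x ∷ v)) ≡ e + d
    split = trans (cng (linear (coin ^^ n)) λ T → M-variance A T λ x v → F (x ∷ v))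
      (trans (add (linear (coin ^^ n)) _ _) (+-congˡ e (comm (coin ^^ n) (linear A) _)))

  -- The mean survives every `T`, while a component of level at least one survives with probability
  -- at most ½. Applied to deviations of the head, this supplies the second factor ½ at levels two
  -- and above.
  M-average-≤½ : ∀ {n} (F : Vec X n → ℚ) →
    𝔼 (coin ^^ n) (λ T → 𝕄 T F) ℚ.≤ ½ * (energy F + 𝔼 (A ^^ n) F * 𝔼 (A ^^ n) F)
  M-average-≤½ {zero} F = ≤-reflexive (re (F [] * F []))
    where
    re : ∀ a → a ≡ ½ * (a + a)
    re = solve-∀ ringℚ
  M-average-≤½ {suc n} F = ≤-trans (≤-reflexive (M-average-suc F))
    (by-nonneg (0≤+ (0≤sub (M-average-≤½ (avg F))) (0≤* (lit ½) (0≤sub (mono A λ x → bound x))))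
      (trans (re p q (energy (avg F)) d (𝔼 (A ^^ n) (avg F)))
        (cong₂ (λ a b → ½ * (a + b * b) - (p + ½ * q)) (sym (energy-avg F)) (𝔼-avg F))))
    where
    p = 𝔼 (coin ^^ n) λ T → 𝕄 T (avg F)
    q = 𝔼 A λ x → 𝔼 (coin ^^ n) λ T → 𝕄 T (deviation F x)
    d = 𝔼 A λ x → energy (deviation F x)
    re : ∀ p q e d a → ½ * (e + a * a) - p + ½ * (d - q) ≡ ½ * (e + d + a * a) - (p + ½ * q)
    re = solve-∀ ringℚ
    bound : ∀ x → 𝔼 (coin ^^ n) (λ T → 𝕄 T (deviation F x)) ℚ.≤ energy (deviation F x)
    bound x = ≤-trans (mono (coin ^^ n) λ T → M≤energy T (deviation F x)) (≤-reflexive (const (coin ^^ n) _))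

  -- On the Efron–Stein component of level ℓ the average over T acts as 2^(-ℓ) ≤ ¼ for ℓ ≥ 2.
  M-average-≤ : ∀ {n} (F : Vec X n → ℚ) → 𝔼 (coin ^^ n) (λ T → 𝕄 T F) ℚ.≤
    ¼ * energy F + ¾ * (𝔼 (A ^^ n) F * 𝔼 (A ^^ n) F) + ¼ * total (weight F)
  M-average-≤ {zero} F = ≤-reflexive (re (F [] * F []))
    where
    re : ∀ a → a ≡ ¼ * a + ¾ * a + ¼ * 0ℚ
    re = solve-∀ ringℚ
  M-average-≤ {suc n} F = ≤-trans (≤-reflexive (M-average-suc F))
    (by-nonneg (0≤+ (0≤sub (M-average-≤ (avg F)))
        (0≤* (lit ½) (0≤sub (mono A λ x → M-average-≤½ (deviation F x)))))
      (trans (cong (λ z → r - p + ½ * (z - q)) half)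
        (trans (re p q (energy (avg F)) d (𝔼 (A ^^ n) (avg F)) w₀ t)
          (cong (λ z → z - (p + ½ * q)) rhs))))
    where
    p = 𝔼 (coin ^^ n) λ T → 𝕄 T (avg F)
    q = 𝔼 A λ x → 𝔼 (coin ^^ n) λ T → 𝕄 T (deviation F x)
    d = 𝔼 A λ x → energy (deviation F x)
    w₀ = 𝔼 A λ x → 𝔼 (A ^^ n) (deviation F x) * 𝔼 (A ^^ n) (deviation F x)
    t = total (weight (avg F))
    r = ¼ * energy (avg F) + ¾ * (𝔼 (A ^^ n) (avg F) * 𝔼 (A ^^ n) (avg F)) + ¼ * t
    half : 𝔼 A (λ x → ½ * (energy (deviation F x) + 𝔼 (A ^^ n) (deviation F x) * 𝔼 (A ^^ n) (deviation F x))) ≡ ½ * (d + w₀)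
    half = trans (scale (linear A) ½ _) (cong (½ *_) (add (linear A) _ _))
    re : ∀ p q e d a w t → ¼ * e + ¾ * (a * a) + ¼ * t - p + ½ * (½ * (d + w) - q) ≡
      ¼ * (e + d) + ¾ * (a * a) + ¼ * (w + t) - (p + ½ * q)
    re = solve-∀ ringℚ
    rhs : ¼ * (energy (avg F) + d) + ¾ * (𝔼 (A ^^ n) (avg F) * 𝔼 (A ^^ n) (avg F)) + ¼ * (w₀ + t) ≡
      ¼ * energy F + ¾ * (𝔼 (A ^^ suc n) F * 𝔼 (A ^^ suc n) F) + ¼ * total (weight F)
    rhs = cong₂ _+_ (cong₂ (λ a b → ¼ * a + ¾ * (b * b)) (sym (energy-avg F)) (𝔼-avg F))
      (cong (¼ *_) (sym (trans (∑-allFin-suc (weight F)) (cong (_+ t) (weight-zero F)))))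

-- Squares

∑-select : ∀ {m} (a : Fin m) (H : Fin m → ℚ) → ∑ (allFin m) (λ k → ind (a Fin.≟ k) * H k) ≡ H a
∑-select {suc m} zero H = trans (∑-allFin-suc (λ k → ind (zero Fin.≟ k) * H k))
  (trans (cong₂ _+_ (ℚP.*-identityˡ (H zero)) (trans (cng (∑-linear (allFin m)) λ k → ℚP.*-zeroˡ (H (suc k)))
    (zer (∑-linear (allFin m))))) (ℚP.+-identityʳ (H zero)))
∑-select {suc m} (suc a) H = trans (∑-allFin-suc (λ k → ind (suc a Fin.≟ k) * H k))
  (trans (cong₂ _+_ (ℚP.*-zeroˡ (H zero)) (trans (cng (∑-linear (allFin m)) λ k →
      cong (_* H (suc k)) (ind-⇔ (suc a Fin.≟ suc k) (a Fin.≟ k) FinP.suc-injective (cong suc)))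
    (∑-select a (H ∘ suc)))) (ℚP.+-identityˡ (H (suc a))))

∑-ind² : ∀ {m} (a : Fin m) → ∑ (allFin m) (λ k → ind (a Fin.≟ k) * ind (a Fin.≟ k)) ≡ 1ℚ
∑-ind² a = trans (∑-select a λ k → ind (a Fin.≟ k)) (ind-yes (a Fin.≟ a) refl)

-- The multiset equality {a , d} = {b , c}.
Square : ∀ {D : Set} → D → D → D → D → Set
Square a b c d = (a ≡ b × c ≡ d) ⊎ (a ≡ c × b ≡ d)

square? : ∀ {m} (a b c d : Fin m) → Dec (Square a b c d)
square? a b c d = (a Fin.≟ b ×-dec c Fin.≟ d) ⊎-dec (a Fin.≟ c ×-dec b Fin.≟ d)

broken : ∀ {m} (a b c d : Fin m) → ℚ
broken a b c d = ind (¬? (square? a b c d))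

-- Mixed second difference over a rectangle with corners `a`, `b`, `c`, `d`, where `a` and `d` are
-- opposite.
mixed : ℚ → ℚ → ℚ → ℚ → ℚ
mixed a b c d = (a - b) - (c - d)

-- For nonnegative numbers the cross term -2(a + d)(b + c) only helps, hence the factor 2 instead of
-- the 4 of Cauchy-Schwarz.
mixed²-≤ : ∀ {a b c d} → 0ℚ ℚ.≤ a → 0ℚ ℚ.≤ b → 0ℚ ℚ.≤ c → 0ℚ ℚ.≤ d →
  mixed a b c d * mixed a b c d ℚ.≤ (1ℚ + 1ℚ) * (a * a + b * b + (c * c + d * d))
mixed²-≤ {a} {b} {c} {d} ha hb hc hd = by-nonneg
  (0≤+ (0≤+ (0≤sq (a - d)) (0≤sq (b - c))) (0≤* (lit (1ℚ + 1ℚ)) (0≤* (0≤+ ha hd) (0≤+ hb hc))))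
  (re a b c d)
  where
  re : ∀ a b c d → (a - d) * (a - d) + (b - c) * (b - c) + (1ℚ + 1ℚ) * ((a + d) * (b + c)) ≡
    (1ℚ + 1ℚ) * (a * a + b * b + (c * c + d * d)) - ((a - b) - (c - d)) * ((a - b) - (c - d))
  re = solve-∀ ringℚ

mixed-square : ∀ {D : Set} (φ : D → ℚ) {a b c d} → Square a b c d → mixed (φ a) (φ b) (φ c) (φ d) ≡ 0ℚ
mixed-square φ {a} {b} {c} {d} (inj₁ (refl , refl)) = re (φ a) (φ c)
  where
  re : ∀ x y → (x - x) - (y - y) ≡ 0ℚ
  re = solve-∀ ringℚ
mixed-square φ {a} {b} {c} {d} (inj₂ (refl , refl)) = re (φ a) (φ b)
  where
  re : ∀ x y → (x - y) - (x - y) ≡ 0ℚ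
  re = solve-∀ ringℚ

eight : ℚ
eight = nat 8

module _ {m} (a b c d : Fin m) where

  private
    mixed-⟪_⟫ : Fin m → ℚ
    mixed-⟪ k ⟫ = mixed (ind (a Fin.≟ k)) (ind (b Fin.≟ k)) (ind (c Fin.≟ k)) (ind (d Fin.≟ k))

  -- At each corner the squared indicators sum to 1 over all `k`, so 2 · 4 = 8 covers all values
  -- together, without a factor `m`.
  ∑-mixed² : ∑ (allFin m) (λ k → mixed-⟪ k ⟫ * mixed-⟪ k ⟫) ℚ.≤ eight * broken a b c d
  ∑-mixed² with square? a b c d
  ... | yes sq = ≤-reflexive (trans (cng (∑-linear (allFin m)) λ k →
          cong (λ z → z * z) (mixed-square (λ e → ind (e Fin.≟ k)) sq)) (zer (∑-linear (allFin m))))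
  ... | no _ = ≤-trans (∑-mono (allFin m) λ k → mixed²-≤ (0≤ind (a Fin.≟ k)) (0≤ind (b Fin.≟ k)) (0≤ind (c Fin.≟ k)) (0≤ind (d Fin.≟ k)))
          (≤-reflexive (trans (scale L (1ℚ + 1ℚ) _) (cong ((1ℚ + 1ℚ) *_)
            (trans (add L _ _) (cong₂ _+_ (pair a b) (pair c d))))))
    where
    L = ∑-linear (allFin m)
    pair : ∀ a b → ∑ (allFin m) (λ k → ind (a Fin.≟ k) * ind (a Fin.≟ k) + ind (b Fin.≟ k) * ind (b Fin.≟ k)) ≡ 1ℚ + 1ℚ
    pair a b = trans (add L _ _) (cong₂ _+_ (∑-ind² a) (∑-ind² b))

  mixed²-broken : (φ : Fin m → ℚ) → (∀ e → 0ℚ ℚ.≤ φ e) → (∀ e → φ e * φ e ℚ.≤ 1ℚ) →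
    mixed (φ a) (φ b) (φ c) (φ d) * mixed (φ a) (φ b) (φ c) (φ d) ℚ.≤ eight * broken a b c d
  mixed²-broken φ h h² with square? a b c d
  ... | yes sq = ≤-reflexive (cong (λ z → z * z) (mixed-square φ sq))
  ... | no _ = ≤-trans (mixed²-≤ (h a) (h b) (h c) (h d))
          (*-monoˡ (1ℚ + 1ℚ) (lit (1ℚ + 1ℚ)) (ℚP.+-mono-≤ (ℚP.+-mono-≤ (h² a) (h² b)) (ℚP.+-mono-≤ (h² c) (h² d))))

module _ {U : Set} (A : Space U) where

  independent-* : ∀ (F G : U → ℚ) → 𝔼 A (λ u → 𝔼 A λ u′ → F u * G u′) ≡ 𝔼 A F * 𝔼 A G
  independent-* F G = trans (cng (linear A) λ u → scale (linear A) (F u) G) (scaleʳ (linear A) (𝔼 A G) F)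

  𝔼-difference² : ∀ (F : U → ℚ) → 𝔼 A (λ u → 𝔼 A λ u′ → (F u - F u′) * (F u - F u′)) ≡
    (1ℚ + 1ℚ) * (𝔼 A (λ u → F u * F u) - 𝔼 A F * 𝔼 A F)
  𝔼-difference² F = trans (cng (linear A) λ u → trans (cng (linear A) λ u′ → pt (F u) (F u′))
      (trans (add (linear A) _ _) (cong₂ _+_ (const A (F u * F u)) (trans (add (linear A) (λ u′ → F u′ * F u′) _)
        (+-congˡ s (scale (linear A) (- (F u + F u)) F))))))
    (trans (add (linear A) (λ u → F u * F u) _) (trans (+-congˡ s (trans (add (linear A) _ _)
      (cong₂ _+_ (const A s) (trans (cng (linear A) λ u → pt′ (F u) e) (scale (linear A) (- (e + e)) F))))) (re s e)))
    where
    s = 𝔼 A λ u → F u * F u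
    e = 𝔼 A F
    pt : ∀ a b → (a - b) * (a - b) ≡ a * a + (b * b + (- (a + a)) * b)
    pt = solve-∀ ringℚ
    pt′ : ∀ a e → (- (a + a)) * e ≡ (- (e + e)) * a
    pt′ = solve-∀ ringℚ
    re : ∀ s e → s + (s + (- (e + e)) * e) ≡ (1ℚ + 1ℚ) * (s - e * e)
    re = solve-∀ ringℚ

module _ {U V : Set} (A : Space U) (B : Space V) where

  𝔼-quad : (U → U → V → V → ℚ) → ℚ
  𝔼-quad Φ = 𝔼 A λ u → 𝔼 A λ u′ → 𝔼 B λ v → 𝔼 B λ v′ → Φ u u′ v v′

  quad-mono : ∀ {Φ Ψ} → (∀ u u′ v v′ → Φ u u′ v v′ ℚ.≤ Ψ u u′ v v′) → 𝔼-quad Φ ℚ.≤ 𝔼-quad Ψ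
  quad-mono h = mono A λ u → mono A λ u′ → mono B λ v → mono B λ v′ → h u u′ v v′

  quad-scale : ∀ c Φ → 𝔼-quad (λ u u′ v v′ → c * Φ u u′ v v′) ≡ c * 𝔼-quad Φ
  quad-scale c Φ = trans (cng (linear A) λ u → trans (cng (linear A) λ u′ → trans (cng (linear B) λ v →
    scale (linear B) c _) (scale (linear B) c _)) (scale (linear A) c _)) (scale (linear A) c _)

  quad-∑ : ∀ {X : Set} (L : List X) (Φ : X → U → U → V → V → ℚ) →
    ∑ L (λ x → 𝔼-quad (Φ x)) ≡ 𝔼-quad λ u u′ v v′ → ∑ L λ x → Φ x u u′ v v′
  quad-∑ L Φ = trans (∑-comm L (linear A) _) (cng (linear A) λ u → trans (∑-comm L (linear A) _)
    (cng (linear A) λ u′ → trans (∑-comm L (linear B) _) (cng (linear B) λ v → ∑-comm L (linear B) _)))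

  -- Differencing in `v` and then in `u` gives a factor 2 each time. The bracket is the energy of
  -- the part of `F` that depends on both halves jointly.
  quad-mixed² : ∀ (F : U → V → ℚ) →
    𝔼-quad (λ u u′ v v′ → mixed (F u v) (F u′ v) (F u v′) (F u′ v′) * mixed (F u v) (F u′ v) (F u v′) (F u′ v′)) ≡
    nat 4 * (𝔼 A (λ u → 𝔼 B λ v → F u v * F u v) + 𝔼 A (λ u → 𝔼 B (F u)) * 𝔼 A (λ u → 𝔼 B (F u))
      - 𝔼 A (λ u → 𝔼 B (F u) * 𝔼 B (F u)) - 𝔼 B λ v → (𝔼 A λ u → F u v) * (𝔼 A λ u → F u v))
  quad-mixed² F = trans (cng (linear A) λ u → cng (linear A) λ u′ → 𝔼-difference² B λ v → F u v - F u′ v)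
    (trans (cng (linear A) λ u → scale (linear A) (1ℚ + 1ℚ) _) (trans (scale (linear A) (1ℚ + 1ℚ) _)
      (trans (cong ((1ℚ + 1ℚ) *_) (trans (cng (linear A) λ u → sub (linear A) _ _) (trans (sub (linear A) _ _)
        (cong₂ _-_ first second)))) (re s q p (μ * μ)))))
    where
    s = 𝔼 A λ u → 𝔼 B λ v → F u v * F u v
    μ = 𝔼 A λ u → 𝔼 B (F u)
    p = 𝔼 A λ u → 𝔼 B (F u) * 𝔼 B (F u)
    q = 𝔼 B λ v → (𝔼 A λ u → F u v) * (𝔼 A λ u → F u v)
    first : 𝔼 A (λ u → 𝔼 A λ u′ → 𝔼 B λ v → (F u v - F u′ v) * (F u v - F u′ v)) ≡ (1ℚ + 1ℚ) * (s - q)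
    first = trans (cng (linear A) λ u → comm A (linear B) _) (trans (comm A (linear B) _)
      (trans (cng (linear B) λ v → 𝔼-difference² A λ u → F u v) (trans (scale (linear B) (1ℚ + 1ℚ) _)
        (cong ((1ℚ + 1ℚ) *_) (trans (sub (linear B) _ _) (cong (_- q) (comm B (linear A) _)))))))
    second : 𝔼 A (λ u → 𝔼 A λ u′ → 𝔼 B (λ v → F u v - F u′ v) * 𝔼 B (λ v → F u v - F u′ v)) ≡ (1ℚ + 1ℚ) * (p - μ * μ)
    second = trans (cng (linear A) λ u → cng (linear A) λ u′ → cong (λ z → z * z) (sub (linear B) (F u) (F u′)))
      (𝔼-difference² A λ u → 𝔼 B (F u))
    re : ∀ s q p e → (1ℚ + 1ℚ) * ((1ℚ + 1ℚ) * (s - q) - (1ℚ + 1ℚ) * (p - e)) ≡ nat 4 * (s + e - p - q)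
    re = solve-∀ ringℚ

  -- If both halves influenced g with noticeable probability, then for independent choices both would
  -- be pivotal at once, which a square forbids.
  influence-product : ∀ {m} (g : U → V → Fin m) →
    𝔼 A (λ u → 𝔼 A λ u′ → 𝔼 B λ v → ind (¬? (g u v Fin.≟ g u′ v))) *
    𝔼 A (λ u → 𝔼 B λ v → 𝔼 B λ v′ → ind (¬? (g u v Fin.≟ g u v′))) ℚ.≤
    nat 3 * 𝔼-quad (λ u u′ v v′ → broken (g u v) (g u′ v) (g u v′) (g u′ v′))
  influence-product g = ≤-trans (≤-reflexive expand)
    (≤-trans (mono A λ u → mono A λ u′ → mono B λ w → mono A λ t → mono B λ v → mono B λ v′ → pointwise u u′ w t v v′)
      (≤-reflexive (trans collapse (re (𝔼-quad N)))))
    where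
    N : _ → _ → _ → _ → ℚ
    N u u′ v v′ = broken (g u v) (g u′ v) (g u v′) (g u′ v′)
    P : _ → _ → _ → ℚ
    P u u′ v = ind (¬? (g u v Fin.≟ g u′ v))
    Q : _ → _ → _ → ℚ
    Q u v v′ = ind (¬? (g u v Fin.≟ g u v′))
    expand : 𝔼 A (λ u → 𝔼 A λ u′ → 𝔼 B (P u u′)) * 𝔼 A (λ t → 𝔼 B λ v → 𝔼 B (Q t v)) ≡
      𝔼 A λ u → 𝔼 A λ u′ → 𝔼 B λ w → 𝔼 A λ t → 𝔼 B λ v → 𝔼 B λ v′ → P u u′ w * Q t v v′
    expand = sym (trans (cng (linear A) λ u → trans (cng (linear A) λ u′ → trans (cng (linear B) λ w →
        trans (cng (linear A) λ t → trans (cng (linear B) λ v → scale (linear B) (P u u′ w) _)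
          (scale (linear B) (P u u′ w) _)) (scale (linear A) (P u u′ w) _))
        (scaleʳ (linear B) _ (P u u′))) (scaleʳ (linear A) _ _)) (scaleʳ (linear A) _ _))
    0≤N : ∀ u u′ v v′ → 0ℚ ℚ.≤ N u u′ v v′
    0≤N u u′ v v′ = 0≤ind (¬? (square? (g u v) (g u′ v) (g u v′) (g u′ v′)))
    pq≤1 : ∀ u u′ w t v v′ → P u u′ w * Q t v v′ ℚ.≤ 1ℚ
    pq≤1 u u′ w t v v′ with g u w Fin.≟ g u′ w
    ... | yes _ = ≤-trans (≤-reflexive (ℚP.*-zeroˡ (Q t v v′))) (lit 1ℚ)
    ... | no _ = ≤-trans (≤-reflexive (ℚP.*-identityˡ (Q t v v′))) (ind≤1 (¬? (g t v Fin.≟ g t v′)))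
    ≤-+ʳ : ∀ {x y} → 0ℚ ℚ.≤ y → x ℚ.≤ x + y
    ≤-+ʳ {x} h = ≤-trans (≤-reflexive (sym (ℚP.+-identityʳ x))) (ℚP.+-monoʳ-≤ x h)
    pointwise : ∀ u u′ w t v v′ → P u u′ w * Q t v v′ ℚ.≤ N u u′ w v + (N u t v v′ + N u u′ v v′)
    pointwise u u′ w t v v′ with square? (g u w) (g u′ w) (g u v) (g u′ v)
    ... | no _ = ≤-trans (pq≤1 u u′ w t v v′) (≤-+ʳ (0≤+ (0≤N u t v v′) (0≤N u u′ v v′)))
    ... | yes s₁ with square? (g u v) (g t v) (g u v′) (g t v′)
    ...   | no _ = ≤-trans (pq≤1 u u′ w t v v′) (≤-trans (≤-+ʳ (0≤N u u′ v v′)) (≤-reflexive (sym (ℚP.+-identityˡ (1ℚ + N u u′ v v′)))))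
    ...   | yes s₂ with square? (g u v) (g u′ v) (g u v′) (g u′ v′)
    ...     | no _ = pq≤1 u u′ w t v v′
    ...     | yes s₃ with g u w Fin.≟ g u′ w
    ...       | yes p = ≤-reflexive (ℚP.*-zeroˡ (Q t v v′))
    ...       | no ¬p with g t v Fin.≟ g t v′
    ...         | yes q = ≤-refl
    ...         | no ¬q = ⊥-elim (impossible s₁ s₂ s₃)
      where
      -- `s₁` carries the difference across `u`, `u′` from `w` to `v`, and `s₂` carries the
      -- difference across `v`, `v′` from `t` to `u`. Both sides then differ at the corner given by
      -- `u` and `v`, which `s₃` excludes. The union over the three squares is the factor 3.
      impossible : Square (g u w) (g u′ w) (g u v) (g u′ v) → Square (g u v) (g t v) (g u v′) (g t v′) →
        Square (g u v) (g u′ v) (g u v′) (g u′ v′) → ⊥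
      impossible (inj₁ (e , _)) _ _ = ¬p e
      impossible (inj₂ (e₁ , e₂)) _ (inj₁ (e , _)) = ¬p (trans e₁ (trans e (sym e₂)))
      impossible (inj₂ _) (inj₁ (f₁ , f₂)) (inj₂ (e , _)) = ¬q (trans (sym f₁) (trans e f₂))
      impossible (inj₂ _) (inj₂ (_ , f)) (inj₂ _) = ¬q f
    collapse : (𝔼 A λ u → 𝔼 A λ u′ → 𝔼 B λ w → 𝔼 A λ t → 𝔼 B λ v → 𝔼 B λ v′ → N u u′ w v + (N u t v v′ + N u u′ v v′)) ≡
      𝔼-quad N + (𝔼-quad N + 𝔼-quad N)
    collapse = trans (cng (linear A) λ u → trans (cng (linear A) λ u′ → trans (cng (linear B) λ w →
        trans (cng (linear A) λ t → trans (cng (linear B) λ v → trans (add (linear B) _ _)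
            (cong₂ _+_ (const B (N u u′ w v)) (add (linear B) (N u t v) (N u u′ v))))
          (trans (add (linear B) (N u u′ w) _) (+-congˡ (𝔼 B (N u u′ w)) (add (linear B) (λ v → 𝔼 B (N u t v)) _))))
        (trans (add (linear A) _ _) (cong₂ _+_ (const A (𝔼 B (N u u′ w))) (trans (add (linear A) (λ t → 𝔼 B λ v → 𝔼 B (N u t v)) _)
          (+-congˡ (n₂ u) (const A (n₁ u u′)))))))
        (trans (add (linear B) (λ w → 𝔼 B (N u u′ w)) _) (+-congˡ (n₁ u u′) (const B (n₂ u + n₁ u u′)))))
        (trans (add (linear A) (n₁ u) _) (+-congˡ (n₂ u) (trans (add (linear A) _ (n₁ u)) (cong (_+ n₂ u) (const A (n₂ u)))))))
        (trans (add (linear A) n₂ _) (+-congˡ (𝔼 A n₂) (add (linear A) n₂ n₂)))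
      where
      n₁ : _ → _ → ℚ
      n₁ u u′ = 𝔼 B λ v → 𝔼 B (N u u′ v)
      n₂ : _ → ℚ
      n₂ u = 𝔼 A (n₁ u)
    re : ∀ x → x + (x + x) ≡ nat 3 * x
    re = solve-∀ ringℚ

coin-flip : ∀ {n} (Φ : Vec Bool n → ℚ) → 𝔼 (coin ^^ n) (λ T → Φ (Vec.map not T)) ≡ 𝔼 (coin ^^ n) Φ
coin-flip {zero} Φ = refl
coin-flip {suc n} Φ = trans (coin-𝔼 λ t → 𝔼 (coin ^^ n) λ T → Φ (not t ∷ Vec.map not T))
  (trans (cong₂ (λ a b → ½ * (a + b)) (coin-flip λ T → Φ (false ∷ T)) (coin-flip λ T → Φ (true ∷ T)))
    (trans (cong (½ *_) (ℚP.+-comm (𝔼 (coin ^^ n) λ T → Φ (false ∷ T)) (𝔼 (coin ^^ n) λ T → Φ (true ∷ T)))) (sym (coin-𝔼 λ t → 𝔼 (coin ^^ n) λ T → Φ (t ∷ T)))))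

partial-split : ∀ {n} (T : Vec Bool n) a → partial T a + partial (Vec.map not T) a ≡ total a
partial-split [] a = refl
partial-split (true ∷ T) a = trans (re (a zero) (partial T (a ∘ suc)) (partial (Vec.map not T) (a ∘ suc)))
  (trans (+-congˡ (a zero) (partial-split T (a ∘ suc))) (sym (∑-allFin-suc a)))
  where
  re : ∀ x p q → x + p + q ≡ x + (p + q)
  re = solve-∀ ringℚ
partial-split (false ∷ T) a = trans (re (a zero) (partial T (a ∘ suc)) (partial (Vec.map not T) (a ∘ suc)))
  (trans (+-congˡ (a zero) (partial-split T (a ∘ suc))) (sym (∑-allFin-suc a)))
  where
  re : ∀ x p q → p + (x + q) ≡ x + (p + q)
  re = solve-∀ ringℚ

partial-nonneg : ∀ {n} (T : Vec Bool n) {a} → (∀ i → 0ℚ ℚ.≤ a i) → 0ℚ ℚ.≤ partial T a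
partial-nonneg [] h = ≤-refl
partial-nonneg (true ∷ T) h = 0≤+ (h zero) (partial-nonneg T (h ∘ suc))
partial-nonneg (false ∷ T) h = partial-nonneg T (h ∘ suc)

partial-∑ : ∀ {Y : Set} (L : List Y) {n} (T : Vec Bool n) (a : Y → Fin n → ℚ) →
  ∑ L (λ y → partial T (a y)) ≡ partial T λ i → ∑ L λ y → a y i
partial-∑ L [] a = zer (∑-linear L)
partial-∑ L (true ∷ T) a = trans (add (∑-linear L) _ _) (+-congˡ (∑ L λ y → a y zero) (partial-∑ L T λ y → a y ∘ suc))
partial-∑ L (false ∷ T) a = partial-∑ L T λ y → a y ∘ suc

-- For i ≠ k, coordinate i is in `T` and k outside with probability ¼, and no coordinate lies on
-- both sides; the difference on the right is the sum over ordered pairs i ≠ k.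
partial-product : ∀ {n} (a : Fin n → ℚ) →
  𝔼 (coin ^^ n) (λ T → partial T a * partial (Vec.map not T) a) ≡
  ¼ * (total a * total a - ∑ (allFin n) λ i → a i * a i)
partial-product {zero} a = refl
partial-product {suc n} a = trans (coin-𝔼 λ t → 𝔼 (coin ^^ n) λ T → partial (t ∷ T) a * partial (Vec.map not (t ∷ T)) a)
  (trans (cong (½ *_) (sym (add (linear (coin ^^ n)) _ _)))
  (trans (sym (scale (linear (coin ^^ n)) ½ _))
  (trans (cng (linear (coin ^^ n)) λ T → trans (pt (a zero) (partial T b) (partial (Vec.map not T) b))
      (cong (λ z → partial T b * partial (Vec.map not T) b + ½ * a zero * z) (partial-split T b)))
  (trans (add (linear (coin ^^ n)) _ _) (trans (cong₂ _+_ (partial-product b) (const (coin ^^ n) _))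
    (trans (re (a zero) (total b) (∑ (allFin n) λ i → b i * b i))
      (cong₂ (λ x y → ¼ * (x * x - y)) (sym (∑-allFin-suc a)) (sym (∑-allFin-suc λ i → a i * a i)))))))))
  where
  b = a ∘ suc
  pt : ∀ x p q → ½ * ((x + p) * q + p * (x + q)) ≡ p * q + ½ * x * (p + q)
  pt = solve-∀ ringℚ
  re : ∀ x s r → ¼ * (s * s - r) + ½ * x * s ≡ ¼ * ((x + s) * (x + s) - (x * x + r))
  re = solve-∀ ringℚ

complement : ∀ {X : Set} (A : Space X) F → 𝔼 A (λ x → 1ℚ - F x) ≡ 1ℚ - 𝔼 A F
complement A F = trans (sub (linear A) (λ _ → 1ℚ) F) (cong (_- 𝔼 A F) (const A 1ℚ))

halve : ∀ {p q} → (1ℚ + 1ℚ) * p ℚ.≤ (1ℚ + 1ℚ) * q → p ℚ.≤ q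
halve {p} {q} h = ≤-trans (≤-reflexive (sym (re p))) (≤-trans (*-monoˡ ½ (lit ½) h) (≤-reflexive (re q)))
  where
  re : ∀ p → ½ * ((1ℚ + 1ℚ) * p) ≡ p
  re = solve-∀ ringℚ

-- Level-one weight and broken squares

module _ {X : Set} (A : Space X) where

  M-not-not : ∀ {n} (T : Vec Bool n) F → 𝕄 A (Vec.map not (Vec.map not T)) F ≡ 𝕄 A T F
  M-not-not [] F = refl
  M-not-not (true ∷ T) F = cng (linear A) λ x → M-not-not T λ v → F (x ∷ v)
  M-not-not (false ∷ T) F = M-not-not T (avg A F)

  quad : ∀ {n} (T : Vec Bool n) → (Vec X n → Vec X n → Vec X n → Vec X n → ℚ) → ℚ
  quad T Φ = 𝔼-quad (selected A T) (selected A (Vec.map not T)) λ u u′ v v′ →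
    Φ (join T u v) (join T u′ v) (join T u v′) (join T u′ v′)

  quad-mixed : ∀ {n} (T : Vec Bool n) F →
    quad T (λ a b c d → mixed (F a) (F b) (F c) (F d) * mixed (F a) (F b) (F c) (F d)) ≡
    nat 4 * (energy A F + 𝔼 (A ^^ n) F * 𝔼 (A ^^ n) F - 𝕄 A T F - 𝕄 A (Vec.map not T) F)
  quad-mixed T F = trans (quad-mixed² (selected A T) (selected A (Vec.map not T)) λ u v → F (join T u v))
    (cong (nat 4 *_) (cong₂ _-_ (cong₂ _-_ (cong₂ _+_ (sym (𝔼-join A T λ v → F v * F v))
      (cong₂ _*_ (sym (𝔼-join A T F)) (sym (𝔼-join A T F)))) (sym (M-join A T F))) (sym (M-join′ A T F))))

  -- On average over `T`, the interaction energy contains level ℓ ≥ 1 with factor 1 - 2 · 2^(-ℓ) and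
  -- the mean not at all: nothing from levels zero and one, at least ½ from each higher level. The
  -- factor 4 of `quad-mixed` turns ½ into 2.
  variance-gap : ∀ {n} (F : Vec X n → ℚ) →
    (1ℚ + 1ℚ) * (energy A F - 𝔼 (A ^^ n) F * 𝔼 (A ^^ n) F - total (weight A F)) ℚ.≤
    𝔼 (coin ^^ n) λ T → quad T λ a b c d → mixed (F a) (F b) (F c) (F d) * mixed (F a) (F b) (F c) (F d)
  variance-gap {n} F = by-nonneg (0≤* (lit (nat 8)) (0≤sub (M-average-≤ A F)))
    (trans (re e μ² (total (weight A F)) s) (cong (_- (1ℚ + 1ℚ) * (e - μ² - total (weight A F))) (sym average)))
    where
    e = energy A F
    μ² = 𝔼 (A ^^ n) F * 𝔼 (A ^^ n) F
    s = 𝔼 (coin ^^ n) λ T → 𝕄 A T F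
    average : 𝔼 (coin ^^ n) (λ T → quad T λ a b c d → mixed (F a) (F b) (F c) (F d) * mixed (F a) (F b) (F c) (F d)) ≡
      nat 4 * (e + μ² - s - s)
    average = trans (cng (linear (coin ^^ n)) λ T → quad-mixed T F)
      (trans (scale (linear (coin ^^ n)) (nat 4) _) (cong (nat 4 *_)
        (trans (sub (linear (coin ^^ n)) _ _) (cong₂ _-_
          (trans (sub (linear (coin ^^ n)) _ _) (cong (_- s) (const (coin ^^ n) (e + μ²))))
          (coin-flip λ T → 𝕄 A T F)))))
    re : ∀ e μ² w s → nat 8 * (¼ * e + ¾ * μ² + ¼ * w - s) ≡ nat 4 * (e + μ² - s - s) - (1ℚ + 1ℚ) * (e - μ² - w)
    re = solve-∀ ringℚ

  -- Required of every partition and not only on average, because `mass-concentrated` bounds a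
  -- product of two influences at each `T`.
  FewBroken : ∀ {m n} → (Vec X n → Fin m) → ℚ → Set
  FewBroken g θ = ∀ T → quad T (λ a b c d → broken (g a) (g b) (g c) (g d)) ℚ.≤ θ

  module Levels {m n : ℕ} (g : Vec X n → Fin m) (θ : ℚ) (squares : FewBroken g θ) where

    level : Fin m → Vec X n → ℚ
    level k v = ind (g v Fin.≟ k)

    mass : Fin n → ℚ
    mass i = ∑ (allFin m) λ k → weight A (level k) i

    -- The collision probability of `g`; `1ℚ - purity` is the sum of the variances of the level
    -- indicators.
    purity : ℚ
    purity = ∑ (allFin m) λ k → 𝔼 (A ^^ n) (level k) * 𝔼 (A ^^ n) (level k)

    private
      Lₘ = ∑-linear (allFin m)

    mass-nonneg : ∀ i → 0ℚ ℚ.≤ mass i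
    mass-nonneg i = ∑-nonneg (allFin m) λ k → weight-nonneg A (level k) i

    ∑-energy : ∑ (allFin m) (λ k → energy A (level k)) ≡ 1ℚ
    ∑-energy = trans (∑-comm (allFin m) (linear (A ^^ n)) _)
      (trans (cng (linear (A ^^ n)) λ v → ∑-ind² (g v)) (one (A ^^ n)))

    ∑-total : ∑ (allFin m) (λ k → total (weight A (level k))) ≡ total mass
    ∑-total = ∑-comm (allFin m) (∑-linear (allFin n)) _

    quad-broken : ∀ Φ → (∀ a b c d → Φ a b c d ℚ.≤ eight * broken (g a) (g b) (g c) (g d)) →
      𝔼 (coin ^^ n) (λ T → quad T Φ) ℚ.≤ eight * θ
    quad-broken Φ h = ≤-trans (mono (coin ^^ n) λ T →
        ≤-trans (quad-mono (selected A T) (selected A (Vec.map not T))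
            λ u u′ v v′ → h (join T u v) (join T u′ v) (join T u v′) (join T u′ v′))
          (≤-trans (≤-reflexive (quad-scale (selected A T) (selected A (Vec.map not T)) eight _))
            (*-monoˡ eight (lit eight) (squares T))))
      (≤-reflexive (const (coin ^^ n) (eight * θ)))

    mass-gap : 1ℚ - purity - total mass ℚ.≤ nat 4 * θ
    mass-gap = halve (≤-trans (≤-reflexive (sym expand)) (≤-trans (∑-mono (allFin m) λ k → variance-gap (level k))
      (≤-trans (≤-reflexive exchange) (≤-trans (quad-broken _ λ a b c d → ∑-mixed² (g a) (g b) (g c) (g d))
        (≤-reflexive (re θ))))))
      where
      re : ∀ θ → eight * θ ≡ (1ℚ + 1ℚ) * (nat 4 * θ)
      re = solve-∀ ringℚ
      expand : ∑ (allFin m) (λ k → (1ℚ + 1ℚ) * (energy A (level k) - 𝔼 (A ^^ n) (level k) * 𝔼 (A ^^ n) (level k)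
          - total (weight A (level k)))) ≡ (1ℚ + 1ℚ) * (1ℚ - purity - total mass)
      expand = trans (scale Lₘ (1ℚ + 1ℚ) _) (cong ((1ℚ + 1ℚ) *_) (trans (sub Lₘ _ _)
        (cong₂ _-_ (trans (sub Lₘ _ _) (cong (_- purity) ∑-energy)) ∑-total)))
      exchange : ∑ (allFin m) (λ k → 𝔼 (coin ^^ n) λ T → quad T λ a b c d →
          mixed (level k a) (level k b) (level k c) (level k d) * mixed (level k a) (level k b) (level k c) (level k d)) ≡
        𝔼 (coin ^^ n) λ T → quad T λ a b c d → ∑ (allFin m) λ k →
          mixed (level k a) (level k b) (level k c) (level k d) * mixed (level k a) (level k b) (level k c) (level k d)
      exchange = trans (∑-comm (allFin m) (linear (coin ^^ n)) _)
        (cng (linear (coin ^^ n)) λ T → quad-∑ (selected A T) (selected A (Vec.map not T)) (allFin m) _)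

    -- Merging values of `g` keeps squares intact, so the estimate passes to functions of the value.
    -- It is applied to the indicator of missing the most likely value.
    image-gap : ∀ (φ : Fin m → ℚ) → (∀ e → 0ℚ ℚ.≤ φ e) → (∀ e → φ e * φ e ℚ.≤ 1ℚ) →
      energy A (φ ∘ g) - 𝔼 (A ^^ n) (φ ∘ g) * 𝔼 (A ^^ n) (φ ∘ g) - total (weight A (φ ∘ g)) ℚ.≤ nat 4 * θ
    image-gap φ h h² = halve (≤-trans (variance-gap (φ ∘ g)) (≤-trans
      (quad-broken _ λ a b c d → mixed²-broken (g a) (g b) (g c) (g d) φ h h²) (≤-reflexive (re θ))))
      where
      re : ∀ θ → eight * θ ≡ (1ℚ + 1ℚ) * (nat 4 * θ)
      re = solve-∀ ringℚ

    ∑-level-agree : ∀ a b → ∑ (allFin m) (λ k → level k a * level k b) ≡ 1ℚ - ind (¬? (g a Fin.≟ g b))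
    ∑-level-agree a b = trans (∑-select (g a) λ k → ind (g b Fin.≟ k))
      (trans (ind-⇔ (g b Fin.≟ g a) (g a Fin.≟ g b) sym sym)
        (trans (re (ind (g a Fin.≟ g b))) (cong (λ z → 1ℚ - z) (sym (ind-¬ (g a Fin.≟ g b))))))
      where
      re : ∀ x → x ≡ 1ℚ - (1ℚ - x)
      re = solve-∀ ringℚ

    partial-mass : ∀ T → partial T mass ≡ ∑ (allFin m) λ k → partial T (weight A (level k))
    partial-mass T = sym (partial-∑ (allFin m) T λ k → weight A (level k))

    ∑-bound : ∀ T (Q : Fin m → ℚ) → (∀ k → partial T (weight A (level k)) + Q k ℚ.≤ energy A (level k)) →
      partial T mass ℚ.≤ 1ℚ - ∑ (allFin m) Q
    ∑-bound T Q h = by-nonneg (0≤sub (∑-mono (allFin m) h))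
      (trans (cong₂ _-_ ∑-energy (trans (add Lₘ _ _) (cong (_+ ∑ (allFin m) Q) (sym (partial-mass T)))))
        (re (partial T mass) (∑ (allFin m) Q)))
      where
      re : ∀ p q → 1ℚ - (p + q) ≡ 1ℚ - q - p
      re = solve-∀ ringℚ

    -- `partial-weight` bounds the level-one weight on `T` by the energy lost on averaging over `T`.
    -- Summed over the indicators, that loss is the chance that resampling the coordinates in `T`
    -- changes `g`.
    partial-mass-≤ : ∀ T → partial T mass ℚ.≤ 𝔼 (selected A T) λ u → 𝔼 (selected A T) λ u′ →
      𝔼 (selected A (Vec.map not T)) λ v → ind (¬? (g (join T u v) Fin.≟ g (join T u′ v)))
    partial-mass-≤ T = ≤-trans (∑-bound T (λ k → 𝕄 A (Vec.map not T) (level k)) λ k → partial-weight A T (level k))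
      (≤-reflexive (trans (cong (λ z → 1ℚ - z) agree) (re q)))
      where
      B = selected A T
      C = selected A (Vec.map not T)
      q = 𝔼 B λ u → 𝔼 B λ u′ → 𝔼 C λ v → ind (¬? (g (join T u v) Fin.≟ g (join T u′ v)))
      re : ∀ x → 1ℚ - (1ℚ - x) ≡ x
      re = solve-∀ ringℚ
      agree : ∑ (allFin m) (λ k → 𝕄 A (Vec.map not T) (level k)) ≡ 1ℚ - q
      agree = trans (cng Lₘ λ k → trans (M-join′ A T (level k)) (trans (cng (linear C) λ v → sym (independent-* B (λ u → level k (join T u v)) λ u → level k (join T u v)))
          (trans (sym (comm B (linear C) _)) (cng (linear B) λ u → sym (comm B (linear C) _)))))
        (trans (∑-comm (allFin m) (linear B) _) (trans (cng (linear B) λ u → trans (∑-comm (allFin m) (linear B) _)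
          (trans (cng (linear B) λ u′ → trans (∑-comm (allFin m) (linear C) _)
            (trans (cng (linear C) λ v → ∑-level-agree (join T u v) (join T u′ v)) (complement C _)))
            (complement B _))) (complement B _)))

    partial-not-mass-≤ : ∀ T → partial (Vec.map not T) mass ℚ.≤ 𝔼 (selected A T) λ u → 𝔼 (selected A (Vec.map not T)) λ v →
      𝔼 (selected A (Vec.map not T)) λ v′ → ind (¬? (g (join T u v) Fin.≟ g (join T u v′)))
    partial-not-mass-≤ T = ≤-trans (∑-bound (Vec.map not T) (λ k → 𝕄 A T (level k)) λ k →
        subst (λ z → partial (Vec.map not T) (weight A (level k)) + z ℚ.≤ energy A (level k)) (M-not-not T (level k))
          (partial-weight A (Vec.map not T) (level k)))
      (≤-reflexive (trans (cong (λ z → 1ℚ - z) agree) (re q)))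
      where
      B = selected A T
      C = selected A (Vec.map not T)
      q = 𝔼 B λ u → 𝔼 C λ v → 𝔼 C λ v′ → ind (¬? (g (join T u v) Fin.≟ g (join T u v′)))
      re : ∀ x → 1ℚ - (1ℚ - x) ≡ x
      re = solve-∀ ringℚ
      agree : ∑ (allFin m) (λ k → 𝕄 A T (level k)) ≡ 1ℚ - q
      agree = trans (cng Lₘ λ k → trans (M-join A T (level k)) (cng (linear B) λ u → sym (independent-* C (λ v → level k (join T u v)) λ v → level k (join T u v))))
        (trans (∑-comm (allFin m) (linear B) _) (trans (cng (linear B) λ u → trans (∑-comm (allFin m) (linear C) _)
          (trans (cng (linear C) λ v → trans (∑-comm (allFin m) (linear C) _)
            (trans (cng (linear C) λ v′ → ∑-level-agree (join T u v) (join T u v′)) (complement C _)))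
            (complement C _))) (complement B _)))

    -- For each partition `influence-product` bounds the product of the two partial masses by 3θ;
    -- undoing the factor ¼ of `partial-product` gives 12θ.
    mass-concentrated : total mass * total mass - ∑ (allFin n) (λ i → mass i * mass i) ℚ.≤ nat 12 * θ
    mass-concentrated = ≤-trans (≤-reflexive (re _)) (≤-trans (*-monoˡ (nat 4) (lit (nat 4))
        (≤-trans (≤-reflexive (sym (partial-product mass))) (≤-trans (mono (coin ^^ n) bound) (≤-reflexive (const (coin ^^ n) (nat 3 * θ))))))
      (≤-reflexive (re′ θ)))
      where
      re : ∀ x → x ≡ nat 4 * (¼ * x)
      re = solve-∀ ringℚ
      re′ : ∀ x → nat 4 * (nat 3 * x) ≡ nat 12 * x
      re′ = solve-∀ ringℚ
      bound : ∀ T → partial T mass * partial (Vec.map not T) mass ℚ.≤ nat 3 * θ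
      bound T = ≤-trans (*-monoˡ (partial T mass) (partial-nonneg T mass-nonneg) (partial-not-mass-≤ T))
        (≤-trans (ℚP.*-monoʳ-≤-nonNeg r {{ℚ.nonNegative 0≤r}} (partial-mass-≤ T))
        (≤-trans (influence-product (selected A T) (selected A (Vec.map not T)) λ u v → g (join T u v))
          (*-monoˡ (nat 3) (lit (nat 3)) (squares T))))
        where
        r = 𝔼 (selected A T) λ u → 𝔼 (selected A (Vec.map not T)) λ v →
          𝔼 (selected A (Vec.map not T)) λ v′ → ind (¬? (g (join T u v) Fin.≟ g (join T u v′)))
        0≤r : 0ℚ ℚ.≤ r
        0≤r = nonneg (selected A T) λ u → nonneg (selected A (Vec.map not T)) λ v → nonneg (selected A (Vec.map not T)) λ v′ →
          0≤ind (¬? (g (join T u v) Fin.≟ g (join T u v′)))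

-- Functions with few broken squares

argmax : ∀ {m} → Fin m → (h : Fin m → ℚ) → ∃ λ k → ∀ k′ → h k′ ℚ.≤ h k
argmax {suc zero} _ h = zero , λ { zero → ≤-refl }
argmax {suc (suc m)} _ h with argmax zero (h ∘ suc)
... | k , hk with ℚP.≤-total (h zero) (h (suc k))
...   | inj₁ le = suc k , λ { zero → le ; (suc k′) → hk k′ }
...   | inj₂ ge = zero , λ { zero → ≤-refl ; (suc k′) → ≤-trans (hk k′) ge }

∑-square-≤ : ∀ {m} (h : Fin m → ℚ) c → (∀ k → 0ℚ ℚ.≤ h k) → (∀ k → h k ℚ.≤ c) →
  ∑ (allFin m) (λ k → h k * h k) ℚ.≤ c * ∑ (allFin m) h
∑-square-≤ {m} h c h≥0 h≤c = ≤-trans (∑-mono (allFin m) λ k →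
    ℚP.*-monoʳ-≤-nonNeg (h k) {{ℚ.nonNegative (h≥0 k)}} (h≤c k)) (≤-reflexive (scale (∑-linear (allFin m)) c h))

term≤total : ∀ {n} (a : Fin n → ℚ) → (∀ i → 0ℚ ℚ.≤ a i) → ∀ i → a i ℚ.≤ total a
term≤total {suc n} a h zero = subst (a zero ℚ.≤_) (sym (∑-allFin-suc a))
  (≤-trans (≤-reflexive (sym (ℚP.+-identityʳ (a zero)))) (ℚP.+-monoʳ-≤ (a zero) (∑-nonneg (allFin n) (h ∘ suc))))
term≤total {suc n} a h (suc i) = subst (a (suc i) ℚ.≤_) (sym (∑-allFin-suc a))
  (≤-trans (term≤total (a ∘ suc) (h ∘ suc) i) (≤-trans (≤-reflexive (sym (ℚP.+-identityˡ (total (a ∘ suc)))))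
    (ℚP.+-monoˡ-≤ (total (a ∘ suc)) (h zero))))

partial-all : ∀ n (a : Fin n → ℚ) → partial (Vec.replicate n true) a ≡ total a
partial-all zero a = refl
partial-all (suc n) a = trans (+-congˡ (a zero) (partial-all n (a ∘ suc))) (sym (∑-allFin-suc a))

module _ {X : Set} (A : Space X) where

  M-nonneg : ∀ {n} (T : Vec Bool n) F → 0ℚ ℚ.≤ 𝕄 A T F
  M-nonneg T F = subst (0ℚ ℚ.≤_) (sym (M-join A T F))
    (nonneg (selected A T) λ u → 0≤sq (𝔼 (selected A (Vec.map not T)) λ v → F (join T u v)))

  total-weight-≤ : ∀ {n} (F : Vec X n → ℚ) → total (weight A F) ℚ.≤ energy A F
  total-weight-≤ {n} F = ≤-trans (≤-reflexive (sym (trans (ℚP.+-identityʳ _) (partial-all n (weight A F)))))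
    (≤-trans (ℚP.+-monoʳ-≤ (partial all (weight A F)) (M-nonneg (Vec.map not all) F)) (partial-weight A all F))
    where
    all = Vec.replicate n true

  -- The product measure conditioned on coordinate i being r.
  pin : ∀ {n} → Fin n → X → Space (Vec X n)
  pin {suc n} zero r = pairing _∷_ (unit r) (A ^^ n)
  pin (suc i) r = pairing _∷_ A (pin i r)

  𝔼-pin : ∀ {n} (i : Fin n) F → 𝔼 (A ^^ n) F ≡ 𝔼 A λ r → 𝔼 (pin i r) F
  𝔼-pin zero F = refl
  𝔼-pin (suc i) F = trans (cng (linear A) λ x → 𝔼-pin i λ v → F (x ∷ v)) (comm A (linear A) _)

  pin-lookup : ∀ {n} (i : Fin n) r (Φ : Vec X n → X → ℚ) →
    𝔼 (pin i r) (λ v → Φ v (lookup v i)) ≡ 𝔼 (pin i r) λ v → Φ v r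
  pin-lookup zero r Φ = refl
  pin-lookup (suc i) r Φ = cng (linear A) λ x → pin-lookup i r λ v → Φ (x ∷ v)

  -- Replaces the recursion on the head by conditioning on coordinate `i`, the form needed for the
  -- level-one projection and for `round`.
  weight-pin : ∀ {n} (F : Vec X n → ℚ) i → weight A F i ≡
    𝔼 A (λ r → 𝔼 (pin i r) F * 𝔼 (pin i r) F) - 𝔼 (A ^^ n) F * 𝔼 (A ^^ n) F
  weight-pin F zero = refl
  weight-pin F (suc i) = trans (weight-pin (avg A F) i)
    (cong₂ _-_ (cng (linear A) λ r → cong₂ _*_ (eq r) (eq r)) (cong₂ _*_ (𝔼-avg A F) (𝔼-avg A F)))
    where
    eq : ∀ r → 𝔼 (pin i r) (avg A F) ≡ 𝔼 (pin (suc i) r) F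
    eq r = comm (pin i r) (linear A) _

  -- Fourth moments and the level-one weight of small sets

  sumOf : ∀ {n} → (Fin n → X → ℚ) → Vec X n → ℚ
  sumOf {n} y v = ∑ (allFin n) λ i → y i (lookup v i)

  sumOf-suc : ∀ {n} (y : Fin (suc n) → X → ℚ) x v → sumOf y (x ∷ v) ≡ y zero x + sumOf (y ∘ suc) v
  sumOf-suc y x v = ∑-allFin-suc λ i → y i (lookup (x ∷ v) i)

  square-sum : ∀ {n} → (Fin n → X → ℚ) → ℚ
  square-sum y = total λ i → 𝔼 A λ x → y i x * y i x

  fourth-sum : ∀ {n} → (Fin n → X → ℚ) → ℚ
  fourth-sum y = total λ i → 𝔼 A λ x → y i x * y i x * (y i x * y i x)

  module _ {V : Set} (B : Space V) (a : X → ℚ) (s : V → ℚ) (𝔼a : 𝔼 A a ≡ 0ℚ) (𝔼s : 𝔼 B s ≡ 0ℚ) where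

    private
      D = A ⊗ B
      prod : (f : X → ℚ) (h : V → ℚ) → 𝔼 D (λ (x , v) → f x * h v) ≡ 𝔼 A f * 𝔼 B h
      prod f h = trans (cng (linear A) λ x → scale (linear B) (f x) h) (scaleʳ (linear A) (𝔼 B h) f)
      left : (f : X → ℚ) → 𝔼 D (λ (x , v) → f x) ≡ 𝔼 A f
      left f = cng (linear A) λ x → const B (f x)
      right : (h : V → ℚ) → 𝔼 D (λ (x , v) → h v) ≡ 𝔼 B h
      right h = const A (𝔼 B h)

    second-moment-+ : 𝔼 D (λ (x , v) → (a x + s v) * (a x + s v)) ≡ 𝔼 A (λ x → a x * a x) + 𝔼 B λ v → s v * s v
    second-moment-+ = trans (cng (linear D) λ (x , v) → pt (a x) (s v))
      (trans (add (linear D) (λ (x , v) → a x * a x) _)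
      (trans (cong₂ _+_ (left λ x → a x * a x) (trans (add (linear D) (λ (x , v) → (a x + a x) * s v) _)
        (cong₂ _+_ (trans (prod (λ x → a x + a x) s) (cong (λ z → c * z) 𝔼s)) (right λ v → s v * s v))))
        (re (𝔼 A λ x → a x * a x) c (𝔼 B λ v → s v * s v))))
      where
      c = 𝔼 A λ x → a x + a x
      pt : ∀ a s → (a + s) * (a + s) ≡ a * a + ((a + a) * s + s * s)
      pt = solve-∀ ringℚ
      re : ∀ a c s → a + (c * 0ℚ + s) ≡ a + s
      re = solve-∀ ringℚ

    -- The terms in a³s and as³ vanish, since both means are zero and the variables are independent.
    fourth-moment-+ : 𝔼 D (λ (x , v) → (a x + s v) * (a x + s v) * ((a x + s v) * (a x + s v))) ≡
      𝔼 A (λ x → a x * a x * (a x * a x)) + nat 6 * (𝔼 A (λ x → a x * a x) * 𝔼 B λ v → s v * s v)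
        + 𝔼 B λ v → s v * s v * (s v * s v)
    fourth-moment-+ = trans (cng (linear D) λ (x , v) → pt (a x) (s v))
      (trans (add (linear D) (λ (x , v) → a x * a x * (a x * a x)) _)
      (trans (cong₂ _+_ (left λ x → a x * a x * (a x * a x))
        (trans (add (linear D) (λ (x , v) → nat 4 * (a x * a x * a x) * s v) _)
        (trans (cong₂ _+_ (trans (prod (λ x → nat 4 * (a x * a x * a x)) s) (cong (λ z → c₃ * z) 𝔼s))
          (trans (add (linear D) (λ (x , v) → nat 6 * (a x * a x) * (s v * s v)) _)
          (cong₂ _+_ (trans (prod (λ x → nat 6 * (a x * a x)) (λ v → s v * s v)) (cong (_* s₂) (scale (linear A) (nat 6) _)))
            (trans (add (linear D) (λ (x , v) → a x * (nat 4 * (s v * s v * s v))) _)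
            (cong₂ _+_ (trans (prod a (λ v → nat 4 * (s v * s v * s v))) (cong (λ z → z * d₃) 𝔼a)) (right λ v → s v * s v * (s v * s v)))))))
        (re₁ c₃ d₃ a₂ s₂ s₄)))) (re₂ a₄ (nat 6 * (a₂ * s₂)) s₄)))
      where
      c₃ = 𝔼 A λ x → nat 4 * (a x * a x * a x)
      d₃ = 𝔼 B λ v → nat 4 * (s v * s v * s v)
      a₂ = 𝔼 A λ x → a x * a x
      a₄ = 𝔼 A λ x → a x * a x * (a x * a x)
      s₂ = 𝔼 B λ v → s v * s v
      s₄ = 𝔼 B λ v → s v * s v * (s v * s v)
      pt : ∀ a s → (a + s) * (a + s) * ((a + s) * (a + s)) ≡
        a * a * (a * a) + (nat 4 * (a * a * a) * s + (nat 6 * (a * a) * (s * s) + (a * (nat 4 * (s * s * s)) + s * s * (s * s))))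
      pt = solve-∀ ringℚ
      re₁ : ∀ c d a s t → c * 0ℚ + (nat 6 * a * s + (0ℚ * d + t)) ≡ nat 6 * (a * s) + t
      re₁ = solve-∀ ringℚ
      re₂ : ∀ a b c → a + (b + c) ≡ a + b + c
      re₂ = solve-∀ ringℚ

  sumOf-mean : ∀ {n} (y : Fin n → X → ℚ) → (∀ i → 𝔼 A (y i) ≡ 0ℚ) → 𝔼 (A ^^ n) (sumOf y) ≡ 0ℚ
  sumOf-mean {zero} y h = refl
  sumOf-mean {suc n} y h = trans (cng (linear A) λ x → trans (cng (linear (A ^^ n)) λ v → sumOf-suc y x v)
      (trans (add (linear (A ^^ n)) (λ v → y zero x) _) (cong₂ _+_ (const (A ^^ n) (y zero x)) (sumOf-mean (y ∘ suc) (h ∘ suc)))))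
    (trans (cng (linear A) λ x → ℚP.+-identityʳ (y zero x)) (h zero))

  sumOf-square : ∀ {n} (y : Fin n → X → ℚ) → (∀ i → 𝔼 A (y i) ≡ 0ℚ) →
    𝔼 (A ^^ n) (λ v → sumOf y v * sumOf y v) ≡ square-sum y
  sumOf-square {zero} y h = refl
  sumOf-square {suc n} y h = trans (cng (linear (A ⊗ (A ^^ n))) λ (x , v) → cong₂ _*_ (sumOf-suc y x v) (sumOf-suc y x v))
    (trans (second-moment-+ (A ^^ n) (y zero) (sumOf (y ∘ suc)) (h zero) (sumOf-mean (y ∘ suc) (h ∘ suc)))
      (trans (+-congˡ (𝔼 A λ x → y zero x * y zero x) (sumOf-square (y ∘ suc) (h ∘ suc)))
        (sym (∑-allFin-suc λ i → 𝔼 A λ x → y i x * y i x))))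

  -- The cross term 6 · a₂ · σ of the induction step is exactly the one in 3(a₂ + σ)², so each step
  -- only discards 3a₂².
  sumOf-fourth : ∀ {n} (y : Fin n → X → ℚ) → (∀ i → 𝔼 A (y i) ≡ 0ℚ) →
    𝔼 (A ^^ n) (λ v → sumOf y v * sumOf y v * (sumOf y v * sumOf y v)) ℚ.≤
    nat 3 * (square-sum y * square-sum y) + fourth-sum y
  sumOf-fourth {zero} y h = ≤-refl
  sumOf-fourth {suc n} y h = ≤-trans (≤-reflexive (trans
      (cng (linear (A ⊗ (A ^^ n))) λ (x , v) → cong (λ z → z * z * (z * z)) (sumOf-suc y x v))
      (trans (fourth-moment-+ (A ^^ n) (y zero) (sumOf (y ∘ suc)) (h zero) (sumOf-mean (y ∘ suc) (h ∘ suc)))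
        (cong (λ z → a₄ + nat 6 * (a₂ * z) + t) (sumOf-square (y ∘ suc) (h ∘ suc))))))
    (by-nonneg (0≤+ (0≤sub (sumOf-fourth (y ∘ suc) (h ∘ suc))) (0≤* (lit (nat 3)) (0≤sq a₂)))
      (trans (re a₂ a₄ σ f t) (cong₂ (λ p q → nat 3 * (p * p) + q - (a₄ + nat 6 * (a₂ * σ) + t))
        (sym (∑-allFin-suc λ i → 𝔼 A λ x → y i x * y i x)) (sym (∑-allFin-suc λ i → 𝔼 A λ x → y i x * y i x * (y i x * y i x))))))
    where
    a₂ = 𝔼 A λ x → y zero x * y zero x
    a₄ = 𝔼 A λ x → y zero x * y zero x * (y zero x * y zero x)
    σ = square-sum (y ∘ suc)
    f = fourth-sum (y ∘ suc)
    t = 𝔼 (A ^^ n) λ v → sumOf (y ∘ suc) v * sumOf (y ∘ suc) v * (sumOf (y ∘ suc) v * sumOf (y ∘ suc) v)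
    re : ∀ a₂ a₄ σ f t → nat 3 * (σ * σ) + f - t + nat 3 * (a₂ * a₂) ≡
      nat 3 * ((a₂ + σ) * (a₂ + σ)) + (a₄ + f) - (a₄ + nat 6 * (a₂ * σ) + t)
    re = solve-∀ ringℚ

  -- Every point has measure at least 1/K.
  Atomic : ℚ → Set
  Atomic K = ∀ (φ : X → ℚ) → (∀ x → 0ℚ ℚ.≤ φ x) → ∀ r → φ r ℚ.≤ K * 𝔼 A φ

  module _ (K : ℚ) (atom : Atomic K) where

    1≤K : 1ℚ ℚ.≤ K
    1≤K = ≤-trans (atom (λ _ → 1ℚ) (λ _ → lit 1ℚ) (proj₁ (attain A (λ _ → 0ℚ) 0ℚ (≤-reflexive (zer (linear A))))))
      (≤-reflexive (trans (cong (K *_) (one A)) (ℚP.*-identityʳ K)))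

    0≤K : 0ℚ ℚ.≤ K
    0≤K = ≤-trans (lit 1ℚ) 1≤K

    module _ {n} (b : Vec X n → ℚ) (b-idem : ∀ v → b v * b v ≡ b v) where

      private
        p = 𝔼 (A ^^ n) b
        W = total (weight A b)

        0≤b : ∀ v → 0ℚ ℚ.≤ b v
        0≤b v = subst (0ℚ ℚ.≤_) (b-idem v) (0≤sq (b v))

        -- The Efron-Stein component of `b` at coordinate `i`; the sum `S` below is the level-one
        -- projection of `b`.
        y : Fin n → X → ℚ
        y i r = 𝔼 (pin i r) b - p

        y-mean : ∀ i → 𝔼 A (y i) ≡ 0ℚ
        y-mean i = trans (sub (linear A) _ _) (trans (cong₂ _-_ (sym (𝔼-pin i b)) (const A p)) (ℚP.+-inverseʳ p))

        weight-y : ∀ i → weight A b i ≡ 𝔼 A λ r → y i r * y i r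
        weight-y i = trans (weight-pin b i) (trans (cong (_- p * p) (variance A (λ r → 𝔼 (pin i r) b)))
          (trans (cong (λ z → z * z + 𝔼 A (λ r → (𝔼 (pin i r) b - z) * (𝔼 (pin i r) b - z)) - p * p) (sym (𝔼-pin i b)))
            (re (p * p) (𝔼 A λ r → y i r * y i r))))
          where
          re : ∀ a b → a + b - a ≡ b
          re = solve-∀ ringℚ

        correlation : ∀ i → 𝔼 (A ^^ n) (λ v → b v * y i (lookup v i)) ≡ weight A b i
        correlation i = trans (𝔼-pin i _) (trans (cng (linear A) λ r → trans (pin-lookup i r λ v x → b v * y i x)
            (trans (scaleʳ (linear (pin i r)) (y i r) b) (re (𝔼 (pin i r) b) p)))
          (trans (sub (linear A) _ _) (trans (cong (λ z → 𝔼 A (λ r → 𝔼 (pin i r) b * 𝔼 (pin i r) b) - z)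
            (trans (scale (linear A) p _) (cong (p *_) (sym (𝔼-pin i b))))) (sym (weight-pin b i)))))
          where
          re : ∀ a p → a * (a - p) ≡ a * a - p * a
          re = solve-∀ ringℚ

        pin-≤ : ∀ i r → 𝔼 (pin i r) b ℚ.≤ K * p
        pin-≤ i r = ≤-trans (atom (λ r → 𝔼 (pin i r) b) (λ r → nonneg (pin i r) 0≤b) r)
          (≤-reflexive (cong (K *_) (sym (𝔼-pin i b))))

        -- `y i r` lies between -p and (K - 1)p, and both ends have modulus at most Kp because K ≥
        -- 1.
        y²-≤ : ∀ i r → y i r * y i r ℚ.≤ K * p * (K * p)
        y²-≤ i r = by-nonneg (0≤* (0≤+ (0≤sub (pin-≤ i r)) 0≤p)
            (0≤+ (0≤* (0≤sub 1≤K) 0≤p) (nonneg (pin i r) 0≤b))) (re K p (𝔼 (pin i r) b))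
          where
          0≤p = nonneg (A ^^ n) 0≤b
          re : ∀ K p a → (K * p - a + p) * ((K - 1ℚ) * p + a) ≡ K * p * (K * p) - (a - p) * (a - p)
          re = solve-∀ ringℚ

        square-sum-y : square-sum y ≡ W
        square-sum-y = cng (∑-linear (allFin n)) λ i → sym (weight-y i)

        fourth-sum-y : fourth-sum y ℚ.≤ K * p * (K * p) * W
        fourth-sum-y = ≤-trans (∑-mono (allFin n) λ i → ≤-trans (mono A λ r →
            ℚP.*-monoʳ-≤-nonNeg (y i r * y i r) {{ℚ.nonNegative (0≤sq (y i r))}} (y²-≤ i r))
            (≤-reflexive (trans (scale (linear A) (K * p * (K * p)) _) (cong (K * p * (K * p) *_) (sym (weight-y i))))))
          (≤-reflexive (scale (∑-linear (allFin n)) (K * p * (K * p)) _))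

        S : Vec X n → ℚ
        S = sumOf y

        -- For b ∈ {0, 1} this is S ≤ ½ + 2 S⁴.
        pointwise : ∀ v → b v * S v ℚ.≤ ½ * b v + (1ℚ + 1ℚ) * (S v * S v * (S v * S v))
        pointwise v = by-nonneg (0≤+ (0≤* (0≤b v) (0≤+ (0≤sq (S v - ½)) (lit (½ * ¼))))
            (0≤* (lit (1ℚ + 1ℚ)) (0≤+ (0≤* (0≤b v) (0≤sq (S v * S v - ¼))) (0≤* 0≤1-b (0≤sq (S v * S v))))))
            (re (b v) (S v))
          where
          re₀ : ∀ b → (1ℚ - b) * (1ℚ - b) ≡ 1ℚ - b + (b * b - b)
          re₀ = solve-∀ ringℚ
          0≤1-b : 0ℚ ℚ.≤ 1ℚ - b v
          0≤1-b = subst (0ℚ ℚ.≤_) (trans (re₀ (b v)) (trans (cong (λ z → 1ℚ - b v + (z - b v)) (b-idem v))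
            (trans (+-congˡ (1ℚ - b v) (ℚP.+-inverseʳ (b v))) (ℚP.+-identityʳ (1ℚ - b v))))) (0≤sq (1ℚ - b v))
          re : ∀ b s → b * ((s - ½) * (s - ½) + ½ * ¼) + (1ℚ + 1ℚ) * (b * ((s * s - ¼) * (s * s - ¼)) + (1ℚ - b) * (s * s * (s * s))) ≡
            ½ * b + (1ℚ + 1ℚ) * (s * s * (s * s)) - b * s
          re = solve-∀ ringℚ

      -- Since `S` is a projection of `b`, the expectation of bS is its weight `W`. Bounding bS by
      -- ½b plus a fourth power leaves ½p and terms of higher order, where Cauchy-Schwarz would give
      -- only W ≤ p.
      level-one-≤ : total (weight A b) ℚ.≤
        ½ * p + (1ℚ + 1ℚ) * (nat 3 * (W * W) + K * p * (K * p) * W)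
      level-one-≤ = ≤-trans (≤-reflexive (sym inner)) (≤-trans (mono (A ^^ n) pointwise)
        (≤-trans (≤-reflexive (trans (add (linear (A ^^ n)) (λ v → ½ * b v) _)
            (cong₂ _+_ (scale (linear (A ^^ n)) ½ b) (scale (linear (A ^^ n)) (1ℚ + 1ℚ) _))))
          (ℚP.+-monoʳ-≤ (½ * p) (*-monoˡ (1ℚ + 1ℚ) (lit (1ℚ + 1ℚ)) (≤-trans (sumOf-fourth y y-mean)
            (≤-trans (ℚP.+-monoʳ-≤ (nat 3 * (square-sum y * square-sum y)) fourth-sum-y)
              (≤-reflexive (cong (λ z → nat 3 * (z * z) + K * p * (K * p) * W) square-sum-y))))))))
        where
        inner : 𝔼 (A ^^ n) (λ v → b v * S v) ≡ W
        inner = trans (cng (linear (A ^^ n)) λ v → sym (scale (∑-linear (allFin n)) (b v) _))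
          (trans (sym (∑-comm (allFin n) (linear (A ^^ n)) _)) (cng (∑-linear (allFin n)) correlation))

      -- With W ≤ p and Kp ≤ 1/32, `level-one-≤` leaves p - p² - W at least p(½ - 7/32 - 2/32²) ≥
      -- p/4; the 7 collects p² and 6W².
      small-set : ∀ δ → 𝔼 (A ^^ n) b - 𝔼 (A ^^ n) b * 𝔼 (A ^^ n) b - total (weight A b) ℚ.≤ δ →
        nat 32 * (K * p) ℚ.≤ 1ℚ → p ℚ.≤ nat 4 * δ
      small-set δ gap small = by-nonneg
          (0≤+ (0≤* (lit (nat 4)) (0≤+ (0≤sub gap) (0≤+ (0≤sub level-one-≤)
              (0≤+ (0≤* (lit (nat 6)) (0≤* (0≤sub W≤p) (0≤+ 0≤W 0≤p)))
              (0≤+ (0≤* (lit (1ℚ + 1ℚ)) (0≤* (0≤sq (K * p)) (0≤sub W≤p)))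
                (0≤+ (0≤* (lit (nat 7 * i)) (0≤* 0≤p (0≤sub 32p≤1)))
                  (0≤* (lit (1ℚ + 1ℚ)) (0≤* 0≤p (0≤sub Kp²≤))))))))) (0≤* (lit (1ℚ - nat 28 * i - nat 8 * (i * i))) 0≤p))
          (re p δ W (K * p))
        where
        0≤p = nonneg (A ^^ n) 0≤b
        0≤W : 0ℚ ℚ.≤ W
        0≤W = ∑-nonneg (allFin n) (weight-nonneg A b)
        W≤p : W ℚ.≤ p
        W≤p = ≤-trans (total-weight-≤ b) (≤-reflexive (cng (linear (A ^^ n)) b-idem))
        i : ℚ
        i = inverse 32
        32p≤1 : nat 32 * p ℚ.≤ 1ℚ
        32p≤1 = ≤-trans (*-monoˡ {p} {K * p} (nat 32) (lit (nat 32)) (by-nonneg (0≤* (0≤sub 1≤K) 0≤p) (re′ K p))) small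
          where
          re′ : ∀ K p → (K - 1ℚ) * p ≡ K * p - p
          re′ = solve-∀ ringℚ
        Kp²≤ : K * p * (K * p) ℚ.≤ i * i
        Kp²≤ = by-nonneg (0≤* (0≤* (lit (i * i)) (0≤sub small)) (0≤+ (lit 1ℚ) (0≤* (lit (nat 32)) (0≤* 0≤K 0≤p)))) (re′ (K * p))
          where
          re′ : ∀ q → i * i * (1ℚ - nat 32 * q) * (1ℚ + nat 32 * q) ≡ i * i - q * q
          re′ = solve-∀ ringℚ
        re : ∀ p δ W q → nat 4 * (δ - (p - p * p - W) + ((½ * p + (1ℚ + 1ℚ) * (nat 3 * (W * W) + q * q * W)) - W +
          (nat 6 * ((p - W) * (W + p)) + ((1ℚ + 1ℚ) * (q * q * (p - W)) + (nat 7 * i * (p * (1ℚ - nat 32 * p)) + (1ℚ + 1ℚ) * (p * (i * i - q * q))))))) +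
          (1ℚ - nat 28 * i - nat 8 * (i * i)) * p ≡ nat 4 * δ - p
        re = solve-∀ ringℚ

-- From few broken squares to a single coordinate

module _ {X : Set} (A : Space X) {m n : ℕ} (g : Vec X (suc n) → Fin m) (θ : ℚ) (squares : FewBroken A g θ)
  (K : ℚ) (atom : Atomic A K) where

  open Levels A g θ squares

  private
    B = A ^^ suc n
    Lₘ = ∑-linear (allFin m)

  inhabitant : Fin m
  inhabitant = g (proj₁ (attain B (λ _ → 0ℚ) 0ℚ (≤-reflexive (zer (linear B)))))

  ∑-level : ∀ v → ∑ (allFin m) (λ k → level k v) ≡ 1ℚ
  ∑-level v = trans (cng Lₘ λ k → sym (ℚP.*-identityʳ (level k v))) (∑-select (g v) λ _ → 1ℚ)

  ∑-𝔼-level : (C : Space (Vec X (suc n))) → ∑ (allFin m) (λ k → 𝔼 C (level k)) ≡ 1ℚ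
  ∑-𝔼-level C = trans (∑-comm (allFin m) (linear C) level) (trans (cng (linear C) ∑-level) (one C))

  0≤level : ∀ k v → 0ℚ ℚ.≤ level k v
  0≤level k v = 0≤ind (g v Fin.≟ k)

  0≤θ : 0ℚ ℚ.≤ θ
  0≤θ = ≤-trans (nonneg (selected A all) λ u → nonneg (selected A all) λ u′ → nonneg (selected A (Vec.map not all)) λ v →
    nonneg (selected A (Vec.map not all)) λ v′ → 0≤ind (¬? (square? (g (join all u v)) (g (join all u′ v)) (g (join all u v′)) (g (join all u′ v′)))))
    (squares all)
    where
    all = Vec.replicate (suc n) true

  -- η picks the most likely value pₖ = Pr[g = k | x_i = r], and Σₖ pₖ² ≤ maxₖ pₖ.
  round : ∀ i → ∃ λ (η : X → Fin m) → 𝔼 B (λ v → ind (¬? (g v Fin.≟ η (lookup v i)))) ℚ.≤ 1ℚ - purity - mass i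
  round i = η , ≤-trans (≤-reflexive (trans (cng (linear B) λ v → ind-¬ (g v Fin.≟ η (lookup v i))) (complement B λ v → level (η (lookup v i)) v)))
    (by-nonneg (0≤sub agree) (re (𝔼 B λ v → level (η (lookup v i)) v) purity (mass i)))
    where
    likely : ∀ r → ∃ λ k → ∀ k′ → 𝔼 (pin A i r) (level k′) ℚ.≤ 𝔼 (pin A i r) (level k)
    likely r = argmax inhabitant λ k → 𝔼 (pin A i r) (level k)
    η : X → Fin m
    η r = proj₁ (likely r)
    re : ∀ e p w → e - (w + p) ≡ 1ℚ - p - w - (1ℚ - e)
    re = solve-∀ ringℚ
    re′ : ∀ a b → a ≡ a - b + b
    re′ = solve-∀ ringℚ
    moments : 𝔼 A (λ r → ∑ (allFin m) λ k → 𝔼 (pin A i r) (level k) * 𝔼 (pin A i r) (level k)) ≡ mass i + purity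
    moments = trans (sym (∑-comm (allFin m) (linear A) _)) (trans (cng Lₘ λ k →
        trans (re′ _ (𝔼 B (level k) * 𝔼 B (level k))) (cong (_+ 𝔼 B (level k) * 𝔼 B (level k)) (sym (weight-pin A (level k) i))))
      (add Lₘ _ _))
    agree : mass i + purity ℚ.≤ 𝔼 B λ v → level (η (lookup v i)) v
    agree = ≤-trans (≤-reflexive (sym moments)) (≤-trans (mono A λ r →
        ≤-trans (∑-square-≤ _ (𝔼 (pin A i r) (level (η r))) (λ k → nonneg (pin A i r) (0≤level k)) (proj₂ (likely r)))
          (≤-reflexive (trans (cong (𝔼 (pin A i r) (level (η r)) *_) (∑-𝔼-level (pin A i r))) (ℚP.*-identityʳ _))))
      (≤-reflexive (sym (trans (𝔼-pin A i _) (cng (linear A) λ r → pin-lookup A i r λ v x → level (η x) v)))))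

  -- The probability p of missing the most likely value is at most `1ℚ - purity`, because Σ pₖ² ≤
  -- max pₖ, and `mass-gap` bounds this by the total mass plus 4θ. Each hypothesis contributes ½ to
  -- the condition 32Kp ≤ 1 of `small-set`, which then improves the bound to 4 · 4θ, free of `K`.
  near-constant : nat 64 * (K * total mass) ℚ.≤ 1ℚ → nat 256 * (K * θ) ℚ.≤ 1ℚ →
    ∃ λ k → 𝔼 B (λ v → ind (¬? (g v Fin.≟ k))) ℚ.≤ nat 16 * θ
  near-constant small-mass small-θ = k , ≤-trans (small-set A K atom b b-idem (nat 4 * θ) gap small) (≤-reflexive (re₀ θ))
    where
    best = argmax inhabitant λ k → 𝔼 B (level k)
    k = proj₁ best
    φ : Fin m → ℚ
    φ e = ind (¬? (e Fin.≟ k))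
    b = λ v → φ (g v)
    p = 𝔼 B b
    b-idem : ∀ v → b v * b v ≡ b v
    b-idem v = ind-idem (¬? (g v Fin.≟ k))
    0≤φ : ∀ e → 0ℚ ℚ.≤ φ e
    0≤φ e = 0≤ind (¬? (e Fin.≟ k))
    φ²≤1 : ∀ e → φ e * φ e ℚ.≤ 1ℚ
    φ²≤1 e = ≤-trans (≤-reflexive (ind-idem (¬? (e Fin.≟ k)))) (ind≤1 (¬? (e Fin.≟ k)))
    gap : p - p * p - total (weight A b) ℚ.≤ nat 4 * θ
    gap = subst (λ e → e - p * p - total (weight A b) ℚ.≤ nat 4 * θ) (cng (linear B) b-idem) (image-gap φ 0≤φ φ²≤1)
    re₀ : ∀ θ → nat 4 * (nat 4 * θ) ≡ nat 16 * θ
    re₀ = solve-∀ ringℚ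
    purity-≤ : purity ℚ.≤ 1ℚ - p
    purity-≤ = ≤-trans (∑-square-≤ _ (𝔼 B (level k)) (λ k′ → nonneg B (0≤level k′)) (proj₂ best))
      (≤-reflexive (trans (cong (𝔼 B (level k) *_) (∑-𝔼-level B)) (trans (ℚP.*-identityʳ (𝔼 B (level k)))
        (trans (re (𝔼 B (level k))) (cong (λ z → 1ℚ - z) (sym (trans (cng (linear B) λ v → ind-¬ (g v Fin.≟ k)) (complement B (level k)))))))))
      where
      re : ∀ x → x ≡ 1ℚ - (1ℚ - x)
      re = solve-∀ ringℚ
    small : nat 32 * (K * p) ℚ.≤ 1ℚ
    small = by-nonneg (0≤+ (0≤* (lit ½) (0≤+ (0≤sub small-mass) (0≤sub small-θ)))
        (0≤* (lit (nat 32)) (0≤* (0≤K A K atom) (0≤+ (0≤sub purity-≤) (0≤sub mass-gap)))))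
      (re K p (total mass) θ purity)
      where
      re : ∀ K p w θ q → ½ * (1ℚ - nat 64 * (K * w) + (1ℚ - nat 256 * (K * θ))) + nat 32 * (K * (1ℚ - p - q + (nat 4 * θ - (1ℚ - q - w)))) ≡
        1ℚ - nat 32 * (K * p)
      re = solve-∀ ringℚ

  -- With W the total mass and x the largest mass, Σ wᵢ² ≤ xW and `mass-concentrated` give W(W - x)
  -- ≤ 12θ. Dividing by W ≥ 1/(64K) yields W - x ≤ 768Kθ; `mass-gap` adds 4θ, and `round` converts
  -- the result into an error probability.
  near-dictator : 1ℚ ℚ.≤ nat 64 * (K * total mass) →
    ∃ λ i → ∃ λ (η : X → Fin m) → 𝔼 B (λ v → ind (¬? (g v Fin.≟ η (lookup v i)))) ℚ.≤ nat 772 * (K * θ)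
  near-dictator large = i , proj₁ (round i) , ≤-trans (proj₂ (round i)) (by-nonneg
      (0≤+ (0≤sub mass-gap) (0≤+ (0≤* (lit (nat 4)) (0≤* (0≤sub (1≤K A K atom)) 0≤θ))
        (0≤+ (0≤* (0≤sub large) (0≤sub (term≤total mass mass-nonneg i)))
          (0≤* (0≤* (lit (nat 64)) (0≤K A K atom)) (0≤+ (0≤sub mass-concentrated)
            (0≤sub (∑-square-≤ mass (mass i) mass-nonneg (proj₂ heaviest))))))))
      (re K θ (total mass) (mass i) purity (∑ (allFin (suc n)) λ i → mass i * mass i)))
    where
    heaviest = argmax zero mass
    i = proj₁ heaviest
    re : ∀ K θ w x q s → nat 4 * θ - (1ℚ - q - w) + (nat 4 * ((K - 1ℚ) * θ) + ((nat 64 * (K * w) - 1ℚ) * (w - x)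
      + nat 64 * K * (nat 12 * θ - (w * w - s) + (x * w - s)))) ≡ nat 772 * (K * θ) - (1ℚ - q - x)
    re = solve-∀ ringℚ

  few-broken-squares : nat 256 * (K * θ) ℚ.≤ 1ℚ →
    ∃ λ i → ∃ λ (η : X → Fin m) → 𝔼 B (λ v → ind (¬? (g v Fin.≟ η (lookup v i)))) ℚ.≤ nat 772 * (K * θ)
  few-broken-squares small-θ = by-mass (ℚP.≤-total 1ℚ (nat 64 * (K * total mass)))
    where
    weaken : ∀ K θ → nat 756 * θ + nat 772 * ((K - 1ℚ) * θ) ≡ nat 772 * (K * θ) - nat 16 * θ
    weaken = solve-∀ ringℚ
    constant : (∃ λ k → 𝔼 B (λ v → ind (¬? (g v Fin.≟ k))) ℚ.≤ nat 16 * θ) →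
      ∃ λ i → ∃ λ (η : X → Fin m) → 𝔼 B (λ v → ind (¬? (g v Fin.≟ η (lookup v i)))) ℚ.≤ nat 772 * (K * θ)
    -- A constant is recorded as a function of voter `zero`; whether the voter matters is settled
    -- only in rounding.
    constant (k , hk) = zero , (λ _ → k) , ≤-trans hk (by-nonneg
      (0≤+ (0≤* (0≤nat 756) 0≤θ) (0≤* (0≤nat 772) (0≤* (0≤sub (1≤K A K atom)) 0≤θ))) (weaken K θ))
    by-mass : 1ℚ ℚ.≤ nat 64 * (K * total mass) ⊎ nat 64 * (K * total mass) ℚ.≤ 1ℚ →
      ∃ λ i → ∃ λ (η : X → Fin m) → 𝔼 B (λ v → ind (¬? (g v Fin.≟ η (lookup v i)))) ℚ.≤ nat 772 * (K * θ)
    by-mass (inj₁ large) = near-dictator large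
    by-mass (inj₂ small) = constant (near-constant small small-θ)

-- Rankings

module _ {X : Set} (_≟ˣ_ : ∀ (a b : X) → Dec (a ≡ b)) where

  Enumerates : List X → Set
  Enumerates L = ∀ b → ∑ L (λ a → ind (a ≟ˣ b)) ≡ 1ℚ

  module _ (L : List X) (enum : Enumerates L) where

    enum-select : ∀ b (F : X → ℚ) → ∑ L (λ a → ind (a ≟ˣ b) * F a) ≡ F b
    enum-select b F = trans (cng (∑-linear L) pt) (trans (scaleʳ (∑-linear L) (F b) _)
      (trans (cong (_* F b) (enum b)) (ℚP.*-identityˡ (F b))))
      where
      pt : ∀ a → ind (a ≟ˣ b) * F a ≡ ind (a ≟ˣ b) * F b
      pt a with a ≟ˣ b
      ... | yes refl = refl
      ... | no _ = trans (ℚP.*-zeroˡ (F a)) (sym (ℚP.*-zeroˡ (F b)))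

    -- `F (π a)` is expanded into a sum of indicators over `b` and the sums are exchanged, so the
    -- list itself is never permuted.
    ∑-bijection : (π σ : X → X) → (∀ a → π (σ a) ≡ a) → (∀ a → σ (π a) ≡ a) → ∀ (F : X → ℚ) → ∑ L (F ∘ π) ≡ ∑ L F
    ∑-bijection π σ πσ σπ F = trans (cng (∑-linear L) λ a → sym (enum-select (π a) F))
      (trans (∑-comm L (∑-linear L) _) (cng (∑-linear L) λ b → trans (scaleʳ (∑-linear L) (F b) _)
        (trans (cong (_* F b) (trans (cng (∑-linear L) λ a → ind-⇔ (b ≟ˣ π a) (a ≟ˣ σ b)
          (λ e → trans (sym (σπ a)) (cong σ (sym e))) (λ e → trans (sym (πσ b)) (cong π (sym e)))) (enum (σ b))))
          (ℚP.*-identityˡ (F b)))))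

uniformOn : ∀ {X : Set} (L : List X) → L ≢ [] → Space X
uniformOn [] ne = contradiction refl ne
uniformOn (x ∷ L) _ = uniform x L

uniformOn-𝔼 : ∀ {X : Set} (L : List X) ne F → 𝔼 (uniformOn L ne) F ≡ inverse (length L) * ∑ L F
uniformOn-𝔼 [] ne F = contradiction refl ne
uniformOn-𝔼 (x ∷ L) _ F = refl

∑-uniformOn : ∀ {X : Set} (L : List X) ne F → ∑ L F ≡ nat (length L) * 𝔼 (uniformOn L ne) F
∑-uniformOn [] ne F = contradiction refl ne
∑-uniformOn (x ∷ L) _ F = sym (trans (re (nat n) (inverse n) (∑ (x ∷ L) F))
  (trans (cong (_* ∑ (x ∷ L) F) (inverse-* (length L))) (ℚP.*-identityˡ (∑ (x ∷ L) F))))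
  where
  n = suc (length L)
  re : ∀ a b c → a * (b * c) ≡ b * a * c
  re = solve-∀ ringℚ

fin-enum : ∀ {m} → Enumerates (Fin._≟_ {m}) (allFin m)
fin-enum {m} b = trans (cng (∑-linear (allFin m)) λ a → trans (ind-⇔ (a Fin.≟ b) (b Fin.≟ a) sym sym) (sym (ℚP.*-identityʳ _)))
  (∑-select b λ _ → 1ℚ)

allVecs-enum : ∀ {X : Set} (_≟ˣ_ : ∀ (a b : X) → Dec (a ≡ b)) (L : List X) → Enumerates _≟ˣ_ L →
  ∀ n → Enumerates (VecP.≡-dec _≟ˣ_) (allVecs L n)
allVecs-enum _≟ˣ_ L enum zero [] = refl
allVecs-enum _≟ˣ_ L enum (suc n) (b ∷ w) = trans (∑-concatMap _ L _)
  (trans (cng (∑-linear L) λ a → trans (∑-map (a ∷_) (allVecs L n) _)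
      (trans (cng (∑-linear (allVecs L n)) λ v → split a v) (trans (scale (∑-linear (allVecs L n)) (ind (a ≟ˣ b)) _)
        (trans (cong (ind (a ≟ˣ b) *_) (allVecs-enum _≟ˣ_ L enum n w)) (ℚP.*-identityʳ (ind (a ≟ˣ b)))))))
    (enum b))
  where
  split : ∀ a v → ind (VecP.≡-dec _≟ˣ_ (a ∷ v) (b ∷ w)) ≡ ind (a ≟ˣ b) * ind (VecP.≡-dec _≟ˣ_ v w)
  split a v with a ≟ˣ b | VecP.≡-dec _≟ˣ_ v w
  ... | yes _ | yes _ = refl
  ... | yes _ | no _ = refl
  ... | no _ | yes _ = refl
  ... | no _ | no _ = refl

module _ {m : ℕ} where

  perm-test⁻ : ∀ (v : Vec (Fin m) m) → T (isPermB v) → ∀ j → ∃ λ r → lookup v r ≡ j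
  perm-test⁻ v t j with AnyP.tabulate⁻ (AnyP.any⁻ (λ r → ⌊ lookup v r Fin.≟ j ⌋) (allFin m)
    (AllP.tabulate⁻ (AllP.all⁺ _ (allFin m) t) j))
  ... | r , h = r , toWitness h

  perm-test⁺ : ∀ (v : Vec (Fin m) m) → (∀ j → ∃ λ r → lookup v r ≡ j) → T (isPermB v)
  perm-test⁺ v h = AllP.all⁻ _ (AllP.tabulate⁺ λ j →
    AnyP.any⁺ _ (AnyP.tabulate⁺ (proj₁ (h j)) (fromWitness {a? = lookup v (proj₁ (h j)) Fin.≟ j} (proj₂ (h j)))))

  perm-ext : ∀ {x y : Perm m} → (∀ r → app x r ≡ app y r) → x ≡ y
  perm-ext {v , s} {w , t} h with trans (sym (VecP.tabulate∘lookup v)) (trans (VecP.tabulate-cong h) (VecP.tabulate∘lookup w))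
  ... | refl = cong (v ,_) (BoolP.T-irrelevant s t)

  abstract
    rank : Perm m → Fin m → Fin m
    rank x j = proj₁ (perm-test⁻ (proj₁ x) (proj₂ x) j)

    app-rank : ∀ x j → app x (rank x j) ≡ j
    app-rank x j = proj₂ (perm-test⁻ (proj₁ x) (proj₂ x) j)

  private
    injective⇒hit : ∀ {k} (f : Fin k → Fin k) → (∀ {a b} → f a ≡ f b → a ≡ b) → ∀ b → ∃ λ a → f a ≡ b
    injective⇒hit {suc k} f inj b with FinP.any? (λ a → f a Fin.≟ b)
    ... | yes h = h
    ... | no ¬h = contradiction (FinP.injective⇒≤ {f = λ a → Fin.punchOut (λ e → ¬h (a , sym e))}
      λ {a} {a′} e → inj (FinP.punchOut-injective (λ e → ¬h (a , sym e)) (λ e → ¬h (a′ , sym e)) e)) (ℕP.<⇒≱ (ℕP.n<1+n k))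

  -- `app-rank` is only a one-sided inverse law, but it makes `rank x` injective on a finite set,
  -- hence surjective.
  rank-app : ∀ x r → rank x (app x r) ≡ r
  rank-app x r with injective⇒hit (rank x) (λ {a} {b} e → trans (sym (app-rank x a)) (trans (cong (app x) e) (app-rank x b))) r
  ... | j , refl = cong (rank x) (app-rank x j)

  rank-injective : ∀ x {j k} → rank x j ≡ rank x k → j ≡ k
  rank-injective x {j} {k} e = trans (sym (app-rank x j)) (trans (cong (app x) e) (app-rank x k))

  rank-unique : ∀ x {r j} → app x r ≡ j → rank x j ≡ r
  rank-unique x {r} refl = rank-app x r

  perm-ext-rank : ∀ {x y : Perm m} → (∀ j → rank x j ≡ rank y j) → x ≡ y
  perm-ext-rank {x} {y} h = perm-ext λ r → trans (sym (app-rank y (app x r)))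
    (cong (app y) (trans (sym (h (app x r))) (rank-app x r)))

  abstract
    mkPerm : (φ ψ : Fin m → Fin m) → (∀ j → φ (ψ j) ≡ j) → Perm m
    mkPerm φ ψ h = tabulate φ , perm-test⁺ (tabulate φ) λ j → ψ j , trans (VecP.lookup∘tabulate φ (ψ j)) (h j)

    app-mkPerm : ∀ φ ψ h r → app (mkPerm φ ψ h) r ≡ φ r
    app-mkPerm φ ψ h r = VecP.lookup∘tabulate φ r

  rank-mkPerm : ∀ φ ψ h j → rank (mkPerm φ ψ h) j ≡ ψ j
  rank-mkPerm φ ψ h j = rank-unique (mkPerm φ ψ h) (trans (app-mkPerm φ ψ h (ψ j)) (h j))

  identity : Perm m
  identity = mkPerm id id λ _ → refl

rankV-first : ∀ {m k} (v : Vec (Fin m) k) j r → lookup v r ≡ j → (∀ s → lookup v s ≡ j → s ≡ r) → rankV v j ≡ just r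
rankV-first (a ∷ v) j r e u with a Fin.≟ j
... | yes p = cong just (u zero p)
rankV-first (a ∷ v) j zero e u | no ¬p = contradiction e ¬p
rankV-first (a ∷ v) j (suc r) e u | no ¬p rewrite rankV-first v j r e (λ s h → FinP.suc-injective (u (suc s) h)) = refl

inv-rank : ∀ {m} (x : Perm m) j → inv x j ≡ just (rank x j)
inv-rank x j = rankV-first (proj₁ x) j (rank x j) (app-rank x j) λ s h → sym (rank-unique x h)

_≟ᵖ_ : ∀ {m} (x y : Perm m) → Dec (x ≡ y)
x ≟ᵖ y with VecP.≡-dec Fin._≟_ (proj₁ x) (proj₁ y)
... | yes e = yes (perm-ext λ r → cong (λ v → lookup v r) e)
... | no ¬e = no (¬e ∘ cong proj₁)

-- Abstracting isPermB v in toPerm v must replace only one side of the recorded equation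
-- isPermB v ≡ isPermB v. The variable u, equal to tt by η but not syntactically, protects the other side.
toPerm-spec′ : ∀ {m} (g : ⊤ → Vec (Fin m) m) (u : ⊤) →
  (∃ λ x → toPerm (g tt) ≡ just x × proj₁ x ≡ g tt) ⊎ (toPerm (g tt) ≡ nothing × isPermB (g tt) ≡ false)
toPerm-spec′ g u with isPermB (g tt) | η u
  where
  η : ∀ u → isPermB (g u) ≡ isPermB (g tt)
  η u = refl
... | true | e = inj₁ (_ , refl , refl)
... | false | e = inj₂ (refl , refl)

toPerm-spec : ∀ {m} (v : Vec (Fin m) m) →
  (∃ λ x → toPerm v ≡ just x × proj₁ x ≡ v) ⊎ (toPerm v ≡ nothing × isPermB v ≡ false)
toPerm-spec v = toPerm-spec′ (λ _ → v) tt

∑-mapMaybe : ∀ {X Y : Set} (φ : X → Maybe Y) L F → ∑ (mapMaybe φ L) F ≡ ∑ L λ x → maybe F 0ℚ (φ x)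
∑-mapMaybe φ [] F = refl
∑-mapMaybe φ (x ∷ L) F with φ x
... | just y = +-congˡ (F y) (∑-mapMaybe φ L F)
... | nothing = trans (∑-mapMaybe φ L F) (sym (ℚP.+-identityˡ _))

allPerms-enum : ∀ m → Enumerates _≟ᵖ_ (allPerms m)
allPerms-enum m x = trans (∑-mapMaybe toPerm (allVecs (allFin m) m) _)
  (trans (cng (∑-linear (allVecs (allFin m) m)) pt) (allVecs-enum Fin._≟_ (allFin m) fin-enum m (proj₁ x)))
  where
  pt : ∀ v → maybe (λ a → ind (a ≟ᵖ x)) 0ℚ (toPerm v) ≡ ind (VecP.≡-dec Fin._≟_ v (proj₁ x))
  pt v with toPerm-spec v
  ... | inj₁ (y , e , refl) rewrite e = ind-⇔ (y ≟ᵖ x) (VecP.≡-dec Fin._≟_ (proj₁ y) (proj₁ x)) (cong proj₁) λ h → perm-ext λ r → cong (λ w → lookup w r) h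
  ... | inj₂ (e , f) rewrite e = sym (ind-no (VecP.≡-dec Fin._≟_ v (proj₁ x)) λ h →
    subst T (trans (cong isPermB (sym h)) f) (proj₂ x))

abstract
  -- nat, but not computing on constructor-headed arguments
  dim : ℕ → ℚ
  dim = nat

  dim≡nat : ∀ n → dim n ≡ nat n
  dim≡nat n = refl

  0≤dim : ∀ n → 0ℚ ℚ.≤ dim n
  0≤dim = 0≤nat

  1≤dim : ∀ n → 1ℚ ℚ.≤ dim (suc n)
  1≤dim n = nat-mono {1} {suc n} (s≤s z≤n)

  ∑-fin-const : ∀ m c → ∑ (allFin m) (λ _ → c) ≡ dim m * c
  ∑-fin-const m c = trans (∑-const (allFin m) c) (cong (λ n → nat n * c) (ListP.length-tabulate {n = m} id))

allPerms-nonempty : ∀ m → allPerms m ≢ []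
allPerms-nonempty m e = ℚP.1≢0 (sym (trans (cong (λ L → ∑ L λ x → ind (x ≟ᵖ identity)) (sym e)) (allPerms-enum m identity)))

abstract
  perms : ∀ m → Space (Perm m)
  perms m = uniformOn (allPerms m) (allPerms-nonempty m)

  names : ∀ m → Space (Fin (suc m))
  names m = uniform zero (List.tabulate suc)

  names-𝔼 : ∀ m F → 𝔼 (names m) F ≡ inverse (suc m) * ∑ (allFin (suc m)) F
  names-𝔼 m F = cong (λ n → inverse (suc n) * ∑ (allFin (suc m)) F) (ListP.length-tabulate {n = m} suc)

  ∑-names : ∀ m F → ∑ (allFin (suc m)) F ≡ dim (suc m) * 𝔼 (names m) F
  ∑-names m F = trans (∑-uniformOn (allFin (suc m)) (λ ()) F)
    (cong (λ n → nat n * 𝔼 (names m) F) (ListP.length-tabulate {n = suc m} id))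

  ∑-perms : ∀ m F → ∑ (allPerms m) F ≡ nat (length (allPerms m)) * 𝔼 (perms m) F
  ∑-perms m F = ∑-uniformOn (allPerms m) (allPerms-nonempty m) F

  names-bijection : ∀ {m} (π σ : Fin (suc m) → Fin (suc m)) → (∀ a → π (σ a) ≡ a) → (∀ a → σ (π a) ≡ a) →
    ∀ F → 𝔼 (names m) (F ∘ π) ≡ 𝔼 (names m) F
  names-bijection {m} π σ πσ σπ F = trans (names-𝔼 m (F ∘ π)) (trans (cong (inverse (suc m) *_)
    (∑-bijection Fin._≟_ (allFin (suc m)) fin-enum π σ πσ σπ F)) (sym (names-𝔼 m F)))

  perms-bijection : ∀ {m} (π σ : Perm m → Perm m) → (∀ a → π (σ a) ≡ a) → (∀ a → σ (π a) ≡ a) →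
    ∀ F → 𝔼 (perms m) (F ∘ π) ≡ 𝔼 (perms m) F
  perms-bijection {m} π σ πσ σπ F = trans (uniformOn-𝔼 (allPerms m) (allPerms-nonempty m) (F ∘ π))
    (trans (cong (inverse (length (allPerms m)) *_) (∑-bijection _≟ᵖ_ (allPerms m) (allPerms-enum m) π σ πσ σπ F))
      (sym (uniformOn-𝔼 (allPerms m) (allPerms-nonempty m) F)))

names-atomic : ∀ m → Atomic (names m) (dim (suc m))
names-atomic m φ h r = ≤-trans (term≤total φ h r) (≤-reflexive (∑-names m φ))

-- Exchanges that preserve the uniform measure on rankings

module _ {n : ℕ} where

  transpose-left : ∀ (i j : Fin n) → transpose i j i ≡ j
  transpose-left i j with i Fin.≟ i
  ... | yes _ = refl
  ... | no ¬e = contradiction refl ¬e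

  transpose-right : ∀ (i j : Fin n) → transpose i j j ≡ i
  transpose-right i j with j Fin.≟ i
  ... | yes e = e
  ... | no _ with j Fin.≟ j
  ...   | yes _ = refl
  ...   | no ¬e = contradiction refl ¬e

  transpose-other : ∀ {i j k : Fin n} → k ≢ i → k ≢ j → transpose i j k ≡ k
  transpose-other {i} {j} {k} k≢i k≢j with k Fin.≟ i
  ... | yes e = contradiction e k≢i
  ... | no _ with k Fin.≟ j
  ...   | yes e = contradiction e k≢j
  ...   | no _ = refl

  swapNames : Fin n → Fin n → Perm n → Perm n
  swapNames j k x = mkPerm (transpose j k ∘ app x) (rank x ∘ transpose k j)
    λ i → trans (cong (transpose j k) (app-rank x _)) (transpose-inverse j k)

  rank-swapNames : ∀ j k x i → rank (swapNames j k x) i ≡ rank x (transpose k j i)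
  rank-swapNames j k x = rank-mkPerm _ _ _

  rank-swapNames-left : ∀ j k x → rank (swapNames j k x) j ≡ rank x k
  rank-swapNames-left j k x = trans (rank-swapNames j k x j) (cong (rank x) (transpose-right k j))

  rank-swapNames-right : ∀ j k x → rank (swapNames j k x) k ≡ rank x j
  rank-swapNames-right j k x = trans (rank-swapNames j k x k) (cong (rank x) (transpose-left k j))

  rank-swapNames-other : ∀ {j k i} x → i ≢ j → i ≢ k → rank (swapNames j k x) i ≡ rank x i
  rank-swapNames-other {j} {k} {i} x i≢j i≢k = trans (rank-swapNames j k x i) (cong (rank x) (transpose-other i≢k i≢j))

  swapRanks : Fin n → Fin n → Perm n → Perm n
  swapRanks r s x = mkPerm (app x ∘ transpose r s) (transpose s r ∘ rank x)
    λ i → trans (cong (app x) (transpose-inverse r s)) (app-rank x i)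

  rank-swapRanks : ∀ r s x i → rank (swapRanks r s x) i ≡ transpose s r (rank x i)
  rank-swapRanks r s x = rank-mkPerm _ _ _

  𝔼-swapNames : ∀ j k F → 𝔼 (perms n) (F ∘ swapNames j k) ≡ 𝔼 (perms n) F
  𝔼-swapNames j k = perms-bijection (swapNames j k) (swapNames k j) (inverses j k) (inverses k j)
    where
    inverses : ∀ j k x → swapNames j k (swapNames k j x) ≡ x
    inverses j k x = perm-ext-rank λ i → trans (rank-swapNames j k (swapNames k j x) i)
      (trans (rank-swapNames k j x (transpose k j i)) (cong (rank x) (transpose-inverse j k)))

  𝔼-swapRanks : ∀ r s F → 𝔼 (perms n) (F ∘ swapRanks r s) ≡ 𝔼 (perms n) F
  𝔼-swapRanks r s = perms-bijection (swapRanks r s) (swapRanks s r) (inverses r s) (inverses s r)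
    where
    inverses : ∀ r s x → swapRanks r s (swapRanks s r x) ≡ x
    inverses r s x = perm-ext-rank λ i → trans (rank-swapRanks r s (swapRanks s r x) i)
      (trans (cong (transpose s r) (rank-swapRanks s r x i)) (transpose-inverse s r))

  -- The alternative s is a source of randomness: swapping j with k unless s = j
  -- makes the new rank of j uniform and independent of the old one.
  disturb : Fin n → Fin n → Perm n → Fin n → Perm n
  disturb j k x s with s Fin.≟ j
  ... | yes _ = x
  ... | no _ = swapNames j k x

  rank-disturb-other : ∀ {j k i} x s → i ≢ j → i ≢ k → rank (disturb j k x s) i ≡ rank x i
  rank-disturb-other {j} x s i≢j i≢k with s Fin.≟ j
  ... | yes _ = refl
  ... | no _ = rank-swapNames-other x i≢j i≢k

  𝔼-disturb : ∀ j k s F → 𝔼 (perms n) (λ x → F (disturb j k x s)) ≡ 𝔼 (perms n) F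
  𝔼-disturb j k s F with s Fin.≟ j
  ... | yes _ = refl
  ... | no _ = 𝔼-swapNames j k F

  -- Puts `l` at rank `r` by swapping two ranks of `t`. For uniform `t` the result is uniform among
  -- the rankings with `l` at rank `r`.
  moveTo : Fin n → Fin n → Perm n → Perm n
  moveTo l r t = swapRanks (rank t l) r t

module _ {m : ℕ} where

  private
    P = perms (suc m)
    N = names m

  𝔼-rank-names : ∀ (x : Perm (suc m)) ψ → 𝔼 N (λ k → ψ (rank x k)) ≡ 𝔼 N ψ
  𝔼-rank-names x = names-bijection (rank x) (app x) (rank-app x) (app-rank x)

  𝔼-rank : ∀ j ψ → 𝔼 P (λ x → ψ (rank x j)) ≡ 𝔼 N ψ
  𝔼-rank j ψ = trans (sym (const N (𝔼 P λ x → ψ (rank x j))))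
    (trans (cng (linear N) λ k → trans (cng (linear P) λ x → cong ψ (sym (rank-swapNames-right j k x)))
      (𝔼-swapNames j k λ x → ψ (rank x k)))
    (trans (comm N (linear P) _) (trans (cng (linear P) λ x → 𝔼-rank-names x ψ) (const P (𝔼 N ψ)))))

  -- For s ≠ j the new rank of `j` is the old rank of `k`, which exchanging the names `k` and `s`
  -- turns into the rank of `s`; for s = j it is that rank already. A uniform `s` has a uniform
  -- rank, whatever the rank of `j`.
  𝔼-rank-disturb : ∀ {j k} → j ≢ k → ∀ (ψ : Fin (suc m) → Fin (suc m) → ℚ) →
    𝔼 P (λ x → 𝔼 N λ s → ψ (rank x j) (rank (disturb j k x s) j)) ≡ 𝔼 N λ a → 𝔼 N (ψ a)
  𝔼-rank-disturb {j} {k} j≢k ψ = trans (comm P (linear N) _) (trans (cng (linear N) pt)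
    (trans (comm N (linear P) _) (trans (cng (linear P) λ x → 𝔼-rank-names x (ψ (rank x j)))
      (𝔼-rank j λ a → 𝔼 N (ψ a)))))
    where
    pt : ∀ s → 𝔼 P (λ x → ψ (rank x j) (rank (disturb j k x s) j)) ≡ 𝔼 P λ x → ψ (rank x j) (rank x s)
    pt s with s Fin.≟ j
    ... | yes refl = refl
    ... | no s≢j = trans (cng (linear P) λ x → cong₂ ψ
        (sym (rank-swapNames-other x j≢k (s≢j ∘ sym)))
        (trans (rank-swapNames-left j k x) (sym (rank-swapNames-right k s x))))
      (𝔼-swapNames k s λ x → ψ (rank x j) (rank x s))

  -- Split by the old rank `s` of `l`: swapping the ranks `s` and `r` maps each case onto the event
  -- that `l` has rank `r`, so all cases contribute equally. This passage from conditional to joint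
  -- probability costs one factor m.
  𝔼-moveTo : ∀ l r (ψ : Perm (suc m) → ℚ) → 𝔼 P (λ t → ψ (moveTo l r t)) ≡ dim (suc m) * 𝔼 P λ y → ind (rank y l Fin.≟ r) * ψ y
  𝔼-moveTo l r ψ = trans (cng (linear P) λ t → sym (∑-select (rank t l) λ s → ψ (swapRanks s r t)))
    (trans (comm P (∑-linear (allFin (suc m))) _) (trans (cng (∑-linear (allFin (suc m))) λ s →
        trans (cng (linear P) λ t → cong (_* ψ (swapRanks s r t)) (ind-⇔ (rank t l Fin.≟ s) (rank (swapRanks s r t) l Fin.≟ r)
          (λ { refl → trans (rank-swapRanks s r t l) (transpose-right r s) })
          (λ e → trans (sym (transpose-inverse s r)) (trans (cong (transpose s r) (trans (sym (rank-swapRanks s r t l)) e)) (transpose-right s r)))))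
        (𝔼-swapRanks s r λ y → ind (rank y l Fin.≟ r) * ψ y))
      (∑-fin-const (suc m) q)))
    where
    q = 𝔼 P λ y → ind (rank y l Fin.≟ r) * ψ y

  𝔼-moveTo-rank : ∀ l (ψ : Perm (suc m) → ℚ) → 𝔼 P (λ x → 𝔼 P λ t → ψ (moveTo l (rank x l) t)) ≡ 𝔼 P ψ
  𝔼-moveTo-rank l ψ = trans (cng (linear P) λ x → 𝔼-moveTo l (rank x l) ψ) (trans (scale (linear P) (dim (suc m)) _)
    (trans (cong (dim (suc m) *_) (comm P (linear P) _)) (trans (sym (scale (linear P) (dim (suc m)) _)) (cng (linear P) pt))))
    where
    re : ∀ a p → a * p ≡ p * a
    re = solve-∀ ringℚ
    pt : ∀ y → dim (suc m) * 𝔼 P (λ x → ind (rank y l Fin.≟ rank x l) * ψ y) ≡ ψ y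
    pt y = trans (cong (dim (suc m) *_) (scaleʳ (linear P) (ψ y) _)) (trans (sym (ℚP.*-assoc (dim (suc m)) _ (ψ y)))
      (trans (cong (_* ψ y) (trans (cong (dim (suc m) *_) (𝔼-rank l λ a → ind (rank y l Fin.≟ a)))
        (trans (sym (∑-names m λ a → ind (rank y l Fin.≟ a))) (trans (cng (∑-linear (allFin (suc m))) λ a → sym (ℚP.*-identityʳ (ind (rank y l Fin.≟ a))))
          (∑-select (rank y l) λ _ → 1ℚ))))) (ℚP.*-identityˡ (ψ y))))

-- From an almost IR function to functions with few broken squares

module _ {X Z : Set} (A : Space X) (D : Space Z) (p₁ p₂ p₃ p₄ : Bool → Z → X)
  (inside : ∀ (ψ : X → X → X → X → ℚ) →
    𝔼 D (λ z → ψ (p₁ true z) (p₂ true z) (p₃ true z) (p₄ true z)) ≡ 𝔼 A λ a → 𝔼 A λ b → ψ a b a b)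
  (outside : ∀ (ψ : X → X → X → X → ℚ) →
    𝔼 D (λ z → ψ (p₁ false z) (p₂ false z) (p₃ false z) (p₄ false z)) ≡ 𝔼 A λ a → 𝔼 A λ b → ψ a a b b) where

  -- A coupling made coordinate by coordinate: the pattern a b a b in `T` and a a b b outside is
  -- that of the corners uv, u′v, uv′, u′v′ of a rectangle.
  quad-transport : ∀ {n} (T : Vec Bool n) (Φ : Vec X n → Vec X n → Vec X n → Vec X n → ℚ) →
    𝔼 (D ^^ n) (λ z → Φ (zipWith p₁ T z) (zipWith p₂ T z) (zipWith p₃ T z) (zipWith p₄ T z)) ≡ quad A T Φ
  quad-transport [] Φ = refl
  quad-transport (true ∷ T) Φ = trans (cng (linear D) λ z → quad-transport T λ a b c d →
      Φ (p₁ true z ∷ a) (p₂ true z ∷ b) (p₃ true z ∷ c) (p₄ true z ∷ d))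
    (trans (inside λ x y z w → quad A T λ a b c d → Φ (x ∷ a) (y ∷ b) (z ∷ c) (w ∷ d))
      (cng (linear A) λ x → sym (comm (selected A T) (linear A) _)))
  quad-transport (false ∷ T) Φ = trans (cng (linear D) λ z → quad-transport T λ a b c d →
      Φ (p₁ false z ∷ a) (p₂ false z ∷ b) (p₃ false z ∷ c) (p₄ false z ∷ d))
    (trans (outside λ x y z w → quad A T λ a b c d → Φ (x ∷ a) (y ∷ b) (z ∷ c) (w ∷ d))
      (sym (trans (cng (linear B) λ u → trans (cng (linear B) λ u′ → cng (linear A) λ x → comm C (linear A) _)
          (comm B (linear (A ⊗ A)) _))
        (comm B (linear (A ⊗ A)) _))))
    where
    B = selected A T
    C = selected A (Vec.map not T)

module _ {Z X : Set} (D : Space Z) (A : Space X) where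

  𝔼-zipWith : ∀ (q : Bool → Z → X) → (∀ t ψ → 𝔼 D (ψ ∘ q t) ≡ 𝔼 A ψ) →
    ∀ {n} (T : Vec Bool n) Ψ → 𝔼 (D ^^ n) (λ z → Ψ (zipWith q T z)) ≡ 𝔼 (A ^^ n) Ψ
  𝔼-zipWith q h [] Ψ = refl
  𝔼-zipWith q h (t ∷ T) Ψ = trans (cng (linear D) λ z → 𝔼-zipWith q h T λ v → Ψ (q t z ∷ v))
    (h t λ x → 𝔼 (A ^^ _) λ v → Ψ (x ∷ v))

  𝔼-map : ∀ (q : Z → X) → (∀ ψ → 𝔼 D (ψ ∘ q) ≡ 𝔼 A ψ) → ∀ n Ψ → 𝔼 (D ^^ n) (Ψ ∘ Vec.map q) ≡ 𝔼 (A ^^ n) Ψ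
  𝔼-map q h zero Ψ = refl
  𝔼-map q h (suc n) Ψ = trans (cng (linear D) λ z → 𝔼-map q h n λ v → Ψ (q z ∷ v)) (h _)

module _ {X : Set} (A : Space X) where

  𝔼-lookup : ∀ {n} (i : Fin n) ψ → 𝔼 (A ^^ n) (λ v → ψ (lookup v i)) ≡ 𝔼 A ψ
  𝔼-lookup {suc n} zero ψ = cng (linear A) λ x → const (A ^^ n) (ψ x)
  𝔼-lookup (suc i) ψ = trans (cng (linear A) λ x → 𝔼-lookup i ψ) (const A (𝔼 A ψ))

  𝔼-update : ∀ (π : X → X) → (∀ ψ → 𝔼 A (ψ ∘ π) ≡ 𝔼 A ψ) → ∀ {n} (i : Fin n) Ψ →
    𝔼 (A ^^ n) (λ v → Ψ (v [ i ]≔ π (lookup v i))) ≡ 𝔼 (A ^^ n) Ψ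
  𝔼-update π h zero Ψ = h _
  𝔼-update π h (suc i) Ψ = cng (linear A) λ x → 𝔼-update π h i λ v → Ψ (x ∷ v)

ind-split : ∀ {m} (a b c : Fin m) → ind (¬? (a Fin.≟ c)) ℚ.≤ ind (¬? (a Fin.≟ b)) + ind (¬? (b Fin.≟ c))
ind-split a b c with a Fin.≟ b
... | yes refl = ≤-reflexive (sym (ℚP.+-identityˡ _))
... | no _ = ≤-trans (ind≤1 (¬? (a Fin.≟ c))) (≤-trans (≤-reflexive (sym (ℚP.+-identityʳ 1ℚ)))
  (ℚP.+-monoʳ-≤ 1ℚ (0≤ind (¬? (b Fin.≟ c)))))

ind-¬∀ : ∀ {m} {P : Fin m → Set} (P? : ∀ j → Dec (P j)) → ind (¬? (FinP.all? P?)) ℚ.≤ ∑ (allFin m) λ j → ind (¬? (P? j))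
ind-¬∀ {m} P? with FinP.all? P?
... | yes _ = ∑-nonneg (allFin m) λ j → 0≤ind (¬? (P? j))
... | no ¬p with FinP.¬∀⟶∃¬ m _ P? ¬p
...   | j , ¬pj = ≤-trans (≤-reflexive (sym (ind-yes (¬? (P? j)) ¬pj)))
  (term≤total (λ j → ind (¬? (P? j))) (λ j → 0≤ind (¬? (P? j))) j)

-- Resample the coordinates one at a time.
hybrid : ∀ {X : Set} (A : Space X) (mv : X → X → X) →
  (∀ ψ → 𝔼 A (λ x → 𝔼 A λ t → ψ (mv x t)) ≡ 𝔼 A ψ) → ∀ {m n} (Φ : Vec X n → Fin m) →
  𝔼 (A ^^ n) (λ x → 𝔼 (A ^^ n) λ t → ind (¬? (Φ x Fin.≟ Φ (zipWith mv x t)))) ℚ.≤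
  ∑ (allFin n) λ i → 𝔼 (A ^^ n) λ x → 𝔼 A λ t → ind (¬? (Φ x Fin.≟ Φ (x [ i ]≔ mv (lookup x i) t)))
hybrid A mv h {n = zero} Φ = ≤-reflexive (ind-no (¬? (Φ [] Fin.≟ Φ [])) λ ne → ne refl)
hybrid {X} A mv h {n = suc n} Φ = ≤-trans
  (mono A λ x → mono B λ v → mono A λ t → mono B λ w → ind-split (Φ (x ∷ v)) (Φ (mv x t ∷ v)) (Φ (mv x t ∷ zipWith mv v w)))
  (≤-trans (≤-reflexive separate) (≤-trans (ℚP.+-monoʳ-≤ first (mono A λ y → hybrid A mv h λ v → Φ (y ∷ v)))
    (≤-reflexive (trans (+-congˡ first (sym (∑-comm (allFin n) (linear A) _))) (sym (∑-allFin-suc influence))))))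
  where
  B = A ^^ n
  influence : Fin (suc n) → ℚ
  influence i = 𝔼 (A ^^ suc n) λ x → 𝔼 A λ t → ind (¬? (Φ x Fin.≟ Φ (x [ i ]≔ mv (lookup x i) t)))
  first = influence zero
  resampled : X → ℚ
  resampled y = 𝔼 B λ v → 𝔼 B λ w → ind (¬? (Φ (y ∷ v) Fin.≟ Φ (y ∷ zipWith mv v w)))
  rest : X → Vec X n → X → ℚ
  rest x v t = 𝔼 B λ w → ind (¬? (Φ (mv x t ∷ v) Fin.≟ Φ (mv x t ∷ zipWith mv v w)))
  separate : 𝔼 A (λ x → 𝔼 B λ v → 𝔼 A λ t → 𝔼 B λ w →
      ind (¬? (Φ (x ∷ v) Fin.≟ Φ (mv x t ∷ v))) + ind (¬? (Φ (mv x t ∷ v) Fin.≟ Φ (mv x t ∷ zipWith mv v w)))) ≡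
    first + 𝔼 A resampled
  separate = trans (cng (linear A) λ x → cng (linear B) λ v → cng (linear A) λ t →
      trans (add (linear B) (λ w → ind (¬? (Φ (x ∷ v) Fin.≟ Φ (mv x t ∷ v)))) _) (cong (λ z → z + rest x v t) (const B (ind (¬? (Φ (x ∷ v) Fin.≟ Φ (mv x t ∷ v)))))))
    (trans (cng (linear A) λ x → trans (cng (linear B) λ v → add (linear A) (λ t → ind (¬? (Φ (x ∷ v) Fin.≟ Φ (mv x t ∷ v)))) _)
      (add (linear B) (λ v → 𝔼 A λ t → ind (¬? (Φ (x ∷ v) Fin.≟ Φ (mv x t ∷ v)))) _))
    (trans (add (linear A) (λ x → 𝔼 B λ v → 𝔼 A λ t → ind (¬? (Φ (x ∷ v) Fin.≟ Φ (mv x t ∷ v)))) _)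
      -- By the invariance `h` the moved head `mv x t` is again uniform, so the induction hypothesis
      -- applies to the remaining coordinates.
      (+-congˡ first (trans (cng (linear A) λ x → comm B (linear A) _) (h resampled)))))

-- In `w`, the rank that `z` gives to `j` belongs to some alternative. Were it neither `j` nor `k`,
-- it would have the same rank in `z` and so be `j` itself.
two-ranks : ∀ {m} (z w : Perm m) {j k} → j ≢ k → (∀ i → i ≢ j → i ≢ k → rank z i ≡ rank w i) →
  (rank z j ≡ rank w j × rank z k ≡ rank w k) ⊎ (rank z j ≡ rank w k × rank z k ≡ rank w j)
two-ranks z w {j} {k} j≢k h with locate j | locate k
  where
  locate : ∀ i → rank z i ≡ rank w j ⊎ rank z i ≡ rank w k ⊎ (i ≢ j × i ≢ k)
  locate i with app w (rank z i) Fin.≟ j | app w (rank z i) Fin.≟ k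
  ... | yes e | _ = inj₁ (sym (rank-unique w e))
  ... | no _ | yes e = inj₂ (inj₁ (sym (rank-unique w e)))
  ... | no ≢j | no ≢k = inj₂ (inj₂ ((λ { refl → ≢j e }) , λ { refl → ≢k e }))
    where
    e : app w (rank z i) ≡ i
    e = rank-injective z (trans (h (app w (rank z i)) ≢j ≢k) (rank-app w (rank z i)))
... | inj₁ a | inj₁ b = contradiction (rank-injective z (trans a (sym b))) j≢k
... | inj₁ a | inj₂ (inj₁ b) = inj₁ (a , b)
... | inj₁ a | inj₂ (inj₂ (_ , ne)) = contradiction refl ne
... | inj₂ (inj₁ a) | inj₁ b = inj₂ (a , b)
... | inj₂ (inj₁ a) | inj₂ (inj₁ b) = contradiction (rank-injective z (trans a (sym b))) j≢k
... | inj₂ (inj₁ a) | inj₂ (inj₂ (_ , ne)) = contradiction refl ne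
... | inj₂ (inj₂ (ne , _)) | _ = contradiction refl ne

column : ∀ {m n} → Fin m → Profile m n → Vec (Fin m) n
column j = Vec.map λ x → rank x j

module _ {m n : ℕ} (f : Profile (suc m) n → Perm (suc m)) (g : Fin (suc m) → Vec (Fin (suc m)) n → Fin (suc m)) where

  private
    P = perms (suc m)
    N = names m
    D = P ⊗ N

  Good : Profile (suc m) n → Set
  Good x = ∀ j → rank (f x) j ≡ g j (column j x)

  good? : ∀ x → Dec (Good x)
  good? x = FinP.all? λ j → rank (f x) j Fin.≟ g j (column j x)

  bad : Profile (suc m) n → ℚ
  bad x = ind (¬? (good? x))

  -- Along x, x′ and along y, y′ only `j` and `k` can trade ranks in the outcome, while x, y and
  -- also x′, y′ share the outcome rank of `k`. No trade gives the first alternative of `Square`,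
  -- two trades the second; in the mixed cases the chain through the shared ranks of `k` gives the
  -- first again.
  good-square : ∀ {j k} → j ≢ k → ∀ {x x′ y y′} →
    (∀ i → i ≢ j → i ≢ k → column i x ≡ column i x′) → (∀ i → i ≢ j → i ≢ k → column i y ≡ column i y′) →
    column k x ≡ column k y → column k x′ ≡ column k y′ → Good x → Good x′ → Good y → Good y′ →
    Square (g j (column j x)) (g j (column j x′)) (g j (column j y)) (g j (column j y′))
  good-square {j} {k} j≢k {x} {x′} {y} {y′} hx hy kx kx′ Gx Gx′ Gy Gy′ =
    subst₂ (λ a b → Square a b _ _) (Gx j) (Gx′ j) (subst₂ (λ a b → Square _ _ a b) (Gy j) (Gy′ j)
      (combine (two-ranks (f x) (f x′) j≢k (transfer Gx Gx′ hx)) (two-ranks (f y) (f y′) j≢k (transfer Gy Gy′ hy))))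
    where
    transfer : ∀ {a b} → Good a → Good b → (∀ i → i ≢ j → i ≢ k → column i a ≡ column i b) →
      ∀ i → i ≢ j → i ≢ k → rank (f a) i ≡ rank (f b) i
    transfer Ga Gb h i i≢j i≢k = trans (Ga i) (trans (cong (g i) (h i i≢j i≢k)) (sym (Gb i)))
    same : ∀ {a b} → Good a → Good b → column k a ≡ column k b → rank (f a) k ≡ rank (f b) k
    same Ga Gb e = trans (Ga k) (trans (cong (g k) e) (sym (Gb k)))
    combine : _ ⊎ _ → _ ⊎ _ → Square (rank (f x) j) (rank (f x′) j) (rank (f y) j) (rank (f y′) j)
    combine (inj₁ (a , _)) (inj₁ (c , _)) = inj₁ (a , c)
    combine (inj₁ (a , b)) (inj₂ (c , d)) = inj₁ (a , trans c (trans (sym (same Gx′ Gy′ kx′)) (trans (sym b) (trans (same Gx Gy kx) d))))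
    combine (inj₂ (a , b)) (inj₁ (c , d)) = inj₁ (trans a (trans (same Gx′ Gy′ kx′) (trans (sym d) (trans (sym (same Gx Gy kx)) b))) , c)
    combine (inj₂ (a , b)) (inj₂ (c , d)) = inj₂ (trans a (trans (same Gx′ Gy′ kx′) (sym c)) , trans (sym b) (trans (same Gx Gy kx) d))

  module _ {j k l : Fin (suc m)} (j≢k : j ≢ k) (j≢l : j ≢ l) (k≢l : k ≢ l) where

    private
      -- The four corners from one seed: voters in `T` exchange `j` with `k`, the others `j` with
      -- `l`. `q₂` makes the first move, `q₃` the second, `q₄` both.
      q₁ q₂ q₃ q₄ : Bool → Perm (suc m) × Fin (suc m) → Perm (suc m)
      q₁ _ (x , s) = x
      q₂ true (x , s) = disturb j k x s
      q₂ false (x , s) = x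
      q₃ true (x , s) = x
      q₃ false (x , s) = disturb j l x s
      q₄ true (x , s) = disturb j k x s
      q₄ false (x , s) = disturb j l x s

      𝔼-q₁ : ∀ ψ → 𝔼 D (λ (x , s) → ψ x) ≡ 𝔼 P ψ
      𝔼-q₁ ψ = cng (linear P) λ x → const N (ψ x)

      𝔼-qₖ : ∀ k ψ → 𝔼 D (λ (x , s) → ψ (disturb j k x s)) ≡ 𝔼 P ψ
      𝔼-qₖ k ψ = trans (comm P (linear N) _) (trans (cng (linear N) λ s → 𝔼-disturb j k s ψ) (const N (𝔼 P ψ)))

      uniform₂ : ∀ t ψ → 𝔼 D (ψ ∘ q₂ t) ≡ 𝔼 P ψ
      uniform₂ true = 𝔼-qₖ k
      uniform₂ false = 𝔼-q₁
      uniform₃ : ∀ t ψ → 𝔼 D (ψ ∘ q₃ t) ≡ 𝔼 P ψ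
      uniform₃ true = 𝔼-q₁
      uniform₃ false = 𝔼-qₖ l
      uniform₄ : ∀ t ψ → 𝔼 D (ψ ∘ q₄ t) ≡ 𝔼 P ψ
      uniform₄ true = 𝔼-qₖ k
      uniform₄ false = 𝔼-qₖ l

      columns-agree : ∀ {q q′ : Bool → Perm (suc m) × Fin (suc m) → Perm (suc m)} {i} →
        (∀ t z → rank (q t z) i ≡ rank (q′ t z) i) → ∀ {n} (T : Vec Bool n) z →
        column i (zipWith q T z) ≡ column i (zipWith q′ T z)
      columns-agree h [] [] = refl
      columns-agree h (t ∷ T) (z ∷ zs) = cong₂ _∷_ (h t z) (columns-agree h T zs)

      column-zipWith : ∀ (q : Bool → Perm (suc m) × Fin (suc m) → Perm (suc m)) {n} (T : Vec Bool n) z →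
        zipWith (λ t z → rank (q t z) j) T z ≡ column j (zipWith q T z)
      column-zipWith q [] [] = refl
      column-zipWith q (t ∷ T) (z ∷ zs) = cong (_ ∷_) (column-zipWith q T zs)

    -- Each of the four coupled profiles is uniform by itself, whence four times the bad
    -- probability. As `k` is neither `j` nor `l`, the second move fixes the column of `k`, as
    -- `good-square` demands.
    few-broken : FewBroken N (g j) (nat 4 * 𝔼 (P ^^ n) bad)
    few-broken T = ≤-trans (≤-reflexive (sym sampled)) (≤-trans (mono (D ^^ n) pointwise) (≤-reflexive total-bad))
      where
      S : (Bool → Perm (suc m) × Fin (suc m) → Perm (suc m)) → Vec (Perm (suc m) × Fin (suc m)) n → Profile (suc m) n
      S q z = zipWith q T z
      R : (Bool → Perm (suc m) × Fin (suc m) → Perm (suc m)) → Bool → Perm (suc m) × Fin (suc m) → Fin (suc m)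
      R q t z = rank (q t z) j
      sampled : 𝔼 (D ^^ n) (λ z → broken (g j (column j (S q₁ z))) (g j (column j (S q₂ z))) (g j (column j (S q₃ z))) (g j (column j (S q₄ z))))
        ≡ quad N T λ a b c d → broken (g j a) (g j b) (g j c) (g j d)
      sampled = trans (cng (linear (D ^^ n)) λ z → sym (congs (column-zipWith q₁ T z) (column-zipWith q₂ T z) (column-zipWith q₃ T z) (column-zipWith q₄ T z)))
        (quad-transport N D (R q₁) (R q₂) (R q₃) (R q₄)
          (λ ψ → 𝔼-rank-disturb j≢k λ a b → ψ a b a b) (λ ψ → 𝔼-rank-disturb j≢l λ a b → ψ a a b b) T λ a b c d → broken (g j a) (g j b) (g j c) (g j d))
        where
        congs : ∀ {a a′ b b′ c c′ d d′} → a ≡ a′ → b ≡ b′ → c ≡ c′ → d ≡ d′ →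
          broken (g j a) (g j b) (g j c) (g j d) ≡ broken (g j a′) (g j b′) (g j c′) (g j d′)
        congs refl refl refl refl = refl
      total-bad : 𝔼 (D ^^ n) (λ z → bad (S q₁ z) + (bad (S q₂ z) + (bad (S q₃ z) + bad (S q₄ z)))) ≡ nat 4 * 𝔼 (P ^^ n) bad
      total-bad = trans (add (linear (D ^^ n)) _ _) (trans (cong₂ _+_ (𝔼-zipWith D P q₁ (λ _ → 𝔼-q₁) T bad)
        (trans (add (linear (D ^^ n)) _ _) (cong₂ _+_ (𝔼-zipWith D P q₂ uniform₂ T bad)
          (trans (add (linear (D ^^ n)) _ _) (cong₂ _+_ (𝔼-zipWith D P q₃ uniform₃ T bad) (𝔼-zipWith D P q₄ uniform₄ T bad))))))
        (re (𝔼 (P ^^ n) bad)))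
        where
        re : ∀ b → b + (b + (b + b)) ≡ nat 4 * b
        re = solve-∀ ringℚ
      union : ∀ {Q A B C E : Set} (q : Dec Q) (a : Dec A) (b : Dec B) (c : Dec C) (e : Dec E) → (A → B → C → E → Q) →
        ind (¬? q) ℚ.≤ ind (¬? a) + (ind (¬? b) + (ind (¬? c) + ind (¬? e)))
      union (yes _) a b c e h = 0≤+ (0≤ind (¬? a)) (0≤+ (0≤ind (¬? b)) (0≤+ (0≤ind (¬? c)) (0≤ind (¬? e))))
      union (no _) (no _) b c e h = ≤-+ʳ (0≤+ (0≤ind (¬? b)) (0≤+ (0≤ind (¬? c)) (0≤ind (¬? e))))
        where
        ≤-+ʳ : ∀ {y} → 0ℚ ℚ.≤ y → 1ℚ ℚ.≤ 1ℚ + y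
        ≤-+ʳ h = ≤-trans (≤-reflexive (sym (ℚP.+-identityʳ 1ℚ))) (ℚP.+-monoʳ-≤ 1ℚ h)
      union (no _) (yes _) (no _) c e h = ≤-trans (ℚP.+-monoʳ-≤ 1ℚ (0≤+ (0≤ind (¬? c)) (0≤ind (¬? e)))) (≤-reflexive (sym (ℚP.+-identityˡ _)))
      union (no _) (yes _) (yes _) (no _) e h = ≤-trans (ℚP.+-monoʳ-≤ 1ℚ (0≤ind (¬? e)))
        (≤-reflexive (sym (trans (ℚP.+-identityˡ _) (ℚP.+-identityˡ _))))
      union (no ¬q) (yes a) (yes b) (yes c) (yes e) h = contradiction (h a b c e) ¬q
      union (no _) (yes _) (yes _) (yes _) (no _) h = ≤-refl
      pointwise : ∀ z → broken (g j (column j (S q₁ z))) (g j (column j (S q₂ z))) (g j (column j (S q₃ z))) (g j (column j (S q₄ z))) ℚ.≤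
        bad (S q₁ z) + (bad (S q₂ z) + (bad (S q₃ z) + bad (S q₄ z)))
      pointwise z = union (square? _ _ _ _) (good? (S q₁ z)) (good? (S q₂ z)) (good? (S q₃ z)) (good? (S q₄ z))
        (good-square j≢k
          (λ i i≢j i≢k → columns-agree (λ { true (x , s) → sym (rank-disturb-other x s i≢j i≢k) ; false _ → refl }) T z)
          (λ i i≢j i≢k → columns-agree (λ { true (x , s) → sym (rank-disturb-other x s i≢j i≢k) ; false _ → refl }) T z)
          (columns-agree (λ { true _ → refl ; false (x , s) → sym (rank-disturb-other x s (j≢k ∘ sym) k≢l) }) T z)
          (columns-agree (λ { true _ → refl ; false (x , s) → sym (rank-disturb-other x s (j≢k ∘ sym) k≢l) }) T z))

-- Rounding to an exact dictator or constant

ind-<1 : ∀ {P : Set} (d : Dec P) → ind (¬? d) ℚ.< 1ℚ → P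
ind-<1 (yes p) _ = p
ind-<1 (no _) h = ⊥-elim (<-irrefl refl h)

-- An independent pair of ranks has probability 1/m². If `j` had rank `r` and has rank `s` ≠ `r`
-- after `disturb`, the exchange did take place, so `k` had rank `s`.
pair-probability : ∀ {m} {j k r s : Fin (suc m)} → j ≢ k → r ≢ s → 1ℚ ℚ.≤ dim (suc m) * (dim (suc m) *
  𝔼 (perms (suc m)) λ x → ind (rank x j Fin.≟ r ×-dec rank x k Fin.≟ s))
pair-probability {m} {j} {k} {r} {s} j≢k r≢s = ≤-trans (≤-reflexive (sym product))
  (*-monoˡ M (0≤dim (suc m)) (*-monoˡ M (0≤dim (suc m)) (≤-trans (≤-reflexive (sym (𝔼-rank-disturb j≢k λ a b → at r a * at s b)))
    (mono P λ x → ≤-trans (mono N (pointwise x)) (≤-reflexive (const N _))))))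
  where
  M = dim (suc m)
  P = perms (suc m)
  N = names m
  at : Fin (suc m) → Fin (suc m) → ℚ
  at r a = ind (a Fin.≟ r)
  M*at : ∀ r → M * 𝔼 N (at r) ≡ 1ℚ
  M*at r = trans (sym (∑-names m (at r))) (fin-enum r)
  re : ∀ M a b → M * (M * (a * b)) ≡ M * a * (M * b)
  re = solve-∀ ringℚ
  product : M * (M * 𝔼 N λ a → 𝔼 N λ b → at r a * at s b) ≡ 1ℚ
  product = trans (cong (λ z → M * (M * z)) (independent-* N (at r) (at s)))
    (trans (re M (𝔼 N (at r)) (𝔼 N (at s))) (cong₂ _*_ (M*at r) (M*at s)))
  both : ∀ {A B C : Set} (a : Dec A) (b : Dec B) (c : Dec C) → (A → B → C) → ind a * ind b ℚ.≤ ind c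
  both (yes a) (yes b) c h = ≤-reflexive (sym (ind-yes c (h a b)))
  both (yes _) (no _) c h = 0≤ind c
  both (no _) b c h = ≤-trans (≤-reflexive (ℚP.*-zeroˡ (ind b))) (0≤ind c)
  pointwise : ∀ x t → at r (rank x j) * at s (rank (disturb j k x t) j) ℚ.≤ ind (rank x j Fin.≟ r ×-dec rank x k Fin.≟ s)
  pointwise x t with t Fin.≟ j
  ... | yes _ = both (rank x j Fin.≟ r) (rank x j Fin.≟ s) (rank x j Fin.≟ r ×-dec rank x k Fin.≟ s)
    λ a b → contradiction (trans (sym a) b) r≢s
  ... | no _ = both (rank x j Fin.≟ r) (rank (swapNames j k x) j Fin.≟ s) (rank x j Fin.≟ r ×-dec rank x k Fin.≟ s)
    λ a b → a , trans (sym (rank-swapNames-left j k x)) b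

module Rounding {m n : ℕ} (f : Profile (suc (suc m)) n → Perm (suc (suc m)))
  (voter : Fin (suc (suc m)) → Fin n) (η : Fin (suc (suc m)) → Fin (suc (suc m)) → Fin (suc (suc m))) where

  private
    M = dim (suc (suc m))
    P = perms (suc (suc m))

  Fits : Profile (suc (suc m)) n → Set
  Fits x = ∀ j → rank (f x) j ≡ η j (rank (lookup x (voter j)) j)

  fits? : ∀ x → Dec (Fits x)
  fits? x = FinP.all? λ j → rank (f x) j Fin.≟ η j (rank (lookup x (voter j)) j)

  misfit : Profile (suc (suc m)) n → ℚ
  misfit x = ind (¬? (fits? x))

  module _ {j k} (j≢k : j ≢ k) (i : Fin n) (x : Profile (suc (suc m)) n)
    (Fx : Fits x) (Fx′ : Fits (x [ i ]≔ swapNames j k (lookup x i))) where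

    private
      x′ = x [ i ]≔ swapNames j k (lookup x i)

      at-i : ∀ l → rank (lookup x′ i) l ≡ rank (swapNames j k (lookup x i)) l
      at-i l = cong (λ z → rank z l) (VecP.lookup∘updateAt i x)

      elsewhere : ∀ q l → q ≢ i → rank (lookup x′ q) l ≡ rank (lookup x q) l
      elsewhere q l q≢i = cong (λ z → rank z l) (VecP.lookup∘updateAt′ q i q≢i x)

      others : ∀ l → l ≢ j → l ≢ k → ∀ q → rank (lookup x′ q) l ≡ rank (lookup x q) l
      others l l≢j l≢k q with q Fin.≟ i
      ... | yes refl = trans (at-i l) (rank-swapNames-other (lookup x i) l≢j l≢k)
      ... | no q≢i = elsewhere q l q≢i

    outcomes : (rank (f x) j ≡ rank (f x′) j × rank (f x) k ≡ rank (f x′) k) ⊎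
               (rank (f x) j ≡ rank (f x′) k × rank (f x) k ≡ rank (f x′) j)
    outcomes = two-ranks (f x) (f x′) j≢k λ l l≢j l≢k →
      trans (Fx l) (trans (cong (η l) (sym (others l l≢j l≢k (voter l)))) (sym (Fx′ l)))

    -- `k` depends on another voter, so its outcome rank stays; then `j` cannot have traded ranks
    -- with `k`.
    exchange-other : voter j ≡ i → voter k ≢ i → η j (rank (lookup x i) j) ≡ η j (rank (lookup x i) k)
    exchange-other refl k≢i = trans (sym (Fx j)) (trans same (trans (Fx′ j)
        (cong (η j) (trans (at-i j) (rank-swapNames-left j k (lookup x i))))))
      where
      same-k : rank (f x) k ≡ rank (f x′) k
      same-k = trans (Fx k) (trans (cong (η k) (sym (elsewhere (voter k) k k≢i))) (sym (Fx′ k)))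
      same : rank (f x) j ≡ rank (f x′) j
      same with outcomes
      ... | inj₁ (e , _) = e
      ... | inj₂ (e , _) = contradiction (rank-injective (f x) (trans e (sym same-k))) j≢k

    exchange-same : voter j ≡ i → voter k ≡ i →
      η j (rank (lookup x i) j) ≡ η j (rank (lookup x i) k) ⊎
      (η j (rank (lookup x i) j) ≡ η k (rank (lookup x i) j) × η j (rank (lookup x i) k) ≡ η k (rank (lookup x i) k))
    exchange-same refl k≡i with outcomes
    ... | inj₁ (e , _) = inj₁ (trans (sym (Fx j)) (trans e (trans (Fx′ j)
            (cong (η j) (trans (at-i j) (rank-swapNames-left j k (lookup x i)))))))
    ... | inj₂ (e , e′) = inj₂
            ( trans (sym (Fx j)) (trans e (trans (Fx′ k) (cong (η k) (trans (cong (λ q → rank (lookup x′ q) k) k≡i)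
                (trans (at-i k) (rank-swapNames-right j k (lookup x i)))))))
            , sym (trans (cong (λ q → η k (rank (lookup x q) k)) (sym k≡i)) (trans (sym (Fx k)) (trans e′ (trans (Fx′ j)
                (cong (η j) (trans (at-i j) (rank-swapNames-left j k (lookup x i)))))))))

  Exchangeable : Set
  Exchangeable = ∀ {j k r s} i → j ≢ k → r ≢ s → ∃ λ x → Fits x × Fits (x [ i ]≔ swapNames j k (lookup x i)) ×
    rank (lookup x i) j ≡ r × rank (lookup x i) k ≡ s

  -- The swapped profile is again uniform, so the three failure indicators have expected sum 2κ + 1
  -- - p, which is below 1 because p ≥ 1/M² > 2κ. A profile where the sum is below 1 has no failure
  -- at all.
  exchangeable : nat 2 * (M * (M * 𝔼 (P ^^ n) misfit)) ℚ.< 1ℚ → Exchangeable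
  exchangeable small {j} {k} {r} {s} i j≢k r≢s = x ,
      ind-<1 (fits? x) (≤-<-trans (first a b c 0≤b 0≤c) below) ,
      ind-<1 (fits? (swap x)) (≤-<-trans (second a b c 0≤a 0≤c) below) ,
      ind-<1 (event? (lookup x i)) (≤-<-trans (third a b c 0≤a 0≤b) below)
    where
    swap : Profile (suc (suc m)) n → Profile (suc (suc m)) n
    swap x = x [ i ]≔ swapNames j k (lookup x i)
    event? : ∀ y → Dec (rank y j ≡ r × rank y k ≡ s)
    event? y = rank y j Fin.≟ r ×-dec rank y k Fin.≟ s
    κ = 𝔼 (P ^^ n) misfit
    p = 𝔼 P (ind ∘ event?)
    G : Profile (suc (suc m)) n → ℚ
    G x = misfit x + (misfit (swap x) + ind (¬? (event? (lookup x i))))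
    average : 𝔼 (P ^^ n) G ≡ κ + (κ + (1ℚ - p))
    average = trans (add (linear (P ^^ n)) misfit _) (+-congˡ κ (trans (add (linear (P ^^ n)) (misfit ∘ swap) _)
      (cong₂ _+_ (𝔼-update P (swapNames j k) (𝔼-swapNames j k) i misfit)
        (trans (𝔼-lookup P i λ y → ind (¬? (event? y))) (trans (cng (linear P) λ y → ind-¬ (event? y)) (complement P (ind ∘ event?)))))))
    2κ<p : κ + κ ℚ.< p
    2κ<p = ℚP.*-cancelˡ-<-nonNeg (M * M) {{ℚ.nonNegative (0≤* (0≤dim (suc (suc m))) (0≤dim (suc (suc m))))}}
      (ℚP.≤-<-trans (≤-reflexive (re M κ)) (<-≤-trans small (≤-trans (pair-probability j≢k r≢s) (≤-reflexive (sym (ℚP.*-assoc M M p))))))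
      where
      re : ∀ M κ → M * M * (κ + κ) ≡ nat 2 * (M * (M * κ))
      re = solve-∀ ringℚ
    average<1 : 𝔼 (P ^^ n) G ℚ.< 1ℚ
    average<1 = ℚP.≤-<-trans (≤-reflexive (trans average (re κ p)))
      (<-≤-trans (ℚP.+-monoˡ-< (1ℚ - p) 2κ<p) (≤-reflexive (re′ p)))
      where
      re : ∀ κ p → κ + (κ + (1ℚ - p)) ≡ κ + κ + (1ℚ - p)
      re = solve-∀ ringℚ
      re′ : ∀ p → p + (1ℚ - p) ≡ 1ℚ
      re′ = solve-∀ ringℚ
    found = attain (P ^^ n) G (𝔼 (P ^^ n) G) ≤-refl
    x = proj₁ found
    below : G x ℚ.< 1ℚ
    below = ≤-<-trans (proj₂ found) average<1
    a = misfit x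
    b = misfit (swap x)
    c = ind (¬? (event? (lookup x i)))
    0≤a : 0ℚ ℚ.≤ a
    0≤a = 0≤ind (¬? (fits? x))
    0≤b : 0ℚ ℚ.≤ b
    0≤b = 0≤ind (¬? (fits? (swap x)))
    0≤c : 0ℚ ℚ.≤ c
    0≤c = 0≤ind (¬? (event? (lookup x i)))
    first : ∀ a b c → 0ℚ ℚ.≤ b → 0ℚ ℚ.≤ c → a ℚ.≤ a + (b + c)
    first a b c hb hc = by-nonneg (0≤+ hb hc) (re a b c)
      where
      re : ∀ a b c → b + c ≡ a + (b + c) - a
      re = solve-∀ ringℚ
    second : ∀ a b c → 0ℚ ℚ.≤ a → 0ℚ ℚ.≤ c → b ℚ.≤ a + (b + c)
    second a b c ha hc = by-nonneg (0≤+ ha hc) (re a b c)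
      where
      re : ∀ a b c → a + c ≡ a + (b + c) - b
      re = solve-∀ ringℚ
    third : ∀ a b c → 0ℚ ℚ.≤ a → 0ℚ ℚ.≤ b → c ℚ.≤ a + (b + c)
    third a b c ha hb = by-nonneg (0≤+ ha hb) (re a b c)
      where
      re : ∀ a b c → a + b ≡ a + (b + c) - c
      re = solve-∀ ringℚ

  module _ (exchange : Exchangeable) where

    constant-unless-shared : ∀ {j k} → j ≢ k → voter k ≢ voter j → ∀ {r s} → r ≢ s → η j r ≡ η j s
    constant-unless-shared {j} {k} j≢k vk≢vj r≢s =
      let (x , Fx , Fx′ , er , es) = exchange (voter j) j≢k r≢s
      in subst₂ (λ r s → η j r ≡ η j s) er es (exchange-other j≢k (voter j) x Fx Fx′ refl vk≢vj)

    agree-or-equal : ∀ {j k} → j ≢ k → voter k ≡ voter j → ∀ {r s} → r ≢ s →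
      η j r ≡ η j s ⊎ (η j r ≡ η k r × η j s ≡ η k s)
    agree-or-equal {j} {k} j≢k vk≡vj r≢s =
      let (x , Fx , Fx′ , er , es) = exchange (voter j) j≢k r≢s
      in subst₂ (λ r s → η j r ≡ η j s ⊎ (η j r ≡ η k r × η j s ≡ η k s)) er es
           (exchange-same j≢k (voter j) x Fx Fx′ refl vk≡vj)

    -- A different voter for `k` would make `η j` constant. With the same voter, `η k` agrees with
    -- `η j` at any two ranks that `η j` separates, and every `t` is separated from `r` or from `s`.
    nonconstant-shared : ∀ {j r s} → η j r ≢ η j s → ∀ k → voter k ≡ voter j × (∀ t → η k t ≡ η j t)
    nonconstant-shared {j} {r} {s} r≁s k with j Fin.≟ k
    ... | yes refl = refl , λ _ → refl
    ... | no j≢k with voter k Fin.≟ voter j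
    ...   | no vk≢vj = contradiction (constant-unless-shared j≢k vk≢vj (r≁s ∘ cong (η j))) r≁s
    ...   | yes vk≡vj = vk≡vj , agree
      where
      decide : ∀ t u → η j t ≢ η j u → η j t ≡ η k t
      decide t u t≁u with agree-or-equal j≢k vk≡vj {t} {u} (t≁u ∘ cong (η j))
      ... | inj₁ e = contradiction e t≁u
      ... | inj₂ (e , _) = e
      agree : ∀ t → η k t ≡ η j t
      agree t with η j t Fin.≟ η j r
      ... | no t≁r = sym (decide t r t≁r)
      ... | yes t~r = sym (decide t s λ e → r≁s (trans (sym t~r) e))

    base : ∃ Fits
    base = let (x , Fx , _) = exchange {zero} {suc zero} {zero} {suc zero} (voter zero) (λ ()) (λ ()) in x , Fx

    dictatorial : ∀ i (τ : Fin (suc (suc m)) → Fin (suc (suc m))) → (∀ k → voter k ≡ i × (∀ t → η k t ≡ τ t)) →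
      ∃ λ h → ConstOrDictator (suc (suc m)) n h × (∀ x → Fits x → f x ≡ h x)
    dictatorial i τ shared = h , inj₂ (i , y , λ x r → app-mkPerm _ _ _ r) , λ x Fx → perm-ext-rank λ j →
      trans (via-τ x Fx j) (sym (trans (rank-mkPerm _ _ _ j) (trans (rank-mkPerm _ _ _ (rank (lookup x i) j))
        (trans (via-τ x₀ (proj₂ base) _) (cong τ (rank-app (lookup x₀ i) (rank (lookup x i) j)))))))
      where
      x₀ = proj₁ base
      via-τ : ∀ x → Fits x → ∀ j → rank (f x) j ≡ τ (rank (lookup x i) j)
      via-τ x Fx j = trans (Fx j) (trans (proj₂ (shared j) _) (cong (λ q → τ (rank (lookup x q) j)) (proj₁ (shared j))))
      -- The fitting profile `x₀` exhibits `τ` as `rank (f x₀) ∘ app (lookup x₀ i)`, hence as a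
      -- bijection; `y` is its inverse.
      y : Perm (suc (suc m))
      y = mkPerm (rank (lookup x₀ i) ∘ app (f x₀)) (rank (f x₀) ∘ app (lookup x₀ i))
        λ a → trans (cong (rank (lookup x₀ i)) (app-rank (f x₀) _)) (rank-app (lookup x₀ i) a)
      h : Profile (suc (suc m)) n → Perm (suc (suc m))
      h x = mkPerm (app (lookup x i) ∘ app y) (rank y ∘ rank (lookup x i))
        λ a → trans (cong (app (lookup x i)) (app-rank y _)) (app-rank (lookup x i) a)

    rounding : ∃ λ h → ConstOrDictator (suc (suc m)) n h × (∀ x → Fits x → f x ≡ h x)
    rounding with FinP.any? (λ j → FinP.any? λ r → FinP.any? λ s → ¬? (η j r Fin.≟ η j s))
    ... | yes (j , r , s , r≁s) = dictatorial (voter j) (η j) (nonconstant-shared r≁s)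
    ... | no all-constant = (λ _ → f (proj₁ base)) , inj₁ (f (proj₁ base) , λ _ _ → refl) , λ x Fx → perm-ext-rank λ j →
      trans (Fx j) (trans (constant j _ _) (sym (proj₂ base j)))
      where
      constant : ∀ j r s → η j r ≡ η j s
      constant j r s with η j r Fin.≟ η j s
      ... | yes e = e
      ... | no ne = contradiction (j , r , s , ne) all-constant

-- Counting probabilities as expectations

nat-sum : ∀ {X : Set} (φ : X → ℕ) L → nat (ℕL.sum (map φ L)) ≡ ∑ L (nat ∘ φ)
nat-sum φ [] = refl
nat-sum φ (x ∷ L) = trans (nat-+ (φ x) _) (+-congˡ (nat (φ x)) (nat-sum φ L))

nat-sum-concatMap : ∀ {X Y : Set} (φ : X → Y → ℕ) K L →
  nat (ℕL.sum (concatMap (λ a → map (φ a) L) K)) ≡ ∑ K λ a → ∑ L λ b → nat (φ a b)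
nat-sum-concatMap φ [] L = refl
nat-sum-concatMap φ (a ∷ K) L = trans (cong nat (ℕL.sum-++ (map (φ a) L) (concatMap (λ a → map (φ a) L) K)))
  (trans (nat-+ (ℕL.sum (map (φ a) L)) _) (cong₂ _+_ (nat-sum (φ a) L) (nat-sum-concatMap φ K L)))

nat-count : ∀ {X : Set} (p : X → Bool) L → nat (count p L) ≡ ∑ L λ x → if p x then 1ℚ else 0ℚ
nat-count p [] = refl
nat-count p (x ∷ L) with p x
... | true = trans (nat-suc (count p L)) (+-congˡ 1ℚ (nat-count p L))
... | false = trans (nat-count p L) (sym (ℚP.+-identityˡ _))

sumℚ-concatMap : ∀ {X Y : Set} (φ : X → Y → ℚ) K L →
  sumℚ (concatMap (λ a → map (φ a) L) K) ≡ ∑ K λ a → ∑ L (φ a)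
sumℚ-concatMap {Y = Y} φ K L = trans (plain (concatMap (λ a → map (φ a) L) K))
  (trans (∑-concatMap (λ a → map (φ a) L) K id) (cng (∑-linear K) λ a → ∑-map (φ a) L id))
  where
  plain : ∀ L → sumℚ L ≡ ∑ L id
  plain [] = refl
  plain (q ∷ L) = +-congˡ q (plain L)

frac-unique′ : ∀ c t e → t ≢ 0 → nat c ≡ nat t * e → frac c t ≡ e
frac-unique′ c zero e t≢0 _ = contradiction refl t≢0
frac-unique′ c (suc t) e _ h = frac-unique c t e h

module _ (m : ℕ) where

  ∑-profiles : ∀ n F → ∑ (allProfiles m n) F ≡ nat (length (allProfiles m n)) * 𝔼 (perms m ^^ n) F
  ∑-profiles zero F = trans (ℚP.+-identityʳ (F [])) (sym (ℚP.*-identityˡ (F [])))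
  ∑-profiles (suc n) F = trans (expand F) (cong (_* 𝔼 (perms m ^^ suc n) F) (sym size))
    where
    c = nat (length (allProfiles m n))
    d = nat (length (allPerms m))
    re : ∀ c d e → c * (d * e) ≡ c * d * e
    re = solve-∀ ringℚ
    expand : ∀ F → ∑ (allProfiles m (suc n)) F ≡ c * d * 𝔼 (perms m ^^ suc n) F
    expand F = trans (∑-concatMap _ (allPerms m) F) (trans (cng (∑-linear (allPerms m)) λ a →
        trans (∑-map (a ∷_) (allProfiles m n) F) (∑-profiles n λ v → F (a ∷ v)))
      (trans (scale (∑-linear (allPerms m)) c _) (trans (cong (c *_) (∑-perms m _)) (re c d _))))
    size : nat (length (allProfiles m (suc n))) ≡ c * d
    size = trans (trans (sym (ℚP.*-identityʳ _)) (sym (∑-const (allProfiles m (suc n)) 1ℚ)))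
      (trans (expand λ _ → 1ℚ) (trans (cong (c * d *_) (one (perms m ^^ suc n))) (ℚP.*-identityʳ (c * d))))

  enumerated-nonempty : ∀ {X : Set} (_≟ˣ_ : ∀ (a b : X) → Dec (a ≡ b)) (L : List X) → Enumerates _≟ˣ_ L → X → length L ≢ 0
  enumerated-nonempty _ [] enum x _ = ℚP.1≢0 (sym (enum x))

  perms-size : length (allPerms m) ≢ 0
  perms-size = enumerated-nonempty _≟ᵖ_ (allPerms m) (allPerms-enum m) identity

  profiles-size : ∀ n → length (allProfiles m n) ≢ 0
  profiles-size n = enumerated-nonempty (VecP.≡-dec _≟ᵖ_) (allProfiles m n) (allVecs-enum _≟ᵖ_ (allPerms m) (allPerms-enum m) n) (Vec.replicate n identity)

  PrPair-𝔼 : ∀ n E → PrPair m n E ≡ 𝔼 (perms m ^^ n) λ x → 𝔼 (perms m) λ y → if E x y then 1ℚ else 0ℚ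
  PrPair-𝔼 n E = frac-unique′ (count (λ p → E (proj₁ p) (proj₂ p)) pairs) (a ℕ.* b) _ product≢0
    (trans (nat-count _ pairs) (trans (∑-concatMap _ (allProfiles m n) _)
      (trans (cng (∑-linear (allProfiles m n)) λ x → trans (∑-map (x ,_) (allPerms m) _) (∑-perms m _))
        (trans (scale (∑-linear (allProfiles m n)) (nat b) _) (trans (cong (nat b *_) (∑-profiles n _))
          (trans (re (nat a) (nat b) _) (cong (_* e) (sym (nat-* a b)))))))))
    where
    pairs = concatMap (λ x → map (λ y → x , y) (allPerms m)) (allProfiles m n)
    a = length (allProfiles m n)
    b = length (allPerms m)
    e = 𝔼 (perms m ^^ n) λ x → 𝔼 (perms m) λ y → if E x y then 1ℚ else 0ℚ
    re : ∀ a b e → b * (a * e) ≡ a * b * e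
    re = solve-∀ ringℚ
    product≢0 : a ℕ.* b ≢ 0
    product≢0 ab≡0 with ℕP.m*n≡0⇒m≡0∨n≡0 a ab≡0
    ... | inj₁ a≡0 = profiles-size n a≡0
    ... | inj₂ b≡0 = perms-size b≡0

  ExpDist-𝔼 : ∀ n f h → ExpDist m n f h ≡ 𝔼 (perms m ^^ n) λ x → nat (frob2 (f x) (h x))
  ExpDist-𝔼 n f h = frac-unique′ (ℕL.sum (map (λ x → frob2 (f x) (h x)) (allProfiles m n))) (length (allProfiles m n)) _ (profiles-size n)
    (trans (nat-sum (λ x → frob2 (f x) (h x)) (allProfiles m n)) (∑-profiles n _))

event-ind : ∀ {m} (x y z w : Perm m) j →
  (if eqMF (inv x j) (inv y j) ∧ not (eqMF (inv z j) (inv w j)) then 1ℚ else 0ℚ) ≡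
  ind (rank y j Fin.≟ rank x j) * ind (¬? (rank z j Fin.≟ rank w j))
event-ind x y z w j rewrite inv-rank x j | inv-rank y j | inv-rank z j | inv-rank w j =
  trans (cong (λ b → if b ∧ not (eqMF (just (rank z j)) (just (rank w j))) then 1ℚ else 0ℚ) (eqMF-just (rank x j) (rank y j)))
    (trans (cong (λ b → if ⌊ rank x j Fin.≟ rank y j ⌋ ∧ not b then 1ℚ else 0ℚ) (eqMF-just (rank z j) (rank w j)))
      (trans (product (rank x j Fin.≟ rank y j) (rank z j Fin.≟ rank w j))
        (cong (_* ind (¬? (rank z j Fin.≟ rank w j))) (ind-⇔ (rank x j Fin.≟ rank y j) (rank y j Fin.≟ rank x j) sym sym))))
  where
  eqMF-just : ∀ {m} (a b : Fin m) → eqMF (just a) (just b) ≡ ⌊ a Fin.≟ b ⌋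
  eqMF-just a b with a Fin.≟ b
  ... | yes _ = refl
  ... | no _ = refl
  product : ∀ {A B : Set} (a : Dec A) (b : Dec B) → (if ⌊ a ⌋ ∧ not ⌊ b ⌋ then 1ℚ else 0ℚ) ≡ ind a * ind (¬? b)
  product (yes _) (yes _) = refl
  product (yes _) (no _) = refl
  product (no _) b = sym (ℚP.*-zeroˡ (ind (¬? b)))

violation : ∀ {m n} → (Profile m n → Perm m) → Fin n → Fin m → ℚ
violation {m} {n} f i j = 𝔼 (perms m ^^ n) λ x → 𝔼 (perms m) λ y →
  ind (rank y j Fin.≟ rank (lookup x i) j) * ind (¬? (rank (f x) j Fin.≟ rank (f (x [ i ]≔ y)) j))

IRsum-𝔼 : ∀ m n f → IRsum m n f ≡ ∑ (allFin n) λ i → ∑ (allFin m) (violation f i)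
IRsum-𝔼 m n f = trans (sumℚ-concatMap _ (allFin n) (allFin m)) (cng (∑-linear (allFin n)) λ i → cng (∑-linear (allFin m)) λ j →
  trans (PrPair-𝔼 m n _) (cng (linear (perms m ^^ n)) λ x → cng (linear (perms m)) λ y →
    event-ind (lookup x i) y (f x) (f (x [ i ]≔ y)) j))

frob2-≤ : ∀ {m} (z w : Perm m) → nat (frob2 z w) ℚ.≤ dim m * (dim m * 1ℚ)
frob2-≤ {m} z w = ≤-trans (≤-reflexive (nat-sum-concatMap entry (allFin m) (allFin m)))
  (≤-trans (∑-mono (allFin m) λ a → ∑-mono (allFin m) λ b → nat-mono (bounded ⌊ app z a Fin.≟ b ⌋ ⌊ app w a Fin.≟ b ⌋))
    (≤-reflexive (trans (cng (∑-linear (allFin m)) λ a → ∑-fin-const m 1ℚ) (∑-fin-const m (dim m * 1ℚ)))))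
  where
  entry : Fin m → Fin m → ℕ
  entry a b = ℕ.∣ PM z a b - PM w a b ∣ ^ 2
  bounded : ∀ p q → ℕ.∣ (if p then 1 else 0) - (if q then 1 else 0) ∣ ^ 2 ≤ 1
  bounded true true = z≤n
  bounded true false = ℕP.≤-refl
  bounded false true = ℕP.≤-refl
  bounded false false = z≤n

frob2-refl : ∀ {m} (z : Perm m) → nat (frob2 z z) ≡ 0ℚ
frob2-refl {m} z = trans (nat-sum-concatMap (λ a b → ℕ.∣ PM z a b - PM z a b ∣ ^ 2) (allFin m) (allFin m))
  (trans (cng (∑-linear (allFin m)) λ a → trans (cng (∑-linear (allFin m)) λ b → cong (λ d → nat (d ^ 2)) (ℕP.∣n-n∣≡0 (PM z a b)))
    (zer (∑-linear (allFin m)))) (zer (∑-linear (allFin m))))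

two-others : ∀ {m} (j : Fin (suc (suc (suc m)))) → ∃ λ k → ∃ λ l → j ≢ k × j ≢ l × k ≢ l
two-others zero = suc zero , suc (suc zero) , (λ ()) , (λ ()) , λ ()
two-others (suc zero) = zero , suc (suc zero) , (λ ()) , (λ ()) , λ ()
two-others (suc (suc j)) = zero , suc zero , (λ ()) , (λ ()) , λ ()

zipWith-column : ∀ {m n} {Z : Set} (φ : Fin m → Z → Z) l (x : Profile m n) t →
  zipWith (λ y → φ (rank y l)) x t ≡ zipWith φ (column l x) t
zipWith-column φ l [] [] = refl
zipWith-column φ l (x ∷ xs) (t ∷ ts) = cong (_ ∷_) (zipWith-column φ l xs ts)

-- Outcome ranks as functions of one column

module _ {m n : ℕ} (f : Profile (suc m) n → Perm (suc m)) where

  private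
    P = perms (suc m)

  -- Rerandomise every voter while keeping the rank of `l`; by `hybrid` the outcome rank of `l`
  -- rarely changes. Fixing a good seed `t` leaves a function of the column of `l` alone.
  column-determined : ∀ l → ∃ λ (g : Vec (Fin (suc m)) n → Fin (suc m)) →
    𝔼 (P ^^ n) (λ x → ind (¬? (rank (f x) l Fin.≟ g (column l x)))) ℚ.≤ dim (suc m) * ∑ (allFin n) λ i → violation f i l
  column-determined l = (λ c → rank (f (zipWith (moveTo l) c t)) l) , ≤-trans
      (≤-reflexive (cng (linear (P ^^ n)) λ x → cong (λ z → ind (¬? (rank (f x) l Fin.≟ rank (f z) l))) (sym (zipWith-column (moveTo l) l x t))))
      (proj₂ found)
    where
    mv : Perm (suc m) → Perm (suc m) → Perm (suc m)
    mv x t = moveTo l (rank x l) t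
    differ : Profile (suc m) n → Profile (suc m) n → ℚ
    differ x z = ind (¬? (rank (f x) l Fin.≟ rank (f z) l))
    influence : ∀ i → 𝔼 (P ^^ n) (λ x → 𝔼 P λ t → differ x (x [ i ]≔ mv (lookup x i) t)) ≡ dim (suc m) * violation f i l
    influence i = trans (cng (linear (P ^^ n)) λ x → 𝔼-moveTo l (rank (lookup x i) l) λ y → differ x (x [ i ]≔ y))
      (scale (linear (P ^^ n)) (dim (suc m)) _)
    average : 𝔼 (P ^^ n) (λ t → 𝔼 (P ^^ n) λ x → differ x (zipWith mv x t)) ℚ.≤ dim (suc m) * ∑ (allFin n) λ i → violation f i l
    average = ≤-trans (≤-reflexive (comm (P ^^ n) (linear (P ^^ n)) _))
      (≤-trans (hybrid P mv (𝔼-moveTo-rank l) λ x → rank (f x) l)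
        (≤-reflexive (trans (cng (∑-linear (allFin n)) influence) (scale (∑-linear (allFin n)) (dim (suc m)) _))))
    found = attain (P ^^ n) (λ t → 𝔼 (P ^^ n) λ x → differ x (zipWith mv x t)) _ average
    t = proj₁ found

  bad-≤ : ∀ (g : Fin (suc m) → Vec (Fin (suc m)) n → Fin (suc m)) →
    (∀ l → 𝔼 (P ^^ n) (λ x → ind (¬? (rank (f x) l Fin.≟ g l (column l x)))) ℚ.≤ dim (suc m) * ∑ (allFin n) λ i → violation f i l) →
    𝔼 (P ^^ n) (bad f g) ℚ.≤ dim (suc m) * IRsum (suc m) n f
  bad-≤ g h = ≤-trans (mono (P ^^ n) λ x → ind-¬∀ λ l → rank (f x) l Fin.≟ g l (column l x))
    (≤-trans (≤-reflexive (sym (∑-comm (allFin (suc m)) (linear (P ^^ n)) _)))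
      (≤-trans (∑-mono (allFin (suc m)) h) (≤-reflexive (trans (scale (∑-linear (allFin (suc m))) (dim (suc m)) _)
        (cong (dim (suc m) *_) (trans (∑-comm (allFin (suc m)) (∑-linear (allFin n)) _) (sym (IRsum-𝔼 (suc m) n f))))))))

-- Powers of m and the constant 6178

module _ {m n : ℕ} (f : Profile (suc (suc (suc m))) (suc n) → Perm (suc (suc (suc m)))) where

  private
    d : ℕ
    d = suc (suc (suc m))
    K = dim d
    P = perms d
    N = names (suc (suc m))

  module _ (g : Fin d → Vec (Fin d) (suc n) → Fin d) (small : nat 256 * (K * (nat 4 * 𝔼 (P ^^ suc n) (bad f g))) ℚ.≤ 1ℚ) where

    private
      b = 𝔼 (P ^^ suc n) (bad f g)

    column-dictator : ∀ j → ∃ λ i → ∃ λ (η : Fin d → Fin d) →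
      𝔼 (N ^^ suc n) (λ c → ind (¬? (g j c Fin.≟ η (lookup c i)))) ℚ.≤ nat 772 * (K * (nat 4 * b))
    column-dictator j = few-broken-squares N (g j) (nat 4 * b) (few-broken′ (two-others j)) K (names-atomic (suc (suc m))) small
      where
      few-broken′ : (∃ λ k → ∃ λ l → j ≢ k × j ≢ l × k ≢ l) → FewBroken N (g j) (nat 4 * b)
      few-broken′ (k , l , j≢k , j≢l , k≢l) = few-broken f g j≢k j≢l k≢l

    misfit-≤ : (voter : Fin d → Fin (suc n)) (η : Fin d → Fin d → Fin d) →
      (∀ j → 𝔼 (N ^^ suc n) (λ c → ind (¬? (g j c Fin.≟ η j (lookup c (voter j))))) ℚ.≤ nat 772 * (K * (nat 4 * b))) →
      𝔼 (P ^^ suc n) (Rounding.misfit f voter η) ℚ.≤ b + K * (nat 772 * (K * (nat 4 * b)))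
    misfit-≤ voter η h = ≤-trans (mono (P ^^ suc n) pointwise) (≤-trans (≤-reflexive expand)
      (ℚP.+-monoʳ-≤ b (≤-trans (∑-mono (allFin d) h) (≤-reflexive (∑-fin-const d _)))))
      where
      off : Fin d → Vec (Fin d) (suc n) → ℚ
      off j c = ind (¬? (g j c Fin.≟ η j (lookup c (voter j))))
      expand : 𝔼 (P ^^ suc n) (λ x → bad f g x + ∑ (allFin d) λ j → off j (column j x)) ≡ b + ∑ (allFin d) λ j → 𝔼 (N ^^ suc n) (off j)
      expand = trans (add (linear (P ^^ suc n)) (bad f g) λ x → ∑ (allFin d) λ j → off j (column j x)) (+-congˡ b (trans (sym (∑-comm (allFin d) (linear (P ^^ suc n)) λ j x → off j (column j x)))
        (cng (∑-linear (allFin d)) λ j → 𝔼-map P N (λ x → rank x j) (𝔼-rank j) (suc n) (off j))))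
      union : ∀ {A B C : Set} (a : Dec A) (b : Dec B) (c : Dec C) → (A → B → C) → ind (¬? c) ℚ.≤ ind (¬? a) + ind (¬? b)
      union a b (yes _) h = 0≤+ (0≤ind (¬? a)) (0≤ind (¬? b))
      union (yes x) (yes y) (no ¬z) h = contradiction (h x y) ¬z
      union (no _) (yes _) (no _) h = ≤-refl
      union (yes _) (no _) (no _) h = ≤-refl
      union (no _) (no _) (no _) h = by-nonneg (lit 1ℚ) refl
      pointwise : ∀ x → Rounding.misfit f voter η x ℚ.≤ bad f g x + ∑ (allFin d) λ j → off j (column j x)
      pointwise x = ≤-trans (union (good? f g x) (FinP.all? λ j → g j (column j x) Fin.≟ η j (lookup (column j x) (voter j)))
          (Rounding.fits? f voter η x)
          λ G e j → trans (G j) (trans (e j) (cong (η j) (VecP.lookup-map (voter j) (λ y → rank y j) x))))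
        (ℚP.+-monoʳ-≤ (bad f g x) (ind-¬∀ λ j → g j (column j x) Fin.≟ η j (lookup (column j x) (voter j))))

  distance-≤ : (voter : Fin d → Fin (suc n)) (η : Fin d → Fin d → Fin d) (h : Profile d (suc n) → Perm d) →
    (∀ x → Rounding.Fits f voter η x → f x ≡ h x) →
    ExpDist d (suc n) f h ℚ.≤ K * (K * 1ℚ) * 𝔼 (P ^^ suc n) (Rounding.misfit f voter η)
  distance-≤ voter η h agree = ≤-trans (≤-reflexive (ExpDist-𝔼 d (suc n) f h))
    (≤-trans (mono (P ^^ suc n) λ x → pointwise x (Rounding.fits? f voter η x)) (≤-reflexive (scale (linear (P ^^ suc n)) (K * (K * 1ℚ)) (Rounding.misfit f voter η))))
    where
    pointwise : ∀ x (dec : Dec (Rounding.Fits f voter η x)) → nat (frob2 (f x) (h x)) ℚ.≤ K * (K * 1ℚ) * ind (¬? dec)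
    pointwise x (yes Fx) = ≤-reflexive (trans (trans (cong (λ z → nat (frob2 (f x) z)) (sym (agree x Fx))) (frob2-refl (f x)))
      (sym (ℚP.*-zeroʳ (K * (K * 1ℚ)))))
    pointwise x (no _) = ≤-trans (frob2-≤ (f x) (h x)) (≤-reflexive (sym (ℚP.*-identityʳ (K * (K * 1ℚ)))))

  distance-trivial : ∀ h → ExpDist d (suc n) f h ℚ.≤ K * (K * 1ℚ)
  distance-trivial h = ≤-trans (≤-reflexive (ExpDist-𝔼 d (suc n) f h))
    (≤-trans (mono (P ^^ suc n) λ x → frob2-≤ (f x) (h x)) (≤-reflexive (const (P ^^ suc n) (K * (K * 1ℚ)))))

  module _ (ε : ℚ) (0≤ε : 0ℚ ℚ.≤ ε) (ir : IRsum d (suc n) f ℚ.≤ ε) where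

    private
      -- Bounds twice m² times the misfit probability: 1 + 4 · 772 = 3089 is its ratio to m²b, where
      -- b ≤ mε, and 2 · 3089 = 6178. Rounding applies when this is below 1.
      κ₀ : ℚ
      κ₀ = nat 6178 * (K * (K * (K * (K * (K * ε)))))

      Conclusion : Set
      Conclusion = ∃ λ h → ConstOrDictator d (suc n) h × ExpDist d (suc n) f h ℚ.≤ nat 6178 * nat (d ^ 8) * ε

      K-1 : 0ℚ ℚ.≤ K - 1ℚ
      K-1 = 0≤sub (1≤dim (suc (suc m)))

      0≤K′ : 0ℚ ℚ.≤ K
      0≤K′ = 0≤dim d

      eighth : nat (d ^ 8) ≡ K * (K * (K * (K * (K * (K * (K * (K * 1ℚ)))))))
      eighth = power 8
        where
        fold : ℕ → ℚ
        fold zero = 1ℚ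
        fold (suc e) = K * fold e
        power : ∀ e → nat (d ^ e) ≡ fold e
        power zero = refl
        power (suc e) = trans (nat-* d (d ^ e)) (cong₂ _*_ (sym (dim≡nat d)) (power e))

      bound : ∀ {q} → q ℚ.≤ nat 6178 * (K * (K * (K * (K * (K * (K * (K * (K * 1ℚ)))))))) * ε → q ℚ.≤ nat 6178 * nat (d ^ 8) * ε
      bound = subst (λ z → _ ℚ.≤ nat 6178 * z * ε) (sym eighth)

    -- Any constant will do: the distance is at most m² ≤ m²κ₀ = 6178m⁷ε, and the second term of the
    -- certificate raises m⁷ to m⁸.
    large-violation : 1ℚ ℚ.≤ κ₀ → Conclusion
    large-violation large = (λ _ → identity) , inj₁ (identity , λ _ _ → refl) , bound (≤-trans (distance-trivial λ _ → identity)
      (by-nonneg (0≤+ (0≤* (0≤* 0≤K′ 0≤K′) (0≤sub large))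
          (0≤* (0≤* (0≤nat 6178) K-1) (0≤* (0≤* (0≤* (0≤* 0≤K′ 0≤K′) (0≤* 0≤K′ 0≤K′)) (0≤* (0≤* 0≤K′ 0≤K′) 0≤K′)) 0≤ε)))
        (re (nat 6178) K ε)))
      where
      re : ∀ c K ε → K * K * (c * (K * (K * (K * (K * (K * ε))))) - 1ℚ) + c * (K - 1ℚ) * (K * K * (K * K) * (K * K * K) * ε) ≡
        c * (K * (K * (K * (K * (K * (K * (K * (K * 1ℚ)))))))) * ε - K * (K * 1ℚ)
      re = solve-∀ ringℚ

    module _ (small : κ₀ ℚ.< 1ℚ) where

      private
        g : Fin d → Vec (Fin d) (suc n) → Fin d
        g l = proj₁ (column-determined f l)

        b = 𝔼 (P ^^ suc n) (bad f g)

        b≤ : b ℚ.≤ K * ε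
        b≤ = ≤-trans (bad-≤ f g λ l → proj₂ (column-determined f l)) (*-monoˡ K 0≤K′ ir)

        K³-1 : 0ℚ ℚ.≤ (K - 1ℚ) * (K * K + K + 1ℚ)
        K³-1 = 0≤* K-1 (0≤+ (0≤+ (0≤* 0≤K′ 0≤K′) 0≤K′) (lit 1ℚ))

        few : nat 256 * (K * (nat 4 * b)) ℚ.≤ 1ℚ
        -- Here 1024 = 256 · 4 and 5154 = 6178 - 1024. As b ≤ Kε, the left side is at most 1024K²ε,
        -- which K³ - 1 ≥ 0 lifts to 1024K⁵ε.
        few = by-nonneg (0≤+ (0≤sub (<⇒≤ small)) (0≤+ (0≤* (0≤+ (0≤* (0≤nat 5154) (0≤* (0≤* 0≤K′ 0≤K′) (0≤* (0≤* 0≤K′ 0≤K′) 0≤K′)))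
            (0≤* (0≤nat 1024) (0≤* (0≤* 0≤K′ 0≤K′) K³-1))) 0≤ε) (0≤* (0≤* (0≤nat 1024) 0≤K′) (0≤sub b≤)))) (re K b ε)
          where
          re : ∀ K b ε → 1ℚ - nat 6178 * (K * (K * (K * (K * (K * ε))))) +
            ((nat 5154 * (K * K * (K * K * K)) + nat 1024 * (K * K * ((K - 1ℚ) * (K * K + K + 1ℚ)))) * ε + nat 1024 * K * (K * ε - b)) ≡
            1ℚ - nat 256 * (K * (nat 4 * b))
          re = solve-∀ ringℚ

        voter : Fin d → Fin (suc n)
        voter j = proj₁ (column-dictator g few j)

        η : Fin d → Fin d → Fin d
        η j = proj₁ (proj₂ (column-dictator g few j))

        κ = 𝔼 (P ^^ suc n) (Rounding.misfit f voter η)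

        κ≤ : κ ℚ.≤ b + K * (nat 772 * (K * (nat 4 * b)))
        κ≤ = misfit-≤ g few voter η λ j → proj₂ (proj₂ (column-dictator g few j))

        K²κ≤ : nat 2 * (K * (K * κ)) ℚ.≤ κ₀
        K²κ≤ = by-nonneg (0≤* (lit (nat 2)) (0≤+ (0≤* (0≤* 0≤K′ 0≤K′) (0≤sub κ≤))
            (0≤+ (0≤* (0≤* (0≤* 0≤K′ 0≤K′) (0≤+ (lit 1ℚ) (0≤* (0≤nat 3088) (0≤* 0≤K′ 0≤K′)))) (0≤sub b≤))
              (0≤* (0≤* (0≤* K-1 (0≤+ 0≤K′ (lit 1ℚ))) (0≤* (0≤* 0≤K′ 0≤K′) 0≤K′)) 0≤ε)))) (re K κ b ε)
          where
          re : ∀ K κ b ε → nat 2 * (K * K * (b + K * (nat 772 * (K * (nat 4 * b))) - κ) +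
              (K * K * (1ℚ + nat 3088 * (K * K)) * (K * ε - b) + (K - 1ℚ) * (K + 1ℚ) * (K * K * K) * ε)) ≡
            nat 6178 * (K * (K * (K * (K * (K * ε))))) - nat 2 * (K * (K * κ))
          re = solve-∀ ringℚ

        rounded : ∃ λ h → ConstOrDictator d (suc n) h × (∀ x → Rounding.Fits f voter η x → f x ≡ h x)
        rounded = Rounding.rounding f voter η (Rounding.exchangeable f voter η (ℚP.≤-<-trans K²κ≤ small))

      -- On fitting profiles `f` and `h` coincide, so the distance is at most m²κ ≤ κ₀, of order
      -- m⁵ε; K³ - 1 ≥ 0 raises it to m⁸.
      small-violation : Conclusion
      small-violation = proj₁ rounded , proj₁ (proj₂ rounded) , bound (≤-trans (distance-≤ voter η (proj₁ rounded) (proj₂ (proj₂ rounded)))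
        (by-nonneg (0≤+ (0≤+ (0≤sub K²κ≤) (0≤* (0≤* 0≤K′ 0≤K′) (nonneg (P ^^ suc n) λ x → 0≤ind (¬? (Rounding.fits? f voter η x)))))
            (0≤* (0≤nat 6178) (0≤* (0≤* K³-1 (0≤* (0≤* 0≤K′ 0≤K′) (0≤* (0≤* 0≤K′ 0≤K′) 0≤K′))) 0≤ε)))
          (re (nat 6178) K κ ε)))
        where
        re : ∀ c K κ ε → c * (K * (K * (K * (K * (K * ε))))) - nat 2 * (K * (K * κ)) + K * K * κ +
            c * ((K - 1ℚ) * (K * K + K + 1ℚ) * (K * K * (K * K * K)) * ε) ≡
          c * (K * (K * (K * (K * (K * (K * (K * (K * 1ℚ)))))))) * ε - K * (K * 1ℚ) * κ
        re = solve-∀ ringℚ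

    near-const-or-dictator : Conclusion
    near-const-or-dictator = decide (κ₀ ℚP.<? 1ℚ)
      where
      decide : Dec (κ₀ ℚ.< 1ℚ) → Conclusion
      decide (yes small) = small-violation small
      decide (no large) = large-violation (≮⇒≥ large)

theorem3p5 : Σ ℚ (λ C → (0ℚ ℚ.< C) ×
    ((m n : ℕ) → 3 ≤ m → 1 ≤ n → (ε : ℚ) → 0ℚ ℚ.≤ ε →
    (f : Profile m n → Perm m) → IRsum m n f ℚ.≤ ε →
    Σ (Profile m n → Perm m) (λ h → ConstOrDictator m n h ×
    (ExpDist m n f h ℚ.≤ C * ((+ (m ^ 8)) / 1) * ε))))
theorem3p5 = nat 6178 , ℚP.positive⁻¹ (nat 6178) , bound
  where
  bound : (m n : ℕ) → 3 ≤ m → 1 ≤ n → (ε : ℚ) → 0ℚ ℚ.≤ ε →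
    (f : Profile m n → Perm m) → IRsum m n f ℚ.≤ ε →
    Σ (Profile m n → Perm m) (λ h → ConstOrDictator m n h ×
    (ExpDist m n f h ℚ.≤ nat 6178 * ((+ (m ^ 8)) / 1) * ε))
  bound (suc (suc (suc m))) (suc n) _ _ ε 0≤ε f ir = near-const-or-dictator f ε 0≤ε ir
  bound 0 _ ()
  bound 1 _ (s≤s ())
  bound 2 _ (s≤s (s≤s ()))
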